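{- Let $N\ge1$ and let $\lambda$ be a partition with $0<\ell(\lambda)<N$. Then the following identity of polynomials in $x_1,\ldots,x_N$ with coefficients in $\mathbb{Z}[t]$ holds: $$\sum_{i=1}^N(-1)^{i+1}x_i^{N-1}\Delta^{(i)}\Bigl(Q_\lambda^{(i)}\bigl(1-t^{\ell(\lambda)}\bigr)+\sum_{\substack{\ell(\mu)=\ell(\lambda)\\ \mu\ne\lambda}}x_i^{n}\,Q_\mu^{(i)}\,\phi_{\lambda\mu}(t)\Bigr)=0,$$ where the inner sum is over partitions $\mu\neq\lambda$ with $\ell(\mu)=\ell(\lambda)$ (only those with $\phi_{\lambda\mu}(t)\neq0$ contribute), and $n$ is determined by $\lambda$ and $\mu$ via $n=(\lambda_1-\mu_1)+(\lambda_2-\mu_2)+\cdots$.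
   Context: $t$ is a formal parameter; $\ell(\lambda)$ is the number of non-zero parts of the partition $\lambda$, $\lambda'$ denotes the conjugate partition, and $k_i$ denotes the multiplicity of the part $i$ in $\lambda$. $\Delta^{(i)}=\Delta(x_1,\ldots,\widehat{x}_i,\ldots,x_N)$ is the Vandermonde product $\prod_{a<b;\ a,b\ne i}(x_a-x_b)$ in the $N-1$ variables other than $x_i$ (equal to $1$ if there is only one such variable), and $Q_\mu^{(i)}=Q_\mu(x_1,\ldots,\widehat{x}_i,\ldots,x_N)$ is the Hall-Littlewood polynomial in the same $N-1$ variables (hats denote omitted variables). Hall-Littlewood polynomials in $M$ variables: for a partition $\mu$ with $\ell(\mu)\le M$, let $m_i$ be the multiplicity of the part $i\ge1$ in $\mu$, let $m_0=M-\ell(\mu)$, and let $v_\mu(t)=\prod_{i\ge0}\prod_{j=1}^{m_i}\frac{1-t^j}{1-t}$, $b_\mu(t)=\prod_{i\ge1}\prod_{j=1}^{m_i}(1-t^j)$. Then $P_\mu(x_1,\ldots,x_M)$ is $v_\mu(t)^{ -1}$ times the sum of all $M!$ products obtained from $x_1^{\mu_1}\cdots x_M^{\mu_M}\prod_{1\le i<j\le M}\frac{x_i-t\,x_j}{x_i-x_j}$ by permuting the variables, and $Q_\mu(x_1,\ldots,x_M)=b_\mu(t)P_\mu(x_1,\ldots,x_M)$. The coefficients $\phi_{\lambda\mu}(t)$ are those of the multiplication formula $Q_nP_\mu=\sum_\lambda\phi_{\lambda\mu}(t)P_\lambda$ for Hall-Littlewood symmetric functions, where $Q_n=Q_{(n)}$.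 Explicitly, $\phi_{\lambda\mu}(t)=0$ unless $\lambda_1\ge\mu_1\ge\lambda_2\ge\mu_2\ge\cdots$; when these inequalities hold, $\phi_{\lambda\mu}(t)$ is the product of $1-t^{k_i}$ over all $i\ge1$ such that $\lambda'_i-\mu'_i>\lambda'_{i+1}-\mu'_{i+1}$. -}

module Defs where

open import Level using (0ℓ)
open import Algebra.Bundles using (CommutativeRing)
open import Algebra.Structures using (IsCommutativeRing)
open import Data.Nat as ℕ using (ℕ; zero; suc; _∸_)
import Data.Nat.Properties as ℕₚ
import Data.Integer.Properties as ℤₚ
open import Data.Fin as Fin using (Fin; toℕ)
import Data.Fin.Properties as Finₚ
open import Data.Fin.Permutation as Perm using (Permutation′; _⟨$⟩ʳ_)
open import Data.List as List
  using (List; []; _∷_; length; map; foldr; filter; upTo; allFin;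
         cartesianProduct; cartesianProductWith; zipWith)
open import Data.List.Properties using (≡-dec)
open import Data.Nat.ListAction using (sum)
open import Data.List.Membership.Propositional using (_∈_)
open import Data.List.Membership.Propositional.Properties
  using (∈-filter⁺; ∈-filter⁻; ∈-cartesianProductWith⁺; ∈-cartesianProductWith⁻; ∈-upTo⁺)
open import Data.List.Relation.Unary.All as All using (All; all?)
open import Data.List.Relation.Unary.Any using (here)
open import Data.List.Relation.Unary.AllPairs using ([]; _∷_)
open import Data.List.Relation.Unary.Linked using (Linked; linked?)
open import Data.List.Relation.Unary.Unique.Propositional using (Unique)
import Data.List.Relation.Unary.Unique.Propositional.Properties as Uniqueₚ
open import Data.Product as Product using (_×_; _,_; proj₁; proj₂)
open import Data.Sum as Sum using (_⊎_; inj₁; inj₂)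
open import Data.Vec.Functional using (Vector; removeAt)
open import Function using (_∘_)
open import Relation.Binary using (Decidable; IsEquivalence; Setoid)
open import Relation.Binary.PropositionalEquality as ≡ using (_≡_; _≢_)
open import Relation.Nullary using (¬_; Dec; yes; no; contradiction)
open import Relation.Nullary.Decidable using (map′; _×-dec_; ¬?)
import Relation.Binary.Reasoning.Setoid as SetoidReasoning
import Algebra.Properties.Ring as RingProperties
import Algebra.Solver.Ring.NaturalCoefficients.Default as SemiringSolver

record DecidableDomain : Set₁ where
  field
    commutativeRing : CommutativeRing 0ℓ 0ℓ
  open CommutativeRing commutativeRing public
  field
    _≈?_        : Decidable _≈_
    1≉0         : 1# ≉ 0#
    zeroProduct : ∀ x y → x * y ≈ 0# → x ≈ 0# ⊎ y ≈ 0#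

ℤ-domain : DecidableDomain
ℤ-domain = record
  { commutativeRing = ℤₚ.+-*-commutativeRing
  ; _≈?_            = ℤₚ._≟_
  ; 1≉0             = λ ()
  ; zeroProduct     = λ x y → ℤₚ.i*j≡0⇒i≡0∨j≡0 x
  }

-- Polynomials in one variable are coefficient lists, lowest degree first; lists
-- differing by trailing zeros are identified by _≋_.
module Polynomials (D : DecidableDomain) where
  open DecidableDomain D
  private
    module S = SetoidReasoning setoid
    module RS = SemiringSolver commutativeSemiring
    open RS using (_:=_; _:+_)

  Poly : Set
  Poly = List Carrier

  coeff : Poly → ℕ → Carrier
  coeff []      _       = 0#
  coeff (a ∷ p) zero    = a
  coeff (a ∷ p) (suc k) = coeff p k

  infix 4 _≋_
  record _≋_ (p q : Poly) : Set where
    constructor coeffs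
    field at : ∀ k → coeff p k ≈ coeff q k
  open _≋_ public

  infixl 6 _⊕_
  infixl 7 _⊗_ _·_

  _⊕_ : Poly → Poly → Poly
  []      ⊕ q       = q
  (a ∷ p) ⊕ []      = a ∷ p
  (a ∷ p) ⊕ (b ∷ q) = (a + b) ∷ (p ⊕ q)

  ⊖_ : Poly → Poly
  ⊖ p = map -_ p

  _·_ : Carrier → Poly → Poly
  c · p = map (c *_) p

  _⊗_ : Poly → Poly → Poly
  []      ⊗ q = []
  (a ∷ p) ⊗ q = a · q ⊕ (0# ∷ p ⊗ q)

  constant : Carrier → Poly
  constant a = a ∷ []

  X : Poly
  X = 0# ∷ 1# ∷ []

  private
    0≈-0 : 0# ≈ - 0#
    0≈-0 = trans (sym (-‿inverseʳ 0#)) (+-identityˡ _)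

    ⊕-at : ∀ p q k → coeff (p ⊕ q) k ≈ coeff p k + coeff q k
    ⊕-at []      q       k       = sym (+-identityˡ _)
    ⊕-at (a ∷ p) []      k       = sym (+-identityʳ _)
    ⊕-at (a ∷ p) (b ∷ q) zero    = refl
    ⊕-at (a ∷ p) (b ∷ q) (suc k) = ⊕-at p q k

    ⊖-at : ∀ p k → coeff (⊖ p) k ≈ - coeff p k
    ⊖-at []      k       = 0≈-0
    ⊖-at (a ∷ p) zero    = refl
    ⊖-at (a ∷ p) (suc k) = ⊖-at p k

    ·-at : ∀ c p k → coeff (c · p) k ≈ c * coeff p k
    ·-at c []      k       = sym (zeroʳ c)
    ·-at c (a ∷ p) zero    = refl
    ·-at c (a ∷ p) (suc k) = ·-at c p k

    ≋-refl : ∀ {p} → p ≋ p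
    ≋-refl = coeffs λ _ → refl

    ≋-sym : ∀ {p q} → p ≋ q → q ≋ p
    ≋-sym e = coeffs λ k → sym (at e k)

    ≋-trans : ∀ {p q r} → p ≋ q → q ≋ r → p ≋ r
    ≋-trans e f = coeffs λ k → trans (at e k) (at f k)

    ∷-cong : ∀ {a b p q} → a ≈ b → p ≋ q → a ∷ p ≋ b ∷ q
    ∷-cong a≈b e = coeffs λ { zero → a≈b ; (suc k) → at e k }

    ∷-zero : ∀ {a p} → a ≈ 0# → p ≋ [] → a ∷ p ≋ []
    ∷-zero a≈0 e = coeffs λ { zero → a≈0 ; (suc k) → at e k }

    tail : ∀ {a b p q} → a ∷ p ≋ b ∷ q → p ≋ q
    tail e = coeffs λ k → at e (suc k)

    tail₀ : ∀ {a p} → a ∷ p ≋ [] → p ≋ []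
    tail₀ e = coeffs λ k → at e (suc k)

    ⊕-cong : ∀ {p p′ q q′} → p ≋ p′ → q ≋ q′ → p ⊕ q ≋ p′ ⊕ q′
    ⊕-cong {p} {p′} {q} {q′} e f = coeffs λ k →
      trans (⊕-at p q k) (trans (+-cong (at e k) (at f k)) (sym (⊕-at p′ q′ k)))

    ⊕-assoc : ∀ p q r → (p ⊕ q) ⊕ r ≋ p ⊕ (q ⊕ r)
    ⊕-assoc p q r = coeffs λ k → S.begin
      coeff ((p ⊕ q) ⊕ r) k                 S.≈⟨ ⊕-at (p ⊕ q) r k ⟩
      coeff (p ⊕ q) k + coeff r k           S.≈⟨ +-congʳ (⊕-at p q k) ⟩
      coeff p k + coeff q k + coeff r k     S.≈⟨ +-assoc _ _ _ ⟩
      coeff p k + (coeff q k + coeff r k)   S.≈⟨ +-congˡ (⊕-at q r k) ⟨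
      coeff p k + coeff (q ⊕ r) k           S.≈⟨ ⊕-at p (q ⊕ r) k ⟨
      coeff (p ⊕ (q ⊕ r)) k                 S.∎

    ⊕-comm : ∀ p q → p ⊕ q ≋ q ⊕ p
    ⊕-comm p q = coeffs λ k →
      trans (⊕-at p q k) (trans (+-comm _ _) (sym (⊕-at q p k)))

    ⊕-identityʳ : ∀ p → p ⊕ [] ≋ p
    ⊕-identityʳ p = ⊕-comm p []

    ⊖-inverseˡ : ∀ p → (⊖ p) ⊕ p ≋ []
    ⊖-inverseˡ p = coeffs λ k →
      trans (⊕-at (⊖ p) p k) (trans (+-congʳ (⊖-at p k)) (-‿inverseˡ _))

    ⊖-cong : ∀ {p q} → p ≋ q → ⊖ p ≋ ⊖ q
    ⊖-cong {p} {q} e = coeffs λ k →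
      trans (⊖-at p k) (trans (-‿cong (at e k)) (sym (⊖-at q k)))

    ·-cong : ∀ {a b p q} → a ≈ b → p ≋ q → a · p ≋ b · q
    ·-cong {a} {b} {p} {q} a≈b e = coeffs λ k →
      trans (·-at a p k) (trans (*-cong a≈b (at e k)) (sym (·-at b q k)))

    ·-distribˡ : ∀ c p q → c · (p ⊕ q) ≋ c · p ⊕ c · q
    ·-distribˡ c p q = coeffs λ k → S.begin
      coeff (c · (p ⊕ q)) k               S.≈⟨ ·-at c (p ⊕ q) k ⟩
      c * coeff (p ⊕ q) k                 S.≈⟨ *-congˡ (⊕-at p q k) ⟩
      c * (coeff p k + coeff q k)         S.≈⟨ distribˡ c _ _ ⟩
      c * coeff p k + c * coeff q k       S.≈⟨ +-cong (·-at c p k) (·-at c q k) ⟨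
      coeff (c · p) k + coeff (c · q) k   S.≈⟨ ⊕-at (c · p) (c · q) k ⟨
      coeff (c · p ⊕ c · q) k             S.∎

    ·-assoc : ∀ a b p → (a * b) · p ≋ a · (b · p)
    ·-assoc a b p = coeffs λ k → S.begin
      coeff ((a * b) · p) k   S.≈⟨ ·-at (a * b) p k ⟩
      a * b * coeff p k       S.≈⟨ *-assoc a b _ ⟩
      a * (b * coeff p k)     S.≈⟨ *-congˡ (·-at b p k) ⟨
      a * coeff (b · p) k     S.≈⟨ ·-at a (b · p) k ⟨
      coeff (a · (b · p)) k   S.∎

    1-· : ∀ p → 1# · p ≋ p
    1-· p = coeffs λ k → trans (·-at 1# p k) (*-identityˡ _)

    0-· : ∀ {a} p → a ≈ 0# → a · p ≋ []
    0-· p a≈0 = coeffs λ k → trans (·-at _ p k) (trans (*-congʳ a≈0) (zeroˡ _))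

    ⊕-medial : ∀ p q r s → (p ⊕ q) ⊕ (r ⊕ s) ≋ (p ⊕ r) ⊕ (q ⊕ s)
    ⊕-medial p q r s = coeffs λ k →
      trans (expand p q r s k) (trans (medial _ _ _ _) (sym (expand p r q s k)))
      where
      expand : ∀ p q r s k → coeff ((p ⊕ q) ⊕ (r ⊕ s)) k
                           ≈ (coeff p k + coeff q k) + (coeff r k + coeff s k)
      expand p q r s k =
        trans (⊕-at (p ⊕ q) (r ⊕ s) k) (+-cong (⊕-at p q k) (⊕-at r s k))
      medial : ∀ a b c d → (a + b) + (c + d) ≈ (a + c) + (b + d)
      medial = RS.solve 4 (λ a b c d →
        (a :+ b) :+ (c :+ d) := (a :+ c) :+ (b :+ d)) refl

    ≋-isEquivalence : IsEquivalence _≋_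
    ≋-isEquivalence = record { refl = ≋-refl ; sym = ≋-sym ; trans = ≋-trans }

    ≋-setoid : Setoid 0ℓ 0ℓ
    ≋-setoid = record { isEquivalence = ≋-isEquivalence }

    open SetoidReasoning ≋-setoid

    shift-⊕ : ∀ p q → 0# ∷ (p ⊕ q) ≋ (0# ∷ p) ⊕ (0# ∷ q)
    shift-⊕ p q = ∷-cong (sym (+-identityˡ 0#)) ≋-refl

    shift-⊗ : ∀ p q → (0# ∷ p) ⊗ q ≋ 0# ∷ p ⊗ q
    shift-⊗ p q = ⊕-cong (0-· q refl) (≋-refl {0# ∷ p ⊗ q})

    ⊗-zeroʳ : ∀ p → p ⊗ [] ≋ []
    ⊗-zeroʳ []      = ≋-refl
    ⊗-zeroʳ (a ∷ p) = ∷-zero refl (⊗-zeroʳ p)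

    ⊗-consʳ : ∀ p b q → p ⊗ (b ∷ q) ≋ b · p ⊕ (0# ∷ p ⊗ q)
    ⊗-consʳ []      b q = ≋-sym (∷-zero refl ≋-refl)
    ⊗-consʳ (a ∷ p) b q = ∷-cong (+-congʳ (*-comm a b)) (begin
      a · q ⊕ p ⊗ (b ∷ q)                ≈⟨ ⊕-cong (≋-refl {a · q}) (⊗-consʳ p b q) ⟩
      a · q ⊕ (b · p ⊕ (0# ∷ p ⊗ q))     ≈⟨ ⊕-assoc (a · q) (b · p) _ ⟨
      (a · q ⊕ b · p) ⊕ (0# ∷ p ⊗ q)     ≈⟨ ⊕-cong (⊕-comm (a · q) (b · p)) ≋-refl ⟩
      (b · p ⊕ a · q) ⊕ (0# ∷ p ⊗ q)     ≈⟨ ⊕-assoc (b · p) (a · q) _ ⟩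
      b · p ⊕ (a · q ⊕ (0# ∷ p ⊗ q))     ∎)

    ⊗-comm : ∀ p q → p ⊗ q ≋ q ⊗ p
    ⊗-comm []      q = ≋-sym (⊗-zeroʳ q)
    ⊗-comm (a ∷ p) q = begin
      a · q ⊕ (0# ∷ p ⊗ q)   ≈⟨ ⊕-cong (≋-refl {a · q}) (∷-cong refl (⊗-comm p q)) ⟩
      a · q ⊕ (0# ∷ q ⊗ p)   ≈⟨ ⊗-consʳ q a p ⟨
      q ⊗ (a ∷ p)            ∎

    ⊗-congˡ : ∀ p {q q′} → q ≋ q′ → p ⊗ q ≋ p ⊗ q′
    ⊗-congˡ []      e = ≋-refl
    ⊗-congˡ (a ∷ p) e = ⊕-cong (·-cong refl e) (∷-cong refl (⊗-congˡ p e))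

    ⊗-cong : ∀ {p p′ q q′} → p ≋ p′ → q ≋ q′ → p ⊗ q ≋ p′ ⊗ q′
    ⊗-cong {p} {p′} {q} {q′} e f = begin
      p ⊗ q     ≈⟨ ⊗-congˡ p f ⟩
      p ⊗ q′    ≈⟨ ⊗-comm p q′ ⟩
      q′ ⊗ p    ≈⟨ ⊗-congˡ q′ e ⟩
      q′ ⊗ p′   ≈⟨ ⊗-comm q′ p′ ⟩
      p′ ⊗ q′   ∎

    ⊗-distribˡ : ∀ p q r → p ⊗ (q ⊕ r) ≋ p ⊗ q ⊕ p ⊗ r
    ⊗-distribˡ []      q r = ≋-refl
    ⊗-distribˡ (a ∷ p) q r = begin
      a · (q ⊕ r) ⊕ (0# ∷ p ⊗ (q ⊕ r))
        ≈⟨ ⊕-cong (·-distribˡ a q r) (∷-cong refl (⊗-distribˡ p q r)) ⟩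
      (a · q ⊕ a · r) ⊕ (0# ∷ (p ⊗ q ⊕ p ⊗ r))
        ≈⟨ ⊕-cong (≋-refl {a · q ⊕ a · r}) (shift-⊕ (p ⊗ q) (p ⊗ r)) ⟩
      (a · q ⊕ a · r) ⊕ ((0# ∷ p ⊗ q) ⊕ (0# ∷ p ⊗ r))
        ≈⟨ ⊕-medial (a · q) (a · r) (0# ∷ p ⊗ q) (0# ∷ p ⊗ r) ⟩
      (a · q ⊕ (0# ∷ p ⊗ q)) ⊕ (a · r ⊕ (0# ∷ p ⊗ r)) ∎

    ⊗-distribʳ : ∀ p q r → (q ⊕ r) ⊗ p ≋ q ⊗ p ⊕ r ⊗ p
    ⊗-distribʳ p q r = begin
      (q ⊕ r) ⊗ p      ≈⟨ ⊗-comm (q ⊕ r) p ⟩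
      p ⊗ (q ⊕ r)      ≈⟨ ⊗-distribˡ p q r ⟩
      p ⊗ q ⊕ p ⊗ r    ≈⟨ ⊕-cong (⊗-comm p q) (⊗-comm p r) ⟩
      q ⊗ p ⊕ r ⊗ p    ∎

    ·-⊗ : ∀ a p q → (a · p) ⊗ q ≋ a · (p ⊗ q)
    ·-⊗ a []      q = ≋-refl
    ·-⊗ a (b ∷ p) q = begin
      (a * b) · q ⊕ (0# ∷ (a · p) ⊗ q)
        ≈⟨ ⊕-cong (·-assoc a b q) (∷-cong (sym (zeroʳ a)) (·-⊗ a p q)) ⟩
      a · (b · q) ⊕ a · (0# ∷ p ⊗ q)
        ≈⟨ ·-distribˡ a (b · q) (0# ∷ p ⊗ q) ⟨
      a · (b · q ⊕ (0# ∷ p ⊗ q)) ∎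

    ⊗-assoc : ∀ p q r → (p ⊗ q) ⊗ r ≋ p ⊗ (q ⊗ r)
    ⊗-assoc []      q r = ≋-refl
    ⊗-assoc (a ∷ p) q r = begin
      (a · q ⊕ (0# ∷ p ⊗ q)) ⊗ r
        ≈⟨ ⊗-distribʳ r (a · q) (0# ∷ p ⊗ q) ⟩
      (a · q) ⊗ r ⊕ (0# ∷ p ⊗ q) ⊗ r
        ≈⟨ ⊕-cong (·-⊗ a q r) (shift-⊗ (p ⊗ q) r) ⟩
      a · (q ⊗ r) ⊕ (0# ∷ (p ⊗ q) ⊗ r)
        ≈⟨ ⊕-cong (≋-refl {a · (q ⊗ r)}) (∷-cong refl (⊗-assoc p q r)) ⟩
      a · (q ⊗ r) ⊕ (0# ∷ p ⊗ (q ⊗ r)) ∎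

    ⊗-identityˡ : ∀ p → constant 1# ⊗ p ≋ p
    ⊗-identityˡ p = begin
      1# · p ⊕ (0# ∷ [])   ≈⟨ ⊕-cong (1-· p) (∷-zero refl ≋-refl) ⟩
      p ⊕ []               ≈⟨ ⊕-identityʳ p ⟩
      p                    ∎

    ⊗-isCommutativeRing : IsCommutativeRing _≋_ _⊕_ _⊗_ ⊖_ [] (constant 1#)
    ⊗-isCommutativeRing = record
      { isRing = record
        { +-isAbelianGroup = record
          { isGroup = record
            { isMonoid = record
              { isSemigroup = record
                { isMagma = record
                  { isEquivalence = ≋-isEquivalence
                  ; ∙-cong        = ⊕-cong }
                ; assoc = ⊕-assoc }
              ; identity = (λ _ → ≋-refl) , ⊕-identityʳ }
            ; inverse = ⊖-inverseˡ , (λ p → ≋-trans (⊕-comm p (⊖ p)) (⊖-inverseˡ p))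
            ; ⁻¹-cong = ⊖-cong }
          ; comm = ⊕-comm }
        ; *-cong     = ⊗-cong
        ; *-assoc    = ⊗-assoc
        ; *-identity = ⊗-identityˡ , (λ p → ≋-trans (⊗-comm p _) (⊗-identityˡ p))
        ; distrib    = ⊗-distribˡ , ⊗-distribʳ }
      ; *-comm = ⊗-comm }

    _≋?_ : Decidable _≋_
    []      ≋? []      = yes ≋-refl
    []      ≋? (b ∷ q) =
      map′ (λ (h , e) → ≋-sym (∷-zero h (≋-sym e)))
           (λ e → sym (at e 0) , ≋-sym (tail₀ (≋-sym e)))
           ((b ≈? 0#) ×-dec ([] ≋? q))
    (a ∷ p) ≋? []      =
      map′ (λ (h , e) → ∷-zero h e) (λ e → at e 0 , tail₀ e)
           ((a ≈? 0#) ×-dec (p ≋? []))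
    (a ∷ p) ≋? (b ∷ q) =
      map′ (λ (h , e) → ∷-cong h e) (λ e → at e 0 , tail e)
           ((a ≈? b) ×-dec (p ≋? q))

    zeroProduct-step : ∀ a p b q →
      (p ⊗ (b ∷ q) ≋ [] → p ≋ [] ⊎ b ∷ q ≋ []) →
      ((a ∷ p) ⊗ q ≋ [] → a ∷ p ≋ [] ⊎ q ≋ []) →
      (a ∷ p) ⊗ (b ∷ q) ≋ [] → a ∷ p ≋ [] ⊎ b ∷ q ≋ []
    zeroProduct-step a p b q ih₁ ih₂ e with a ≈? 0#
    ... | yes a≈0 = Sum.map₁ (∷-zero a≈0) (ih₁ (tail₀ (begin
      0# ∷ p ⊗ (b ∷ q)                      ≈⟨ ⊕-cong (0-· (b ∷ q) a≈0) ≋-refl ⟨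
      a · (b ∷ q) ⊕ (0# ∷ p ⊗ (b ∷ q))      ≈⟨ e ⟩
      []                                    ∎)))
    ... | no  a≉0 = Sum.map₂ (∷-zero b≈0) (ih₂ (tail₀ (begin
      0# ∷ (a ∷ p) ⊗ q                      ≈⟨ ⊕-cong (0-· (a ∷ p) b≈0) ≋-refl ⟨
      b · (a ∷ p) ⊕ (0# ∷ (a ∷ p) ⊗ q)      ≈⟨ ⊗-consʳ (a ∷ p) b q ⟨
      (a ∷ p) ⊗ (b ∷ q)                     ≈⟨ e ⟩
      []                                    ∎)))
      where
      b≈0 : b ≈ 0#
      b≈0 with zeroProduct a b (trans (sym (+-identityʳ _)) (at e 0))
      ... | inj₁ a≈0 = contradiction a≈0 a≉0
      ... | inj₂ b≈0 = b≈0

    ⊗-zeroProduct : ∀ p q → p ⊗ q ≋ [] → p ≋ [] ⊎ q ≋ []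
    ⊗-zeroProduct []      q       _ = inj₁ ≋-refl
    ⊗-zeroProduct (a ∷ p) []      _ = inj₂ ≋-refl
    ⊗-zeroProduct (a ∷ p) (b ∷ q) =
      zeroProduct-step a p b q (⊗-zeroProduct p (b ∷ q)) (⊗-zeroProduct (a ∷ p) q)

  domain : DecidableDomain
  domain = record
    { commutativeRing = record { isCommutativeRing = ⊗-isCommutativeRing }
    ; _≈?_            = _≋?_
    ; 1≉0             = λ e → 1≉0 (at e 0)
    ; zeroProduct     = ⊗-zeroProduct
    }

module Fractions (D : DecidableDomain) where
  open DecidableDomain D
  private
    module RS = SemiringSolver commutativeSemiring
    open RS using (_:=_; _:+_; _:*_)

  record Fraction : Set where
    constructor mkFraction
    field
      num   : Carrier
      den   : Carrier
      den≉0 : den ≉ 0#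
  open Fraction public

  infix 4 _≃_
  record _≃_ (f g : Fraction) : Set where
    constructor cross
    field crossEq : num f * den g ≈ num g * den f
  open _≃_ public

  private
    den-* : ∀ {a b} → a ≉ 0# → b ≉ 0# → a * b ≉ 0#
    den-* a≉0 b≉0 e with zeroProduct _ _ e
    ... | inj₁ a≈0 = a≉0 a≈0
    ... | inj₂ b≈0 = b≉0 b≈0

  embed : Carrier → Fraction
  embed a = mkFraction a 1# 1≉0

  _+ᶠ_ _*ᶠ_ : Fraction → Fraction → Fraction
  mkFraction a b b≉0 +ᶠ mkFraction c d d≉0 = mkFraction (a * d + c * b) (b * d) (den-* b≉0 d≉0)
  mkFraction a b b≉0 *ᶠ mkFraction c d d≉0 = mkFraction (a * c) (b * d) (den-* b≉0 d≉0)

  -ᶠ_ : Fraction → Fraction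
  -ᶠ mkFraction a b b≉0 = mkFraction (- a) b b≉0

  -- Total inversion: inverts every nonzero fraction and sends zero to zero.
  _⁻¹ : Fraction → Fraction
  mkFraction a b b≉0 ⁻¹ with a ≈? 0#
  ... | yes _   = embed 0#
  ... | no  a≉0 = mkFraction b a a≉0

  private
    cancel : ∀ a {b c} → a ≉ 0# → b * a ≈ c * a → b ≈ c
    cancel a {b} {c} a≉0 e with zeroProduct (b - c) a (begin
        (b - c) * a           ≈⟨ distribʳ a b (- c) ⟩
        b * a + - c * a       ≈⟨ +-congʳ e ⟩
        c * a + - c * a       ≈⟨ distribʳ a c (- c) ⟨
        (c - c) * a           ≈⟨ *-congʳ (-‿inverseʳ c) ⟩
        0# * a                ≈⟨ zeroˡ a ⟩
        0#                    ∎)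
      where open SetoidReasoning setoid
    ... | inj₂ a≈0   = contradiction a≈0 a≉0
    ... | inj₁ b-c≈0 = begin
      b                ≈⟨ +-identityʳ b ⟨
      b + 0#           ≈⟨ +-congˡ (-‿inverseˡ c) ⟨
      b + (- c + c)    ≈⟨ +-assoc b (- c) c ⟨
      (b - c) + c      ≈⟨ +-congʳ b-c≈0 ⟩
      0# + c           ≈⟨ +-identityˡ c ⟩
      c                ∎
      where open SetoidReasoning setoid

    ≃-trans : ∀ {f g h} → f ≃ g → g ≃ h → f ≃ h
    ≃-trans {mkFraction a b _} {mkFraction c d d≉0} {mkFraction e f _} (cross p) (cross q) =
      cross (cancel d d≉0 (begin
        (a * f) * d   ≈⟨ RS.solve 3 (λ a f d → (a :* f) :* d := (a :* d) :* f) refl a f d ⟩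
        (a * d) * f   ≈⟨ *-congʳ p ⟩
        (c * b) * f   ≈⟨ RS.solve 3 (λ c b f → (c :* b) :* f := (c :* f) :* b) refl c b f ⟩
        (c * f) * b   ≈⟨ *-congʳ q ⟩
        (e * d) * b   ≈⟨ RS.solve 3 (λ e d b → (e :* d) :* b := (e :* b) :* d) refl e d b ⟩
        (e * b) * d   ∎))
      where open SetoidReasoning setoid

    ≃-isEquivalence : IsEquivalence _≃_
    ≃-isEquivalence = record
      { refl  = cross refl
      ; sym   = λ (cross e) → cross (sym e)
      ; trans = ≃-trans
      }

    +ᶠ-cong : ∀ {f f′ g g′} → f ≃ f′ → g ≃ g′ → (f +ᶠ g) ≃ (f′ +ᶠ g′)
    +ᶠ-cong {mkFraction a b _} {mkFraction a′ b′ _} {mkFraction c d _} {mkFraction c′ d′ _}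
            (cross p) (cross q) = cross (begin
      (a * d + c * b) * (b′ * d′)
        ≈⟨ RS.solve 6 (λ a b c d b′ d′ → (a :* d :+ c :* b) :* (b′ :* d′)
             := (a :* b′) :* (d :* d′) :+ (c :* d′) :* (b :* b′)) refl a b c d b′ d′ ⟩
      (a * b′) * (d * d′) + (c * d′) * (b * b′)
        ≈⟨ +-cong (*-congʳ p) (*-congʳ q) ⟩
      (a′ * b) * (d * d′) + (c′ * d) * (b * b′)
        ≈⟨ RS.solve 6 (λ a′ b c′ d b′ d′ → (a′ :* b) :* (d :* d′) :+ (c′ :* d) :* (b :* b′)
             := (a′ :* d′ :+ c′ :* b′) :* (b :* d)) refl a′ b c′ d b′ d′ ⟩
      (a′ * d′ + c′ * b′) * (b * d) ∎)
      where open SetoidReasoning setoid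

    *ᶠ-cong : ∀ {f f′ g g′} → f ≃ f′ → g ≃ g′ → (f *ᶠ g) ≃ (f′ *ᶠ g′)
    *ᶠ-cong {mkFraction a b _} {mkFraction a′ b′ _} {mkFraction c d _} {mkFraction c′ d′ _}
            (cross p) (cross q) = cross (begin
      (a * c) * (b′ * d′)
        ≈⟨ RS.solve 4 (λ a c b′ d′ → (a :* c) :* (b′ :* d′) := (a :* b′) :* (c :* d′)) refl a c b′ d′ ⟩
      (a * b′) * (c * d′)
        ≈⟨ *-cong p q ⟩
      (a′ * b) * (c′ * d)
        ≈⟨ RS.solve 4 (λ a c b′ d′ → (a :* b′) :* (c :* d′) := (a :* c) :* (b′ :* d′)) refl a′ c′ b d ⟩
      (a′ * c′) * (b * d) ∎)
      where open SetoidReasoning setoid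

    open RingProperties ring using (-‿distribˡ-*)

    -ᶠ-cong : ∀ {f g} → f ≃ g → (-ᶠ f) ≃ (-ᶠ g)
    -ᶠ-cong {mkFraction a b _} {mkFraction c d _} (cross p) = cross (begin
      - a * d     ≈⟨ -‿distribˡ-* a d ⟨
      - (a * d)   ≈⟨ -‿cong p ⟩
      - (c * b)   ≈⟨ -‿distribˡ-* c b ⟩
      - c * b     ∎)
      where open SetoidReasoning setoid

    +ᶠ-comm : ∀ f g → (f +ᶠ g) ≃ (g +ᶠ f)
    +ᶠ-comm (mkFraction a b _) (mkFraction c d _) = cross
      (RS.solve 4 (λ a b c d → (a :* d :+ c :* b) :* (d :* b)
                             := (c :* b :+ a :* d) :* (b :* d)) refl a b c d)

    +ᶠ-identityˡ : ∀ f → (embed 0# +ᶠ f) ≃ f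
    +ᶠ-identityˡ (mkFraction a b _) = cross (begin
      (0# * b + a * 1#) * b   ≈⟨ *-congʳ (+-cong (zeroˡ b) (*-identityʳ a)) ⟩
      (0# + a) * b            ≈⟨ *-congʳ (+-identityˡ a) ⟩
      a * b                   ≈⟨ *-congˡ (*-identityˡ b) ⟨
      a * (1# * b)            ∎)
      where open SetoidReasoning setoid

    -ᶠ-inverseˡ : ∀ f → ((-ᶠ f) +ᶠ f) ≃ embed 0#
    -ᶠ-inverseˡ (mkFraction a b _) = cross (begin
      (- a * b + a * b) * 1#   ≈⟨ *-identityʳ _ ⟩
      - a * b + a * b          ≈⟨ distribʳ b (- a) a ⟨
      (- a + a) * b            ≈⟨ *-congʳ (-‿inverseˡ a) ⟩
      0# * b                   ≈⟨ zeroˡ b ⟩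
      0#                       ≈⟨ zeroˡ _ ⟨
      0# * (b * b)             ∎)
      where open SetoidReasoning setoid

    *ᶠ-comm : ∀ f g → (f *ᶠ g) ≃ (g *ᶠ f)
    *ᶠ-comm (mkFraction a b _) (mkFraction c d _) = cross
      (*-cong (*-comm a c) (*-comm d b))

    *ᶠ-identityˡ : ∀ f → (embed 1# *ᶠ f) ≃ f
    *ᶠ-identityˡ (mkFraction a b _) = cross
      (trans (*-congʳ (*-identityˡ a)) (*-congˡ (sym (*-identityˡ b))))

    distribˡᶠ : ∀ f g h → (f *ᶠ (g +ᶠ h)) ≃ ((f *ᶠ g) +ᶠ (f *ᶠ h))
    distribˡᶠ (mkFraction a b _) (mkFraction c d _) (mkFraction e f _) = cross
      (RS.solve 6 (λ a b c d e f →
        (a :* (c :* f :+ e :* d)) :* ((b :* d) :* (b :* f))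
        := ((a :* c) :* (b :* f) :+ (a :* e) :* (b :* d)) :* (b :* (d :* f))) refl a b c d e f)

    *ᶠ-isCommutativeRing : IsCommutativeRing _≃_ _+ᶠ_ _*ᶠ_ -ᶠ_ (embed 0#) (embed 1#)
    *ᶠ-isCommutativeRing = record
      { isRing = record
        { +-isAbelianGroup = record
          { isGroup = record
            { isMonoid = record
              { isSemigroup = record
                { isMagma = record
                  { isEquivalence = ≃-isEquivalence
                  ; ∙-cong        = +ᶠ-cong }
                ; assoc = λ { (mkFraction a b _) (mkFraction c d _) (mkFraction e f _) → cross
                    (RS.solve 6 (λ a b c d e f →
                      ((a :* d :+ c :* b) :* f :+ e :* (b :* d)) :* (b :* (d :* f))
                      := (a :* (d :* f) :+ (c :* f :+ e :* d) :* b) :* ((b :* d) :* f))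
                      refl a b c d e f) } }
              ; identity = +ᶠ-identityˡ , (λ f → ≃-trans (+ᶠ-comm f (embed 0#)) (+ᶠ-identityˡ f)) }
            ; inverse = -ᶠ-inverseˡ , (λ f → ≃-trans (+ᶠ-comm f (-ᶠ f)) (-ᶠ-inverseˡ f))
            ; ⁻¹-cong = -ᶠ-cong }
          ; comm = +ᶠ-comm }
        ; *-cong     = *ᶠ-cong
        ; *-assoc    = λ { (mkFraction a b _) (mkFraction c d _) (mkFraction e f _) → cross
            (*-cong (*-assoc a c e) (sym (*-assoc b d f))) }
        ; *-identity = *ᶠ-identityˡ , (λ f → ≃-trans (*ᶠ-comm f (embed 1#)) (*ᶠ-identityˡ f))
        ; distrib    = distribˡᶠ , (λ f g h →
            ≃-trans (*ᶠ-comm (g +ᶠ h) f)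
              (≃-trans (distribˡᶠ f g h) (+ᶠ-cong (*ᶠ-comm f g) (*ᶠ-comm f h)))) }
      ; *-comm = *ᶠ-comm }

  fractionField : CommutativeRing 0ℓ 0ℓ
  fractionField = record { isCommutativeRing = *ᶠ-isCommutativeRing }

  ⁻¹-inverseʳ : ∀ f → ¬ (f ≃ embed 0#) → (f *ᶠ (f ⁻¹)) ≃ embed 1#
  ⁻¹-inverseʳ (mkFraction a b b≉0) f≄0 with a ≈? 0#
  ... | yes a≈0 = contradiction
          (cross (trans (*-congʳ a≈0) (trans (zeroˡ _) (sym (zeroˡ b))))) f≄0
  ... | no  a≉0 = cross (trans (*-identityʳ _) (trans (*-comm a b) (sym (*-identityˡ _))))

module ℤ[t] = Polynomials ℤ-domain

-- ℤ[t][x₁,…,x_N], obtained by adjoining one variable at a time.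
ℤ[t][x] : ℕ → DecidableDomain
ℤ[t][x] zero    = ℤ[t].domain
ℤ[t][x] (suc N) = Polynomials.domain (ℤ[t][x] N)

t-poly : ∀ N → DecidableDomain.Carrier (ℤ[t][x] N)
t-poly zero    = ℤ[t].X
t-poly (suc N) = Polynomials.constant (ℤ[t][x] N) (t-poly N)

x-poly : ∀ N → Fin N → DecidableDomain.Carrier (ℤ[t][x] N)
x-poly (suc N) Fin.zero    = Polynomials.X (ℤ[t][x] N)
x-poly (suc N) (Fin.suc i) = Polynomials.constant (ℤ[t][x] N) (x-poly N i)

-- ℚ(t, x₁, …, x_N), as the field of fractions of ℤ[t][x₁,…,x_N].  Hall–Littlewood
-- polynomials are defined through rational functions, so identities between them are
-- stated in this field, into which ℤ[t][x₁,…,x_N] embeds.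
module RationalFunctions (N : ℕ) where
  open Fractions (ℤ[t][x] N) public using (fractionField; _⁻¹; embed)

  t : CommutativeRing.Carrier fractionField
  t = embed (t-poly N)

  x : Vector (CommutativeRing.Carrier fractionField) N
  x i = embed (x-poly N i)

-- The list holds the nonzero parts only, so ℓ is length.
IsPartition : List ℕ → Set
IsPartition μ = Linked ℕ._≥_ μ × All (0 ℕ.<_) μ

isPartition? : ∀ μ → Dec (IsPartition μ)
isPartition? μ = linked? ℕ._≥?_ μ ×-dec all? (0 ℕ.<?_) μ

-- part μ k is μ_{k+1}, and is 0 beyond the last part.
part : List ℕ → ℕ → ℕ
part []      _       = 0
part (a ∷ μ) zero    = a
part (a ∷ μ) (suc k) = part μ k

multiplicity : List ℕ → ℕ → ℕ
multiplicity μ i = length (filter (i ℕ.≟_) μ)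

-- conjugate μ i is the i-th part (i ≥ 1) of the conjugate partition.
conjugate : List ℕ → ℕ → ℕ
conjugate μ i = length (filter (i ℕ.≤?_) μ)

-- λ₁ ≥ μ₁ ≥ λ₂ ≥ μ₂ ≥ ⋯
Interlacing : List ℕ → List ℕ → Set
Interlacing lam μ = ∀ k → part μ k ℕ.≤ part lam k × part lam (suc k) ℕ.≤ part μ k

private
  part-beyond : ∀ μ {k} → length μ ℕ.≤ k → part μ k ≡ 0
  part-beyond []      _           = ≡.refl
  part-beyond (a ∷ μ) (ℕ.s≤s μ≤k) = part-beyond μ μ≤k

interlacing? : ∀ lam μ → Dec (Interlacing lam μ)
interlacing? lam μ = map′ extend (λ I {k} _ → I k)
  (ℕₚ.allUpTo? (λ k → (part μ k ℕ.≤? part lam k) ×-dec (part lam (suc k) ℕ.≤? part μ k)) L)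
  where
  L : ℕ
  L = length lam ℕ.+ length μ
  extend : (∀ {k} → k ℕ.< L → part μ k ℕ.≤ part lam k × part lam (suc k) ℕ.≤ part μ k) →
           Interlacing lam μ
  extend bounded k with k ℕ.<? L
  ... | yes k<L = bounded k<L
  ... | no  k≮L
    rewrite part-beyond μ {k} (ℕₚ.≤-trans (ℕₚ.m≤n+m _ (length lam)) (ℕₚ.≮⇒≥ k≮L))
          | part-beyond lam {suc k} (ℕₚ.m≤n⇒m≤1+n (ℕₚ.≤-trans (ℕₚ.m≤m+n _ (length μ)) (ℕₚ.≮⇒≥ k≮L)))
    = ℕ.z≤n , ℕ.z≤n

listsBelow : List ℕ → List (List ℕ)
listsBelow []        = [] ∷ []
listsBelow (a ∷ lam) = cartesianProductWith _∷_ (upTo (suc a)) (listsBelow lam)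

-- The partitions μ ≠ λ with ℓ(μ) = ℓ(λ) and μᵢ ≤ λᵢ for all i, each listed once.
-- The bound keeps the list finite; it discards no μ with φ_{λμ} ≠ 0, since φ_{λμ}
-- vanishes unless λ and μ interlace (see ∈-innerIndices⁺).
innerIndices : List ℕ → List (List ℕ)
innerIndices lam =
  filter (λ μ → isPartition? μ ×-dec ¬? (≡-dec ℕ._≟_ μ lam)) (listsBelow lam)

∈-innerIndices⁺ : ∀ {lam μ} → IsPartition μ → length μ ≡ length lam → μ ≢ lam →
                  Interlacing lam μ → μ ∈ innerIndices lam
∈-innerIndices⁺ {lam} {μ} μ-part ℓ≡ μ≢lam I =
  ∈-filter⁺ _ (below lam μ ℓ≡ (proj₁ ∘ I)) (μ-part , μ≢lam)
  where
  below : ∀ lam μ → length μ ≡ length lam → (∀ k → part μ k ℕ.≤ part lam k) → μ ∈ listsBelow lam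
  below []        []      _  _ = here ≡.refl
  below (a ∷ lam) (b ∷ μ) ℓ≡ I =
    ∈-cartesianProductWith⁺ _∷_ (∈-upTo⁺ (ℕ.s≤s (I 0)))
      (below lam μ (ℕₚ.suc-injective ℓ≡) (I ∘ suc))

∈-innerIndices⁻ : ∀ {lam μ} → μ ∈ innerIndices lam →
                  IsPartition μ × length μ ≡ length lam × μ ≢ lam
∈-innerIndices⁻ {lam} μ∈ with ∈-filter⁻ _ {xs = listsBelow lam} μ∈
... | μ∈below , μ-part , μ≢lam = μ-part , same-length lam μ∈below , μ≢lam
  where
  same-length : ∀ lam {μ} → μ ∈ listsBelow lam → length μ ≡ length lam
  same-length []        (here ≡.refl) = ≡.refl
  same-length (a ∷ lam) μ∈ with ∈-cartesianProductWith⁻ _∷_ (upTo (suc a)) (listsBelow lam) μ∈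
  ... | _ , _ , _ , ν∈ , ≡.refl = ≡.cong suc (same-length lam ν∈)

innerIndices-unique : ∀ lam → Unique (innerIndices lam)
innerIndices-unique lam = Uniqueₚ.filter⁺ _ (below lam)
  where
  below : ∀ lam → Unique (listsBelow lam)
  below []        = All.[] ∷ []
  below (a ∷ lam) = Uniqueₚ.cartesianProductWith⁺ _∷_
    (λ { ≡.refl → ≡.refl , ≡.refl }) (Uniqueₚ.upTo⁺ (suc a)) (below lam)

-- (λ₁ − μ₁) + (λ₂ − μ₂) + ⋯ for lists of equal length with μᵢ ≤ λᵢ.
weightDifference : List ℕ → List ℕ → ℕ
weightDifference lam μ = sum (zipWith _∸_ lam μ)

-- The M! permutations: the image j of 0 is arbitrary, and the remaining indices are
-- mapped to the remaining values by a permutation of M - 1 letters.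
permutations : ∀ M → List (Permutation′ M)
permutations zero    = Perm.id ∷ []
permutations (suc M) = cartesianProductWith (Perm.insert Fin.zero) (allFin (suc M)) (permutations M)

[1⋯_] : ℕ → List ℕ
[1⋯ n ] = map suc (upTo n)

-- K is to be a field with total inversion (0 ⁻¹ = 0).  The only denominators are
-- 1 − t, yᵢ − yⱼ (i ≠ j) and v, none of which is zero when K is the field of rational
-- functions and the y's are distinct variables.
module HallLittlewood
  (K    : CommutativeRing 0ℓ 0ℓ)
  (_⁻¹  : CommutativeRing.Carrier K → CommutativeRing.Carrier K)
  (t    : CommutativeRing.Carrier K)
  where
  open CommutativeRing K
  open import Algebra.Properties.Semiring.Exp semiring public using (_^_)

  infixl 7 _/_
  _/_ : Carrier → Carrier → Carrier
  a / b = a * b ⁻¹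

  infix 5 sumOver productOver
  sumOver productOver : {A : Set} → List A → (A → Carrier) → Carrier
  sumOver     as f = foldr _+_ 0# (map f as)
  productOver as f = foldr _*_ 1# (map f as)

  syntax sumOver     as (λ a → e) = ∑[ a ∈ as ] e
  syntax productOver as (λ a → e) = ∏[ a ∈ as ] e

  orderedPairs : ∀ M → List (Fin M × Fin M)
  orderedPairs M = filter (λ (a , b) → a Finₚ.<? b) (cartesianProduct (allFin M) (allFin M))

  Δ : ∀ {M} → Vector Carrier M → Carrier
  Δ {M} x = ∏[ (a , b) ∈ orderedPairs M ] (x a - x b)

  -- The products over i range up to the largest part; all later multiplicities are 0.
  -- The first factor of v is the one for m₀ = M − ℓ(μ).
  v : ℕ → List ℕ → Carrier
  v M μ = (∏[ j ∈ [1⋯ M ∸ length μ ] ] ((1# - t ^ j) / (1# - t)))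
        * (∏[ i ∈ [1⋯ part μ 0 ] ] ∏[ j ∈ [1⋯ multiplicity μ i ] ] ((1# - t ^ j) / (1# - t)))

  b : List ℕ → Carrier
  b μ = ∏[ i ∈ [1⋯ part μ 0 ] ] ∏[ j ∈ [1⋯ multiplicity μ i ] ] (1# - t ^ j)

  -- P and Q are meaningful for partitions μ with ℓ(μ) ≤ M.
  P : ∀ {M} → List ℕ → Vector Carrier M → Carrier
  P {M} μ x = v M μ ⁻¹ * (∑[ π ∈ permutations M ] summand (x ∘ (π ⟨$⟩ʳ_)))
    where
    summand : Vector Carrier M → Carrier
    summand y = (∏[ i ∈ allFin M ] (y i ^ part μ (toℕ i)))
              * (∏[ (i , j) ∈ orderedPairs M ] ((y i - t * y j) / (y i - y j)))

  Q : ∀ {M} → List ℕ → Vector Carrier M → Carrier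
  Q μ x = b μ * P μ x

  -- When λ and μ interlace, μ' ≤ λ' termwise, so _∸_ is exact; for i > λ₁ both λ'ᵢ and
  -- μ'ᵢ vanish, so the product stops at λ₁.
  φ : List ℕ → List ℕ → Carrier
  φ lam μ with interlacing? lam μ
  ... | no  _ = 0#
  ... | yes _ = ∏[ i ∈ filter (λ i → drop (suc i) ℕ.<? drop i) [1⋯ part lam 0 ] ]
                  (1# - t ^ multiplicity lam i)
    where
    drop : ℕ → ℕ
    drop i = conjugate lam i ∸ conjugate μ i

{-# OPTIONS --safe #-}
-- Put κ(a, b) = (a − t b)/(a − b).  The ratio b_μ/v_μ depends only on ℓ(μ), and Δ⁽ⁱ⁾ is
-- ± Δ/∏(xᵢ − w); so the claim is that the symmetrization over all N variables z, y₁, …, y_M of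
--   z^M/∏(z − y_k) · ∏_{a<b} κ(y_a, y_b) · (U(z; y) − t^{ℓ(λ)} y^λ),   U = ∑_μ φ_{λμ} z^{|λ|−|μ|} y^μ,
-- vanishes, μ = λ being included in U with φ_{λλ} = 1.  The coefficients φ satisfy a two-state
-- recursion along the rows of λ.  It shows that, up to terms which are antisymmetric in two
-- adjacent variables once multiplied by the kernel, U is the sum of ∏ κ(y_k, z) y^λ and of terms
-- in which z takes over the place of one of the y's.  After renaming variables both U and y^λ are
-- integrated against one and the same kernel ∏ κ in N variables, and the remaining factors agree
-- by Lagrange interpolation of s^M at the N variables, evaluated at t times the last one.
module Submission where

open import Defs
open import Level using (0ℓ)
open import Algebra.Bundles using (CommutativeMonoid; CommutativeRing; RawRing)
import Algebra.Properties.Ring as RingProperties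
import Algebra.Solver.Ring as RingSolver
open import Algebra.Solver.Ring.AlmostCommutativeRing
  using (_-Raw-AlmostCommutative⟶_; fromCommutativeRing)
open import Data.Fin as Fin using (Fin; toℕ)
import Data.Fin.Properties as Finₚ
open import Data.Fin.Permutation as Perm using (Permutation′; _⟨$⟩ʳ_)
open import Data.Integer as ℤ using (ℤ; +_; -[1+_])
import Data.Integer.Properties as ℤₚ
open import Data.List as List
  using (List; []; _∷_; _++_; allFin; cartesianProductWith; filter; foldr; length; map; upTo)
import Data.List.Properties as Listₚ
open import Data.List.Membership.Propositional using (_∈_)
open import Data.List.Membership.Propositional.Properties
  using (∈-upTo⁺; ∈-upTo⁻; ∈-map⁺; ∈-map⁻; ∈-cartesianProductWith⁺; ∈-cartesianProductWith⁻)
open import Data.List.Relation.Unary.All as All using (All; []; _∷_)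
open import Data.List.Relation.Unary.AllPairs using ([]; _∷_)
open import Data.List.Relation.Unary.Any using (here; there)
open import Data.List.Relation.Unary.Linked using ([]; [-]; _∷_)
open import Data.List.Relation.Unary.Unique.Propositional using (Unique)
import Data.List.Relation.Unary.Unique.Propositional.Properties as Uniqueₚ
open import Data.Maybe using (Maybe; just; nothing)
open import Data.Nat as ℕ using (ℕ; zero; suc; _∸_)
import Data.Nat.Properties as ℕₚ
open import Data.Product using (∃; ∃₂; _×_; _,_; proj₁; proj₂)
open import Data.Vec using (Vec; []; _∷_; tabulate)
open import Data.Vec.Functional using (Vector; removeAt)
import Data.Vec.Properties as Vecₚ
open import Data.Vec.Relation.Unary.All using ([]; _∷_) renaming (All to Allᵥ)
open import Data.Vec.Relation.Unary.AllPairs using (AllPairs; []; _∷_)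
import Data.Vec.Relation.Unary.AllPairs.Properties as AllPairsₚ
open import Function using (_∘_; id)
open import Relation.Binary using (Symmetric)
open import Relation.Binary.PropositionalEquality as ≡ using (_≡_; _≢_)
import Relation.Binary.Reasoning.Setoid as SetoidReasoning
open import Relation.Nullary using (¬_; Dec; yes; no; contradiction)
open import Relation.Nullary.Decidable using (_×-dec_; ¬?)

-- The recursion needs two states because the exponent k in a factor 1 - t^k counts a whole block of
-- equal parts, which a recursion by rows never sees at once. The identity 1 - t^(k+1) = t (1 - t^k)
-- + (1 - t) builds the factor row by row: with weight t the row stays untouched, with weight 1 - t
-- the factor of the column λ₁ is left out below. The same two weights produce the kernel, since t +
-- (1 - t) y/(y - z) = κ(y, z). Padding λ by zeros to M parts makes all rows alike. Each zero
-- multiplies U by t, so that t^ℓ(λ) becomes t^M, which is the power that appears when s^M is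
-- evaluated at s = t w. This ties the exponent ℓ(λ) of the claim to the exponent N - 1 of x_i. One
-- further zero, in place N, lets z join the y's: y^λ is unchanged when z is put last, whereas in U
-- the variable z may end in any place. The argument only divides by differences a - b and a - t b,
-- by 1 - t^j and by t, so it is carried out for generic elements of a ring in which nonzero
-- elements are invertible.

module IntegerSolver (K : CommutativeRing 0ℓ 0ℓ) where
  open CommutativeRing K
  open import Algebra.Properties.Semiring.Mult.TCOptimised semiring
    using (×-homo-+; ×1-homo-*; 1+×) renaming (_×_ to _×ᵣ_)
  open RingProperties ring
  open import Relation.Binary.Reasoning.Setoid setoid

  private
    -- The solver takes its coefficients in ℤ, where equality is decidable and opposite coefficients
    -- cancel by computation; an abstract `K` offers neither.
    image : ℤ → Carrier
    image (+ n)    = n ×ᵣ 1#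
    image -[1+ n ] = - (suc n ×ᵣ 1#)

    image-neg : ∀ i → image (ℤ.- i) ≈ - image i
    image-neg (+ zero)  = sym -0#≈0#
    image-neg (+ suc n) = refl
    image-neg -[1+ n ]  = sym (-‿involutive _)

    cancel-1 : ∀ a b → (1# + a) - (1# + b) ≈ a - b
    cancel-1 a b = begin
      (1# + a) - (1# + b)       ≈⟨ +-congˡ (-‿+-comm 1# b) ⟨
      (1# + a) + (- 1# + - b)   ≈⟨ +-congʳ (+-comm 1# a) ⟩
      (a + 1#) + (- 1# + - b)   ≈⟨ +-assoc a 1# _ ⟩
      a + (1# + (- 1# + - b))   ≈⟨ +-congˡ (+-assoc 1# (- 1#) (- b)) ⟨
      a + ((1# - 1#) + - b)     ≈⟨ +-congˡ (+-congʳ (-‿inverseʳ 1#)) ⟩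
      a + (0# + - b)            ≈⟨ +-congˡ (+-identityˡ _) ⟩
      a - b                     ∎

    image-⊖ : ∀ m n → image (m ℤ.⊖ n) ≈ m ×ᵣ 1# - n ×ᵣ 1#
    image-⊖ zero    zero    = sym (-‿inverseʳ _)
    image-⊖ zero    (suc n) = sym (+-identityˡ _)
    image-⊖ (suc m) zero    = sym (trans (+-congˡ -0#≈0#) (+-identityʳ _))
    image-⊖ (suc m) (suc n) = begin
      image (suc m ℤ.⊖ suc n)             ≡⟨ ≡.cong image (ℤₚ.[1+m]⊖[1+n]≡m⊖n m n) ⟩
      image (m ℤ.⊖ n)                     ≈⟨ image-⊖ m n ⟩
      m ×ᵣ 1# - n ×ᵣ 1#                     ≈⟨ cancel-1 _ _ ⟨
      (1# + m ×ᵣ 1#) - (1# + n ×ᵣ 1#)       ≈⟨ +-cong (1+× m 1#) (-‿cong (1+× n 1#)) ⟨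
      suc m ×ᵣ 1# - suc n ×ᵣ 1#             ∎

    image-+ : ∀ i j → image (i ℤ.+ j) ≈ image i + image j
    image-+ (+ m)    (+ n)    = ×-homo-+ 1# m n
    image-+ (+ m)    -[1+ n ] = image-⊖ m (suc n)
    image-+ -[1+ m ] (+ n)    = trans (image-⊖ n (suc m)) (+-comm _ _)
    image-+ -[1+ m ] -[1+ n ] = begin
      - (suc (suc (m ℕ.+ n)) ×ᵣ 1#)    ≡⟨ ≡.cong (λ k → - (k ×ᵣ 1#)) (≡.sym (ℕₚ.+-suc (suc m) n)) ⟩
      - ((suc m ℕ.+ suc n) ×ᵣ 1#)      ≈⟨ -‿cong (×-homo-+ 1# (suc m) (suc n)) ⟩
      - (suc m ×ᵣ 1# + suc n ×ᵣ 1#)     ≈⟨ -‿+-comm _ _ ⟨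
      - (suc m ×ᵣ 1#) - suc n ×ᵣ 1#     ∎

    image-pos-* : ∀ m j → image (+ m ℤ.* j) ≈ m ×ᵣ 1# * image j
    image-pos-* m (+ n) = begin
      image (+ m ℤ.* + n)   ≡⟨ ≡.cong image (ℤₚ.pos-* m n) ⟨
      (m ℕ.* n) ×ᵣ 1#        ≈⟨ ×1-homo-* m n ⟩
      m ×ᵣ 1# * n ×ᵣ 1#       ∎
    image-pos-* m -[1+ n ] = begin
      image (+ m ℤ.* -[1+ n ])        ≡⟨ ≡.cong image (ℤₚ.neg-distribʳ-* (+ m) (+ suc n)) ⟨
      image (ℤ.- (+ m ℤ.* + suc n))   ≈⟨ image-neg (+ m ℤ.* + suc n) ⟩
      - image (+ m ℤ.* + suc n)       ≈⟨ -‿cong (image-pos-* m (+ suc n)) ⟩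
      - (m ×ᵣ 1# * suc n ×ᵣ 1#)         ≈⟨ -‿distribʳ-* _ _ ⟩
      m ×ᵣ 1# * - (suc n ×ᵣ 1#)         ∎

    image-* : ∀ i j → image (i ℤ.* j) ≈ image i * image j
    image-* (+ m)    j = image-pos-* m j
    image-* -[1+ m ] j = begin
      image (-[1+ m ] ℤ.* j)        ≡⟨ ≡.cong image (ℤₚ.neg-distribˡ-* (+ suc m) j) ⟨
      image (ℤ.- (+ suc m ℤ.* j))   ≈⟨ image-neg (+ suc m ℤ.* j) ⟩
      - image (+ suc m ℤ.* j)       ≈⟨ -‿cong (image-pos-* (suc m) j) ⟩
      - (suc m ×ᵣ 1# * image j)      ≈⟨ -‿distribˡ-* _ _ ⟩
      - (suc m ×ᵣ 1#) * image j      ∎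

    ℤ-rawRing : RawRing 0ℓ 0ℓ
    ℤ-rawRing = CommutativeRing.rawRing ℤₚ.+-*-commutativeRing

    ℤ⟶K : ℤ-rawRing -Raw-AlmostCommutative⟶ fromCommutativeRing K
    ℤ⟶K = record
      { ⟦_⟧    = image
      ; +-homo = image-+
      ; *-homo = image-*
      ; -‿homo = image-neg
      ; 0-homo = refl
      ; 1-homo = refl
      }

    image≟ : ∀ i j → Maybe (image i ≈ image j)
    image≟ i j with i ℤ.≟ j
    ... | yes ≡.refl = just refl
    ... | no  _      = nothing

  open RingSolver ℤ-rawRing (fromCommutativeRing K) ℤ⟶K image≟ public
    using (solve; con; _:=_; _:+_; _:*_; _:-_; :-_)

-- Sums over the orderings of a vector

-- The relational side of `selectSum`: the congruence lemmas hand each summand a proof of where its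
-- entry and remainder come from, so that genericity survives the selection.
data Selects {A : Set} : ∀ {n} → Vec A (suc n) → A → Vec A n → Set where
  here  : ∀ {n x} {xs : Vec A n} → Selects (x ∷ xs) x xs
  there : ∀ {n x y r} {xs : Vec A (suc n)} → Selects xs y r → Selects (x ∷ xs) y (x ∷ r)

All-select : ∀ {A : Set} {P : A → Set} {n y r} {xs : Vec A (suc n)} →
             Selects xs y r → Allᵥ P xs → Allᵥ P (y ∷ r)
All-select here      pxs        = pxs
All-select (there s) (px ∷ pxs) with All-select s pxs
... | py ∷ pr = py ∷ px ∷ pr

AllPairs-select : ∀ {A : Set} {R : A → A → Set} → Symmetric R → ∀ {n y r} {xs : Vec A (suc n)} →
                  Selects xs y r → AllPairs R xs → AllPairs R (y ∷ r)
AllPairs-select R-sym here      rxs        = rxs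
AllPairs-select R-sym (there s) (rx ∷ rxs) with AllPairs-select R-sym s rxs | All-select s rx
... | ry ∷ rr | rxy ∷ rxr = (R-sym rxy ∷ ry) ∷ rxr ∷ rr

data Orders {A : Set} : ∀ {n} → Vec A n → Vec A n → Set where
  []  : Orders [] []
  _∷_ : ∀ {n y r ys} {xs : Vec A (suc n)} → Selects xs y r → Orders r ys → Orders xs (y ∷ ys)

All-orders : ∀ {A : Set} {P : A → Set} {n} {xs ys : Vec A n} → Orders xs ys → Allᵥ P xs → Allᵥ P ys
All-orders []      []  = []
All-orders (s ∷ o) pxs with All-select s pxs
... | py ∷ pr = py ∷ All-orders o pr

AllPairs-orders : ∀ {A : Set} {R : A → A → Set} → Symmetric R → ∀ {n} {xs ys : Vec A n} →
                  Orders xs ys → AllPairs R xs → AllPairs R ys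
AllPairs-orders R-sym []      []  = []
AllPairs-orders R-sym (s ∷ o) rxs with AllPairs-select R-sym s rxs
... | ry ∷ rr = All-orders o ry ∷ AllPairs-orders R-sym o rr

-- Adjacent transpositions generate all permutations, so invariance under them already is symmetry,
-- and it is easy to check along a vector.
data Swap {A : Set} : ∀ {n} → Vec A n → Vec A n → Set where
  swap : ∀ {n} a b {r : Vec A n} → Swap (a ∷ b ∷ r) (b ∷ a ∷ r)
  prep : ∀ {n} x {r s : Vec A n} → Swap r s → Swap (x ∷ r) (x ∷ s)

module Symmetrization (K : CommutativeRing 0ℓ 0ℓ) {A : Set} where
  open CommutativeRing K
  open IntegerSolver K
  open import Relation.Binary.Reasoning.Setoid setoid

  Π : (A → Carrier) → ∀ {n} → Vec A n → Carrier
  Π h []       = 1#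
  Π h (w ∷ ws) = h w * Π h ws

  selectSum : ∀ {n} → Vec A (suc n) → (A → Vec A n → Carrier) → Carrier
  selectSum {zero}  (x ∷ []) f = f x []
  selectSum {suc n} (x ∷ xs) f = f x xs + selectSum xs (λ y r → f y (x ∷ r))

  orderSum : ∀ {n} → Vec A n → (Vec A n → Carrier) → Carrier
  orderSum {zero}  xs F = F xs
  orderSum {suc n} xs F = selectSum xs (λ x r → orderSum r (λ ys → F (x ∷ ys)))

  Invariant : ∀ {n} → (Vec A n → Carrier) → Set
  Invariant w = ∀ {xs ys} → Swap xs ys → w xs ≈ w ys

  Π-invariant : ∀ h {n} → Invariant (Π h {n})
  Π-invariant h (swap a b {r}) =
    solve 3 (λ a b r → a :* (b :* r) := b :* (a :* r)) refl (h a) (h b) (Π h r)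
  Π-invariant h (prep x s)     = *-congˡ (Π-invariant h s)

  Π-select : ∀ h {n y r} {xs : Vec A (suc n)} → Selects xs y r → Π h (y ∷ r) ≈ Π h xs
  Π-select h here = refl
  Π-select h {y = y} (there {x = x} {r = r} s) =
    trans (Π-invariant h (swap y x {r})) (*-congˡ (Π-select h s))

  Π-* : ∀ h k {n} (xs : Vec A n) → Π (λ x → h x * k x) xs ≈ Π h xs * Π k xs
  Π-* h k []       = sym (*-identityˡ 1#)
  Π-* h k (x ∷ xs) = trans (*-congˡ (Π-* h k xs))
    (solve 4 (λ a b c d → (a :* b) :* (c :* d) := (a :* c) :* (b :* d)) refl (h x) (k x) _ _)

  selectSum-cong : ∀ {n} (xs : Vec A (suc n)) {f g} →
             (∀ {y r} → Selects xs y r → f y r ≈ g y r) → selectSum xs f ≈ selectSum xs g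
  selectSum-cong {zero}  (x ∷ []) e = e here
  selectSum-cong {suc n} (x ∷ xs) e = +-cong (e here) (selectSum-cong xs (λ s → e (there s)))

  selectSum-+ : ∀ {n} (xs : Vec A (suc n)) f g →
          selectSum xs (λ y r → f y r + g y r) ≈ selectSum xs f + selectSum xs g
  selectSum-+ {zero}  (x ∷ []) f g = refl
  selectSum-+ {suc n} (x ∷ xs) f g = trans (+-congˡ (selectSum-+ xs _ _))
    (solve 4 (λ a b c d → (a :+ b) :+ (c :+ d) := (a :+ c) :+ (b :+ d)) refl (f x xs) (g x xs) _ _)

  selectSum-* : ∀ {n} (xs : Vec A (suc n)) c f → selectSum xs (λ y r → c * f y r) ≈ c * selectSum xs f
  selectSum-* {zero}  (x ∷ []) c f = refl
  selectSum-* {suc n} (x ∷ xs) c f = trans (+-congˡ (selectSum-* xs c _)) (sym (distribˡ c _ _))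

  selectSum-0 : ∀ {n} (xs : Vec A (suc n)) {f} →
          (∀ {y r} → Selects xs y r → f y r ≈ 0#) → selectSum xs f ≈ 0#
  selectSum-0 {zero}  (x ∷ []) e = e here
  selectSum-0 {suc n} (x ∷ xs) e =
    trans (+-cong (e here) (selectSum-0 xs (λ s → e (there s)))) (+-identityˡ 0#)

  orderSum-+ : ∀ {n} (xs : Vec A n) F G → orderSum xs (λ ys → F ys + G ys) ≈ orderSum xs F + orderSum xs G
  orderSum-+ {zero}  xs F G = refl
  orderSum-+ {suc n} xs F G =
    trans (selectSum-cong xs (λ {y} {r} _ → orderSum-+ r (λ ys → F (y ∷ ys)) (λ ys → G (y ∷ ys)))) (selectSum-+ xs _ _)

  orderSum-* : ∀ {n} (xs : Vec A n) c F → orderSum xs (λ ys → c * F ys) ≈ c * orderSum xs F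
  orderSum-* {zero}  xs c F = refl
  orderSum-* {suc n} xs c F =
    trans (selectSum-cong xs (λ {y} {r} _ → orderSum-* r c (λ ys → F (y ∷ ys)))) (selectSum-* xs c _)

  orderSum-cong : ∀ {n} (xs : Vec A n) {F G} →
              (∀ {ys} → Orders xs ys → F ys ≈ G ys) → orderSum xs F ≈ orderSum xs G
  orderSum-cong {zero}  [] e = e []
  orderSum-cong {suc n} xs e = selectSum-cong xs λ {_} {r} s → orderSum-cong r λ o → e (s ∷ o)

  -- Both sides run over the ordered pairs of distinct positions, with the same remainders. It
  -- serves to choose a y before z.
  selectSum-swap : ∀ {n} (xs : Vec A (suc (suc n))) (f : A → A → Vec A n → Carrier) →
             selectSum xs (λ a r → selectSum r (f a)) ≈ selectSum xs (λ a r → selectSum r (λ b s → f b a s))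
  selectSum-swap {zero}  (x ∷ y ∷ []) f = +-comm _ _
  selectSum-swap {suc n} (x ∷ xs) f = begin
    selectSum xs (f x) + selectSum xs (λ a r → f a x r + selectSum r (λ b s → f a b (x ∷ s)))
      ≈⟨ +-congˡ (selectSum-+ xs _ _) ⟩
    selectSum xs (f x) + (selectSum xs (λ a r → f a x r) + selectSum xs (λ a r → selectSum r (λ b s → f a b (x ∷ s))))
      ≈⟨ +-congˡ (+-congˡ (selectSum-swap xs _)) ⟩
    selectSum xs (f x) + (selectSum xs (λ a r → f a x r) + selectSum xs (λ a r → selectSum r (λ b s → f b a (x ∷ s))))
      ≈⟨ solve 3 (λ a b c → a :+ (b :+ c) := b :+ (a :+ c)) refl _ _ _ ⟩
    selectSum xs (λ a r → f a x r) + (selectSum xs (f x) + selectSum xs (λ a r → selectSum r (λ b s → f b a (x ∷ s))))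
      ≈⟨ +-congˡ (selectSum-+ xs _ _) ⟨
    selectSum xs (λ a r → f a x r) + selectSum xs (λ a r → f x a r + selectSum r (λ b s → f b a (x ∷ s))) ∎

  -- The two terms of an unordered pair are cancelled against each other inside the induction.
  -- Exchanging the two choices would only show that twice the sum vanishes, and `K` may have
  -- characteristic 2.
  selectSum-antisymmetric : ∀ {n} (xs : Vec A (suc (suc n))) (f : A → A → Vec A n → Carrier) →
    (∀ {a b r s} → Selects xs a r → Selects r b s → f a b s + f b a s ≈ 0#) →
    selectSum xs (λ a r → selectSum r (f a)) ≈ 0#
  selectSum-antisymmetric {zero}  (x ∷ y ∷ []) f e = e here here
  selectSum-antisymmetric {suc n} (x ∷ xs) f e = begin
    selectSum xs (f x) + selectSum xs (λ a r → f a x r + selectSum r (λ b s → f a b (x ∷ s)))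
      ≈⟨ +-congˡ (selectSum-+ xs _ _) ⟩
    selectSum xs (f x) + (selectSum xs (λ a r → f a x r) + selectSum xs (λ a r → selectSum r (λ b s → f a b (x ∷ s))))
      ≈⟨ +-assoc _ _ _ ⟨
    (selectSum xs (f x) + selectSum xs (λ a r → f a x r)) + selectSum xs (λ a r → selectSum r (λ b s → f a b (x ∷ s)))
      ≈⟨ +-cong (sym (selectSum-+ xs _ _))
                (selectSum-antisymmetric xs _ (λ s₁ s₂ → e (there s₁) (there s₂))) ⟩
    selectSum xs (λ a r → f x a r + f a x r) + 0#
      ≈⟨ +-congʳ (selectSum-0 xs (λ s → e here s)) ⟩
    0# + 0# ≈⟨ +-identityˡ 0# ⟩
    0# ∎

  orderSum-0 : ∀ {n} (xs : Vec A n) {F} → (∀ {ys} → Orders xs ys → F ys ≈ 0#) → orderSum xs F ≈ 0#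
  orderSum-0 {zero}  [] e = e []
  orderSum-0 {suc n} xs e = selectSum-0 xs λ {_} {r} s → orderSum-0 r λ o → e (s ∷ o)

tabulate-selects : ∀ {A : Set} {n} (x : Vector A (suc n)) i →
                   Selects (tabulate x) (x i) (tabulate (removeAt x i))
tabulate-selects         x Fin.zero    = here
tabulate-selects {n = suc n} x (Fin.suc i) = there (tabulate-selects (x ∘ Fin.suc) i)

tabulate-insert : ∀ {A : Set} {n} (x : Vector A (suc n)) i (π : Permutation′ n) →
  tabulate (x ∘ (Perm.insert Fin.zero i π ⟨$⟩ʳ_)) ≡ x i ∷ tabulate (removeAt x i ∘ (π ⟨$⟩ʳ_))
tabulate-insert x i π =
  ≡.cong (x i ∷_) (Vecₚ.tabulate-cong λ k → ≡.cong x (Perm.insert-punchIn Fin.zero i π k))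

-- Finite sums and products over lists

module Fold (M : CommutativeMonoid 0ℓ 0ℓ) where
  open CommutativeMonoid M
  open import Algebra.Properties.CommutativeSemigroup commutativeSemigroup using (interchange)

  fold : {A : Set} → List A → (A → Carrier) → Carrier
  fold as f = foldr _∙_ ε (map f as)

  module _ {A : Set} where

    fold-cong : ∀ (as : List A) {f g} → (∀ {a} → a ∈ as → f a ≈ g a) → fold as f ≈ fold as g
    fold-cong []       e = refl
    fold-cong (a ∷ as) e = ∙-cong (e (here ≡.refl)) (fold-cong as (e ∘ there))

    fold-ε : ∀ (as : List A) {f} → (∀ {a} → a ∈ as → f a ≈ ε) → fold as f ≈ ε
    fold-ε []       e = refl
    fold-ε (a ∷ as) e = trans (∙-cong (e (here ≡.refl)) (fold-ε as (e ∘ there))) (identityˡ ε)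

    fold-∙ : ∀ (as : List A) f g → fold as (λ a → f a ∙ g a) ≈ fold as f ∙ fold as g
    fold-∙ []       f g = sym (identityˡ ε)
    fold-∙ (a ∷ as) f g = trans (∙-congˡ (fold-∙ as f g)) (interchange _ _ _ _)

    fold-++ : ∀ (as bs : List A) f → fold (as ++ bs) f ≈ fold as f ∙ fold bs f
    fold-++ []       bs f = sym (identityˡ _)
    fold-++ (a ∷ as) bs f = trans (∙-congˡ (fold-++ as bs f)) (sym (assoc _ _ _))

  fold-map : ∀ {A B : Set} (g : A → B) as f → fold (map g as) f ≈ fold as (f ∘ g)
  fold-map g as f = reflexive (≡.cong (foldr _∙_ ε) (≡.sym (Listₚ.map-∘ as)))

  fold-cartesian : ∀ {A B C : Set} (g : A → B → C) as bs f →
    fold (cartesianProductWith g as bs) f ≈ fold as (λ a → fold bs (λ b → f (g a b)))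
  fold-cartesian g []       bs f = refl
  fold-cartesian g (a ∷ as) bs f =
    trans (fold-++ (map (g a) bs) _ f) (∙-cong (fold-map (g a) bs f) (fold-cartesian g as bs f))

  -- Trades a filtered list for an indicator on the full one, so that expressions with different
  -- side conditions share one index list.
  keep : ∀ {P : Set} → Dec P → Carrier → Carrier
  keep (yes _) x = x
  keep (no _)  x = ε

  keep-yes : ∀ {P : Set} (P? : Dec P) {x} → P → keep P? x ≈ x
  keep-yes (yes _) p = refl
  keep-yes (no ¬p) p = contradiction p ¬p

  keep-no : ∀ {P : Set} (P? : Dec P) {x} → ¬ P → keep P? x ≈ ε
  keep-no (yes p) ¬p = contradiction p ¬p
  keep-no (no _)  ¬p = refl

  fold-filter : ∀ {A : Set} {P : A → Set} (P? : ∀ a → Dec (P a)) as f →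
               fold (filter P? as) f ≈ fold as (λ a → keep (P? a) (f a))
  fold-filter P? []       f = refl
  fold-filter P? (a ∷ as) f with P? a
  ... | yes _ = ∙-congˡ (fold-filter P? as f)
  ... | no  _ = trans (fold-filter P? as f) (sym (identityˡ _))

  fold-single : ∀ {A : Set} {P : A → Set} (P? : ∀ a → Dec (P a)) {as b} (f : A → Carrier) → Unique as → b ∈ as →
               P b → (∀ {a} → P a → a ≡ b) → fold as (λ a → keep (P? a) (f a)) ≈ f b
  fold-single P? {a ∷ as} f (a≢ ∷ _) (here ≡.refl) Pb P⇒≡ =
    trans (∙-cong (keep-yes (P? a) Pb)
                  (fold-ε as λ {c} c∈ → keep-no (P? c) λ Pc → All.lookup a≢ c∈ (≡.sym (P⇒≡ Pc))))
          (identityʳ (f a))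
  fold-single P? {a ∷ as} {b} f (a≢ ∷ u) (there b∈) Pb P⇒≡ =
    trans (∙-cong (keep-no (P? a) {f a} (λ Pa → All.lookup a≢ b∈ (P⇒≡ Pa))) (fold-single P? f u b∈ Pb P⇒≡))
          (identityˡ (f b))

  fold-upTo : ∀ n f → fold (upTo (suc n)) f ≈ fold (upTo n) f ∙ f n
  fold-upTo n f = trans (reflexive (≡.cong (λ as → fold as f) (≡.sym (Listₚ.upTo-∷ʳ n))))
                       (trans (fold-++ (upTo n) _ f) (∙-congˡ (identityʳ (f n))))

  fold-[1⋯] : ∀ n f → fold [1⋯ suc n ] f ≈ fold [1⋯ n ] f ∙ f (suc n)
  fold-[1⋯] n f = trans (fold-map suc (upTo (suc n)) f)
    (trans (fold-upTo n (f ∘ suc)) (∙-congʳ (sym (fold-map suc (upTo n) f))))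

  fold-[1⋯]-cong : ∀ n {f g} → (∀ {i} → 0 ℕ.< i → i ℕ.≤ n → f i ≈ g i) → fold [1⋯ n ] f ≈ fold [1⋯ n ] g
  fold-[1⋯]-cong zero            e = refl
  fold-[1⋯]-cong (suc n) {f} {g} e = trans (fold-[1⋯] n f) (trans
    (∙-cong (fold-[1⋯]-cong n (λ 0<i i≤n → e 0<i (ℕₚ.m≤n⇒m≤1+n i≤n))) (e ℕ.z<s ℕₚ.≤-refl))
    (sym (fold-[1⋯] n g)))

  fold-[1⋯]-truncate : ∀ {m n f} → m ℕ.≤ n → (∀ {i} → m ℕ.< i → i ℕ.≤ n → f i ≈ ε) →
                      fold [1⋯ n ] f ≈ fold [1⋯ m ] f
  fold-[1⋯]-truncate {m} {n} {f} m≤n e with m ℕ.≟ n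
  ... | yes ≡.refl = refl
  fold-[1⋯]-truncate {m} {zero}  ℕ.z≤n e | no m≢n = contradiction ≡.refl m≢n
  fold-[1⋯]-truncate {m} {suc n} {f} m≤n e | no m≢n = trans (fold-[1⋯] n f) (trans
    (∙-cong (fold-[1⋯]-truncate (ℕₚ.≤-pred m<) (λ m<i i≤n → e m<i (ℕₚ.m≤n⇒m≤1+n i≤n)))
            (e m< ℕₚ.≤-refl))
    (identityʳ _))
    where m< = ℕₚ.≤∧≢⇒< m≤n m≢n

  keep-cong : ∀ {P Q : Set} (P? : Dec P) (Q? : Dec Q) {x} → (P → Q) → (Q → P) → keep P? x ≈ keep Q? x
  keep-cong (yes p) Q? f g = sym (keep-yes Q? (f p))
  keep-cong (no ¬p) Q? f g = sym (keep-no Q? (¬p ∘ g))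

  fold-allFin : ∀ n (f : Fin (suc n) → Carrier) →
               fold (allFin (suc n)) f ≈ f Fin.zero ∙ fold (allFin n) (f ∘ Fin.suc)
  fold-allFin n f = ∙-congˡ (trans (reflexive (≡.cong (λ as → fold as f) (≡.sym (Listₚ.map-tabulate id Fin.suc))))
                                  (fold-map Fin.suc (allFin n) f))

-- Horizontal strips

uncons : ∀ {p lam} → IsPartition (p ∷ lam) → part lam 0 ℕ.≤ p × 0 ℕ.< p × IsPartition lam
uncons {lam = []}    (_ , 0<p ∷ 0<lam)              = ℕ.z≤n , 0<p , ([] , 0<lam)
uncons {lam = _ ∷ _} (p≥q ∷ decreasing , 0<p ∷ 0<lam) = p≥q , 0<p , (decreasing , 0<lam)

cons : ∀ {p lam} → part lam 0 ℕ.≤ p → 0 ℕ.< p → IsPartition lam → IsPartition (p ∷ lam)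
cons {lam = []}    _   0<p (_ , 0<lam)          = [-] , 0<p ∷ 0<lam
cons {lam = _ ∷ _} q≤p 0<p (decreasing , 0<lam) = q≤p ∷ decreasing , 0<p ∷ 0<lam

part-decreasing : ∀ {lam} → IsPartition lam → ∀ k → part lam (suc k) ℕ.≤ part lam k
part-decreasing {[]}      lam-part k       = ℕ.z≤n
part-decreasing {p ∷ lam} lam-part zero    = proj₁ (uncons lam-part)
part-decreasing {p ∷ lam} lam-part (suc k) = part-decreasing (proj₂ (proj₂ (uncons lam-part))) k

part-0 : ∀ lam {k} → length lam ℕ.≤ k → part lam k ≡ 0
part-0 []        _           = ≡.refl
part-0 (p ∷ lam) (ℕ.s≤s lam≤k) = part-0 lam lam≤k

-- λ/μ is a horizontal strip, and μ has as many nonzero parts as λ.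
data Strip : List ℕ → List ℕ → Set where
  []    : Strip [] []
  strip : ∀ {p ν lam μ} → part lam 0 ℕ.≤ ν → ν ℕ.≤ p → 0 ℕ.< ν → Strip lam μ → Strip (p ∷ lam) (ν ∷ μ)

strip? : ∀ lam μ → Dec (Strip lam μ)
strip? []        []      = yes []
strip? []        (ν ∷ μ) = no λ ()
strip? (p ∷ lam) []      = no λ ()
strip? (p ∷ lam) (ν ∷ μ) with part lam 0 ℕ.≤? ν | ν ℕ.≤? p | 0 ℕ.<? ν | strip? lam μ
... | yes q≤ν | yes ν≤p | yes 0<ν | yes s = yes (strip q≤ν ν≤p 0<ν s)
... | no q≰ν  | _       | _       | _     = no λ { (strip q≤ν _ _ _) → q≰ν q≤ν }
... | _       | no ν≰p  | _       | _     = no λ { (strip _ ν≤p _ _) → ν≰p ν≤p }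
... | _       | _       | no 0≮ν  | _     = no λ { (strip _ _ 0<ν _) → 0≮ν 0<ν }
... | _       | _       | _       | no ¬s = no λ { (strip _ _ _ s) → ¬s s }

strip-head : ∀ {lam μ} → Strip lam μ → part μ 0 ℕ.≤ part lam 0
strip-head []                = ℕ.z≤n
strip-head (strip _ ν≤p _ _) = ν≤p

strip⇒partition : ∀ {lam μ} → Strip lam μ → IsPartition μ
strip⇒partition []                    = [] , []
strip⇒partition (strip q≤ν ν≤p 0<ν s) = cons (ℕₚ.≤-trans (strip-head s) q≤ν) 0<ν (strip⇒partition s)

strip⇒interlacing : ∀ {lam μ} → Strip lam μ → Interlacing lam μ
strip⇒interlacing []                  k       = ℕ.z≤n , ℕ.z≤n
strip⇒interlacing (strip q≤ν ν≤p _ _) zero    = ν≤p , q≤ν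
strip⇒interlacing (strip _ _ _ s)     (suc k) = strip⇒interlacing s k

interlacing⇒strip : ∀ {lam μ} → length μ ≡ length lam → IsPartition μ → Interlacing lam μ → Strip lam μ
interlacing⇒strip {[]}      {[]}    _  _      _ = []
interlacing⇒strip {p ∷ lam} {ν ∷ μ} ℓ≡ μ-part I with uncons μ-part
... | _ , 0<ν , μ-part′ = strip (proj₂ (I 0)) (proj₁ (I 0)) 0<ν
        (interlacing⇒strip (ℕₚ.suc-injective ℓ≡) μ-part′ (I ∘ suc))

conjugate-≤ : ∀ {p i} lam → i ℕ.≤ p → conjugate (p ∷ lam) i ≡ suc (conjugate lam i)
conjugate-≤ {i = i} lam i≤p = ≡.cong length (Listₚ.filter-accept (i ℕ.≤?_) i≤p)

conjugate-> : ∀ {p i} lam → p ℕ.< i → conjugate (p ∷ lam) i ≡ conjugate lam i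
conjugate-> {i = i} lam p<i = ≡.cong length (Listₚ.filter-reject (i ℕ.≤?_) (ℕₚ.<⇒≱ p<i))

multiplicity-≡ : ∀ p lam → multiplicity (p ∷ lam) p ≡ suc (multiplicity lam p)
multiplicity-≡ p lam = ≡.cong length (Listₚ.filter-accept (p ℕ.≟_) ≡.refl)

multiplicity-≢ : ∀ {p i} lam → i ≢ p → multiplicity (p ∷ lam) i ≡ multiplicity lam i
multiplicity-≢ {i = i} lam i≢p = ≡.cong length (Listₚ.filter-reject (i ℕ.≟_) i≢p)

conjugate-beyond : ∀ {lam i} → IsPartition lam → part lam 0 ℕ.< i → conjugate lam i ≡ 0
conjugate-beyond {[]}      lam-part q<i = ≡.refl
conjugate-beyond {p ∷ lam} lam-part p<i with uncons lam-part
... | q≤p , _ , lam-part′ =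
  ≡.trans (conjugate-> lam p<i) (conjugate-beyond lam-part′ (ℕₚ.≤-<-trans q≤p p<i))

multiplicity-beyond : ∀ {lam i} → IsPartition lam → part lam 0 ℕ.< i → multiplicity lam i ≡ 0
multiplicity-beyond {[]}      lam-part q<i = ≡.refl
multiplicity-beyond {p ∷ lam} lam-part p<i with uncons lam-part
... | q≤p , _ , lam-part′ =
  ≡.trans (multiplicity-≢ lam (ℕₚ.>⇒≢ p<i)) (multiplicity-beyond lam-part′ (ℕₚ.≤-<-trans q≤p p<i))

excess : List ℕ → List ℕ → ℕ → ℕ
excess lam μ i = conjugate lam i ∸ conjugate μ i

excess-beyond : ∀ {lam μ i} → IsPartition lam → part lam 0 ℕ.< i → excess lam μ i ≡ 0
excess-beyond {lam} {μ} {i} lam-part q<i rewrite conjugate-beyond {lam} lam-part q<i =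
  ℕₚ.0∸n≡0 (conjugate μ i)

excess-same : ∀ {p ν i} lam μ → i ℕ.≤ p → i ℕ.≤ ν → excess (p ∷ lam) (ν ∷ μ) i ≡ excess lam μ i
excess-same lam μ i≤p i≤ν rewrite conjugate-≤ lam i≤p | conjugate-≤ μ i≤ν = ≡.refl

-- For i > λ₂, column i of λ/μ can only contain the box of the first row.
excess-1 : ∀ {p ν i} {lam μ} → IsPartition lam → IsPartition μ → part lam 0 ℕ.< i → part μ 0 ℕ.< i →
           i ℕ.≤ p → ν ℕ.< i → excess (p ∷ lam) (ν ∷ μ) i ≡ 1
excess-1 {lam = lam} {μ} lam-part μ-part q<i μ<i i≤p ν<i
  rewrite conjugate-≤ lam i≤p | conjugate-> μ ν<i
        | conjugate-beyond lam-part q<i | conjugate-beyond μ-part μ<i = ≡.refl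

-- A horizontal strip has at most one box in each column: if the first row has a box in column i,
-- then i exceeds ν, hence also `part lam 0`, and no lower row reaches column i.
conjugate-strip : ∀ {lam μ} → IsPartition lam → Strip lam μ → ∀ i → conjugate lam i ℕ.≤ suc (conjugate μ i)
conjugate-strip lam-part [] i = ℕ.z≤n
conjugate-strip {p ∷ lam} {ν ∷ μ} lam-part (strip q≤ν ν≤p _ s) i with uncons lam-part | i ℕ.≤? p | i ℕ.≤? ν
... | _ , _ , lam-part′ | yes i≤p | yes i≤ν
      rewrite conjugate-≤ lam i≤p | conjugate-≤ μ i≤ν = ℕ.s≤s (conjugate-strip lam-part′ s i)
... | _ , _ , lam-part′ | yes i≤p | no i≰ν
      rewrite conjugate-≤ lam i≤p
            | conjugate-beyond {lam} lam-part′ (ℕₚ.≤-<-trans q≤ν (ℕₚ.≰⇒> i≰ν)) = ℕ.s≤s ℕ.z≤n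
... | _ , _ , lam-part′ | no i≰p | i≤?ν
      rewrite conjugate-> lam (ℕₚ.≰⇒> i≰p)
            | conjugate-> μ (ℕₚ.≤-<-trans ν≤p (ℕₚ.≰⇒> i≰p)) = conjugate-strip lam-part′ s i

excess-≤1 : ∀ {lam μ} → IsPartition lam → Strip lam μ → ∀ i → excess lam μ i ℕ.≤ 1
excess-≤1 {lam} {μ} lam-part s i = ℕₚ.m≤n+o⇒m∸n≤o (conjugate lam i) (conjugate μ i)
  (≡.subst (conjugate lam i ℕ.≤_) (≡.sym (ℕₚ.+-comm (conjugate μ i) 1)) (conjugate-strip lam-part s i))

weightDifference-refl : ∀ lam → weightDifference lam lam ≡ 0
weightDifference-refl []        = ≡.refl
weightDifference-refl (p ∷ lam) rewrite ℕₚ.n∸n≡0 p = weightDifference-refl lam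

partition-bounds : ∀ {lam} → IsPartition lam → ∀ {n} → part lam 0 ℕ.≤ n →
                   All (λ p → 0 ℕ.< p × p ℕ.≤ n) lam
partition-bounds {[]}      lam-part p≤n = []
partition-bounds {p ∷ lam} lam-part p≤n with uncons lam-part
... | q≤p , 0<p , lam-part′ = (0<p , p≤n) ∷ partition-bounds lam-part′ (ℕₚ.≤-trans q≤p p≤n)

below-uncons : ∀ {p lam μ} → μ ∈ listsBelow (p ∷ lam) →
               ∃₂ λ ν μ′ → μ ≡ ν ∷ μ′ × ν ℕ.≤ p × μ′ ∈ listsBelow lam
below-uncons {p} {lam} μ∈ with ∈-cartesianProductWith⁻ _∷_ (upTo (suc p)) (listsBelow lam) μ∈
... | ν , μ′ , ν∈ , μ′∈ , ≡.refl = ν , μ′ , ≡.refl , ℕₚ.≤-pred (∈-upTo⁻ ν∈) , μ′∈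

below-length : ∀ lam {μ} → μ ∈ listsBelow lam → length μ ≡ length lam
below-length []        (here ≡.refl) = ≡.refl
below-length (p ∷ lam) μ∈ with below-uncons {p} {lam} μ∈
... | _ , _ , ≡.refl , _ , μ′∈ = ≡.cong suc (below-length lam μ′∈)

below-refl : ∀ lam → lam ∈ listsBelow lam
below-refl []        = here ≡.refl
below-refl (p ∷ lam) = ∈-cartesianProductWith⁺ _∷_ (∈-upTo⁺ (ℕₚ.n<1+n p)) (below-refl lam)

below-unique : ∀ lam → Unique (listsBelow lam)
below-unique []        = All.[] ∷ []
below-unique (p ∷ lam) = Uniqueₚ.cartesianProductWith⁺ _∷_
  (λ { ≡.refl → ≡.refl , ≡.refl }) (Uniqueₚ.upTo⁺ (suc p)) (below-unique lam)

InvertsNonzero : (K : CommutativeRing 0ℓ 0ℓ) →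
                 (CommutativeRing.Carrier K → CommutativeRing.Carrier K) → Set
InvertsNonzero K _⁻¹ = ∀ a → a ≉ 0# → a * a ⁻¹ ≈ 1#
  where open CommutativeRing K

-- Inversion of nonzero elements and generic variables

module HallLittlewoodIdentity
  (K    : CommutativeRing 0ℓ 0ℓ)
  (_⁻¹  : CommutativeRing.Carrier K → CommutativeRing.Carrier K)
  (t    : CommutativeRing.Carrier K)
  (inverseʳ : InvertsNonzero K _⁻¹)
  where
  open CommutativeRing K
  open HallLittlewood K _⁻¹ t
  open RingProperties ring using (-0#≈0#)
  open IntegerSolver K
  open Symmetrization K {Carrier}
  open import Algebra.Properties.CommutativeSemiring.Exp commutativeSemiring using (^-homo-*; ^-distrib-*)
  open import Relation.Binary.Reasoning.Setoid setoid

  cancelˡ : ∀ {a b c} → a ≉ 0# → a * b ≈ a * c → b ≈ c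
  cancelˡ {a} {b} {c} a≉0 e = begin
    b                  ≈⟨ *-identityˡ b ⟨
    1# * b             ≈⟨ *-congʳ (inverseʳ a a≉0) ⟨
    a * a ⁻¹ * b       ≈⟨ regroup a (a ⁻¹) b ⟩
    a ⁻¹ * (a * b)     ≈⟨ *-congˡ e ⟩
    a ⁻¹ * (a * c)     ≈⟨ regroup a (a ⁻¹) c ⟨
    a * a ⁻¹ * c       ≈⟨ *-congʳ (inverseʳ a a≉0) ⟩
    1# * c             ≈⟨ *-identityˡ c ⟩
    c                  ∎
    where regroup = solve 3 (λ a i b → a :* i :* b := i :* (a :* b)) refl

  *-≉0 : ∀ {a b} → a ≉ 0# → b ≉ 0# → a * b ≉ 0#
  *-≉0 {a} {b} a≉0 b≉0 e = b≉0 (cancelˡ a≉0 (trans e (sym (zeroʳ a))))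

  ⁻¹-unique : ∀ {a b} → a ≉ 0# → a * b ≈ 1# → b ≈ a ⁻¹
  ⁻¹-unique {a} a≉0 e = cancelˡ a≉0 (trans e (sym (inverseʳ a a≉0)))

  ⁻¹-cong : ∀ {a b} → a ≉ 0# → a ≈ b → a ⁻¹ ≈ b ⁻¹
  ⁻¹-cong {a} {b} a≉0 e =
    ⁻¹-unique (a≉0 ∘ trans e) (trans (*-congʳ (sym e)) (inverseʳ a a≉0))

  minus-flip : ∀ a b → a - b ≈ - (b - a)
  minus-flip = solve 2 (λ a b → a :- b := :- (b :- a)) refl

  flip-≉0 : ∀ {a b} → a - b ≉ 0# → b - a ≉ 0#
  flip-≉0 {a} {b} a-b≉0 e = a-b≉0 (begin
    a - b        ≈⟨ minus-flip a b ⟩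
    - (b - a)    ≈⟨ -‿cong e ⟩
    - 0#         ≈⟨ -0#≈0# ⟩
    0#           ∎)

  ⁻¹-flip : ∀ {a b} → a - b ≉ 0# → (b - a) ⁻¹ ≈ - (a - b) ⁻¹
  ⁻¹-flip {a} {b} a-b≉0 = sym (⁻¹-unique (flip-≉0 a-b≉0) (begin
    (b - a) * - (a - b) ⁻¹   ≈⟨ solve 3 (λ a b i → (b :- a) :* (:- i) := (a :- b) :* i) refl a b _ ⟩
    (a - b) * (a - b) ⁻¹     ≈⟨ inverseʳ _ a-b≉0 ⟩
    1#                       ∎))

  -- The first condition is for the denominators of `κ`, the other two for those of `κ⁻` and of the
  -- interpolation at t times a variable. Both orders are included to make the relation symmetric,
  -- since the variables get permuted.
  Generic : Carrier → Carrier → Set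
  Generic a b = a - b ≉ 0# × a - t * b ≉ 0# × b - t * a ≉ 0#

  Generic-sym : Symmetric Generic
  Generic-sym (p , q , r) = flip-≉0 p , r , q

  generic-select : ∀ {n y r} {xs : Vec Carrier (suc n)} →
                   Selects xs y r → AllPairs Generic xs → AllPairs Generic (y ∷ r)
  generic-select = AllPairs-select λ {a} {b} → Generic-sym {a} {b}

  generic-head : ∀ {n y r} {xs : Vec Carrier (suc n)} →
                 Selects xs y r → AllPairs Generic xs → Allᵥ (Generic y) r
  generic-head s xs-gen with generic-select s xs-gen
  ... | y-gen ∷ _ = y-gen

  generic-rest : ∀ {n y r} {xs : Vec Carrier (suc n)} →
                 Selects xs y r → AllPairs Generic xs → AllPairs Generic r
  generic-rest s xs-gen with generic-select s xs-gen
  ... | _ ∷ r-gen = r-gen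

  -- The generating functions U and T and how their first row splits off

  κ : Carrier → Carrier → Carrier
  κ a b = (a - t * b) / (a - b)

  Pairs : (Carrier → Carrier → Carrier) → ∀ {n} → Vec Carrier n → Carrier
  Pairs g []       = 1#
  Pairs g (y ∷ ys) = Π (g y) ys * Pairs g ys

  kernel : ∀ {n} → Vec Carrier n → Carrier
  kernel = Pairs κ

  monomial : (ℕ → ℕ) → ∀ {n} → Vec Carrier n → Carrier
  monomial a []       = 1#
  monomial a (y ∷ ys) = y ^ a 0 * monomial (a ∘ suc) ys

  -- The sum of z^(p - ν) y^ν over q < ν ≤ p: the first row p shrinks to a length ν that stays
  -- strictly above the next row q.
  steps : ℕ → ℕ → Carrier → Carrier → Carrier
  steps zero    q z y = 0#
  steps (suc p) q z y with q ℕ.≤? p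
  ... | yes _ = z * steps p q z y + y ^ suc p
  ... | no  _ = 0#

  -- With a = λ padded by zeros, U a z y is t^{number of zeros} ∑_μ φ_{λμ} z^{|λ|−|μ|} y^μ over
  -- the μ with ℓ(μ) = ℓ(λ); T is the same sum without the factor 1 − t^k that φ has when the
  -- strip meets the column λ₁, as is right when the row above reaches down to that column.
  U T : (ℕ → ℕ) → Carrier → ∀ {n} → Vec Carrier n → Carrier
  U a z []       = 1#
  U a z (y ∷ ys) = t * (y ^ a 0 * U (a ∘ suc) z ys) + (1# - t) * T a z (y ∷ ys)
  T a z []       = 0#
  T a z (y ∷ ys) = steps (a 0) (a 1) z y * U (a ∘ suc) z ys
                 + y ^ a 1 * z ^ (a 0 ∸ a 1) * T (a ∘ suc) z ys

  Decreasing : (ℕ → ℕ) → Set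
  Decreasing a = ∀ k → a (suc k) ℕ.≤ a k

  -- A geometric sum in y and z; the prefactor y is there because the exponents of y start at q + 1.
  steps-telescope : ∀ p q z y → q ℕ.≤ p →
    steps p q z y * (y - z) ≈ y * (y ^ p - y ^ q * z ^ (p ∸ q))
  steps-telescope zero zero z y q≤p =
    solve 2 (λ y z → con (+ 0) :* (y :- z) := y :* (con (+ 1) :- con (+ 1) :* con (+ 1))) refl y z
  steps-telescope (suc p) q z y q≤p with q ℕ.≤? p
  ... | yes q≤p′ rewrite ℕₚ.+-∸-assoc 1 q≤p′ = begin
    (z * steps p q z y + y * y ^ p) * (y - z)
      ≈⟨ solve 4 (λ z s y c → (z :* s :+ y :* c) :* (y :- z)
           := z :* (s :* (y :- z)) :+ y :* c :* (y :- z)) refl z (steps p q z y) y (y ^ p) ⟩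
    z * (steps p q z y * (y - z)) + y * y ^ p * (y - z)
      ≈⟨ +-congʳ (*-congˡ (steps-telescope p q z y q≤p′)) ⟩
    z * (y * (y ^ p - y ^ q * z ^ (p ∸ q))) + y * y ^ p * (y - z)
      ≈⟨ solve 5 (λ z y c d f → z :* (y :* (c :- d :* f)) :+ y :* c :* (y :- z)
           := y :* (y :* c :- d :* (z :* f))) refl z y (y ^ p) (y ^ q) (z ^ (p ∸ q)) ⟩
    y * (y * y ^ p - y ^ q * (z * z ^ (p ∸ q))) ∎
  ... | no q≰p with ℕₚ.≤-antisym q≤p (ℕₚ.≰⇒> q≰p)
  ...   | ≡.refl rewrite ℕₚ.n∸n≡0 p =
    solve 3 (λ y z c → con (+ 0) :* (y :- z) := y :* (c :- c :* con (+ 1))) refl y z (y ^ suc p)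

  -- The failure of U to be multiplicative in its first row, see U-split.
  deficit : ℕ → (ℕ → ℕ) → Carrier → ∀ {n} → Vec Carrier (suc n) → Carrier
  deficit p a z (y ∷ ys) =
    y ^ a 0 * z ^ (p ∸ a 0) * (T a z ys - y / (y - z) * U a z ys)

  -- The upper end of the geometric sum gives the main term. Its lower end has the exponent of the
  -- next row on y, like the second term of `T`, and the two together form the deficit.
  T-split : ∀ {a} → Decreasing a → ∀ z {n} y (ys : Vec Carrier n) → y - z ≉ 0# →
    T a z (y ∷ ys) ≈ y * y ^ a 0 / (y - z) * U (a ∘ suc) z ys + deficit (a 0) (a ∘ suc) z (y ∷ ys)
  T-split {a} a-dec z y ys y-z≉0 = begin
    steps p q z y * u + w * τ
      ≈⟨ +-congʳ (*-congʳ (trans (sym (*-identityʳ _)) (*-congˡ (sym (inverseʳ _ y-z≉0))))) ⟩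
    steps p q z y * ((y - z) * i) * u + w * τ
      ≈⟨ +-congʳ (*-congʳ (trans (sym (*-assoc _ _ _)) (*-congʳ (steps-telescope p q z y (a-dec 0))))) ⟩
    y * (y ^ p - w) * i * u + w * τ
      ≈⟨ solve 6 (λ y c w i u τ → y :* (c :- w) :* i :* u :+ w :* τ
           := y :* c :* i :* u :+ w :* (τ :- y :* i :* u)) refl y (y ^ p) w i u τ ⟩
    y * y ^ p * i * u + w * (τ - y * i * u) ∎
    where
    p = a 0
    q = a 1
    u = U (a ∘ suc) z ys
    τ = T (a ∘ suc) z ys
    w = y ^ q * z ^ (p ∸ q)
    i = (y - z) ⁻¹

  -- The weight t of an untouched row and the weight 1 - t of the main term in `T-split` combine to
  -- t + (1 - t) y/(y - z) = κ(y, z).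
  U-split : ∀ {a} → Decreasing a → ∀ z {n} y (ys : Vec Carrier n) → y - z ≉ 0# →
    U a z (y ∷ ys) ≈ y ^ a 0 * κ y z * U (a ∘ suc) z ys
                   + (1# - t) * deficit (a 0) (a ∘ suc) z (y ∷ ys)
  U-split {a} a-dec z y ys y-z≉0 = begin
    t * (c * u) + (1# - t) * T a z (y ∷ ys)
      ≈⟨ +-cong (trans (sym (*-identityʳ _)) (*-congˡ (sym (inverseʳ _ y-z≉0))))
                (*-congˡ (T-split a-dec z y ys y-z≉0)) ⟩
    t * (c * u) * ((y - z) * i) + (1# - t) * (y * c * i * u + o)
      ≈⟨ solve 7 (λ t c u y z i o →
           t :* (c :* u) :* ((y :- z) :* i) :+ (con (+ 1) :- t) :* (y :* c :* i :* u :+ o)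
           := c :* ((y :- t :* z) :* i) :* u :+ (con (+ 1) :- t) :* o) refl t c u y z i o ⟩
    c * ((y - t * z) * i) * u + (1# - t) * o ∎
    where
    c = y ^ a 0
    u = U (a ∘ suc) z ys
    o = deficit (a 0) (a ∘ suc) z (y ∷ ys)
    i = (y - z) ⁻¹

  -- After substituting `T-split` and `U-split`, the next deficit has coefficient 1 - (1 - t) x/(x -
  -- z) = κ(z, x). In the other term x and y carry the same exponent `a 0`, so up to a factor
  -- symmetric in x and y only t x - y is left; multiplied by κ(x, y) it becomes antisymmetric.
  deficit-step : ∀ p {a} → Decreasing a → ∀ z {n} x y (ys : Vec Carrier n) →
    x - z ≉ 0# → y - z ≉ 0# →
    deficit p a z (x ∷ y ∷ ys)
      ≈ x ^ a 0 * z ^ (p ∸ a 0) * (y ^ a 0 * (z * (t * x - y) * ((x - z) ⁻¹ * (y - z) ⁻¹))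
                                   * U (a ∘ suc) z ys)
      + x ^ a 0 * z ^ (p ∸ a 0) * κ z x * deficit (a 0) (a ∘ suc) z (y ∷ ys)
  deficit-step p {a} a-dec z x y ys x-z≉0 y-z≉0 = begin
    w * (T a z (y ∷ ys) - x * i * U a z (y ∷ ys))
      ≈⟨ *-congˡ (+-cong (T-split a-dec z y ys y-z≉0)
                         (-‿cong (*-congˡ (U-split a-dec z y ys y-z≉0)))) ⟩
    w * ((y * c * j * u + o) - x * i * (c * ((y - t * z) * j) * u + (1# - t) * o))
      ≈⟨ *-congˡ (+-congʳ (trans (sym (*-identityʳ _)) (*-congˡ (sym (inverseʳ _ x-z≉0))))) ⟩
    w * ((y * c * j * u + o) * ((x - z) * i) - x * i * (c * ((y - t * z) * j) * u + (1# - t) * o))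
      ≈⟨ solve 10 (λ w y c j u o x z i t →
           w :* ((y :* c :* j :* u :+ o) :* ((x :- z) :* i)
                 :- x :* i :* (c :* ((y :- t :* z) :* j) :* u :+ (con (+ 1) :- t) :* o))
           := w :* (c :* (z :* (t :* x :- y) :* (i :* j)) :* u)
              :+ w :* ((z :- t :* x) :* (:- i)) :* o) refl w y c j u o x z i t ⟩
    w * (c * (z * (t * x - y) * (i * j)) * u) + w * ((z - t * x) * - i) * o
      ≈⟨ +-congˡ (*-congʳ (*-congˡ (*-congˡ (⁻¹-flip x-z≉0)))) ⟨
    w * (c * (z * (t * x - y) * (i * j)) * u) + w * κ z x * o ∎
    where
    w = x ^ a 0 * z ^ (p ∸ a 0)
    c = y ^ a 0
    u = U (a ∘ suc) z ys
    o = deficit (a 0) (a ∘ suc) z (y ∷ ys)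
    i = (x - z) ⁻¹
    j = (y - z) ⁻¹

  -- Symmetrization of the deficit

  final : ∀ {n} → Vec Carrier (suc n) → Carrier
  final (x ∷ [])     = x
  final (x ∷ y ∷ ys) = final (y ∷ ys)

  -- Each use of `deficit-step` loses its antisymmetric term under the sum and leaves a factor κ(z,
  -- x), until one variable remains. In the result z has exponent p, as if it stood in a row above
  -- those of v. The symmetric weight `w` is arbitrary so that it can absorb the factors of the
  -- variables already split off.
  deficit-symmetrized : ∀ {n} p {a} → Decreasing a → a 0 ℕ.≤ p → a n ≡ 0 → ∀ z
    {w : Vec Carrier (suc n) → Carrier} → Invariant w → ∀ {xs} →
    AllPairs Generic xs → Allᵥ (Generic z) xs →
    orderSum xs (λ v → w v * (kernel v * deficit p a z v))
      ≈ orderSum xs (λ v → w v * (kernel v * (z ^ p * (Π (κ z) v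
                                * (monomial a v * (final v / (z - t * final v)))))))
  deficit-symmetrized {zero} p {a} a-dec a≤p a≡0 z {w} w-inv {y ∷ []} _ ((z≉y , z≉ty , _) ∷ [])
    -- The deficit is z^p times -y/(y - z). Writing this quotient as κ(z, y) · y/(z - t y) exhibits
    -- the factor κ(z, y) of the kernel of z followed by y.
    rewrite a≡0 = *-congˡ (*-congˡ (begin
      1# * zᵖ * (0# - y * i * 1#)
        ≈⟨ solve 3 (λ c y i → con (+ 1) :* c :* (con (+ 0) :- y :* i :* con (+ 1)) := c :* (y :* (:- i)))
                   refl zᵖ y i ⟩
      zᵖ * (y * - i)
        ≈⟨ *-congˡ (*-congˡ (⁻¹-flip (flip-≉0 z≉y))) ⟨
      zᵖ * (y * j)
        ≈⟨ *-identityʳ _ ⟨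
      zᵖ * (y * j) * 1#
        ≈⟨ *-congˡ (inverseʳ _ z≉ty) ⟨
      zᵖ * (y * j) * ((z - t * y) * k)
        ≈⟨ solve 6 (λ c y j z t k → c :* (y :* j) :* ((z :- t :* y) :* k)
             := c :* ((z :- t :* y) :* j :* con (+ 1) :* (con (+ 1) :* con (+ 1) :* (y :* k))))
             refl zᵖ y j z t k ⟩
      zᵖ * (κ z y * 1# * (1# * 1# * (y * k))) ∎))
    where
    zᵖ = z ^ p
    i = (y - z) ⁻¹
    j = (z - y) ⁻¹
    k = (z - t * y) ⁻¹
  deficit-symmetrized {suc n} p {a} a-dec a≤p a≡0 z {w} w-inv {xs} xs-gen z-gen = begin
    selectSum xs (λ x r → orderSum r (λ v → w (x ∷ v) * (kernel (x ∷ v) * deficit p a z (x ∷ v))))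
      ≈⟨ selectSum-cong xs (λ {_} {r} s → orderSum-cong r (λ o → split (All-orders (s ∷ o) z-gen))) ⟩
    selectSum xs (λ x r → orderSum r (λ v → odd x v + rest x v))
      ≈⟨ selectSum-cong xs (λ {x} {r} _ → orderSum-+ r (odd x) (rest x)) ⟩
    selectSum xs (λ x r → orderSum r (odd x) + orderSum r (rest x))
      ≈⟨ selectSum-+ xs _ _ ⟩
    selectSum xs (λ x r → orderSum r (odd x)) + selectSum xs (λ x r → orderSum r (rest x))
      -- The induction hypothesis is applied with `a 0` in place of p and with `restWeight x`, which
      -- is symmetric in the remaining variables, as the weight.
      ≈⟨ +-cong odd-vanishes (selectSum-cong xs (λ s → deficit-symmetrized (a 0) (a-dec ∘ suc) (a-dec 0) a≡0 z
           (rest-invariant _) (generic-rest s xs-gen) (tail-z s))) ⟩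
    0# + selectSum xs (λ x r → orderSum r (λ v → restWeight x v * (kernel v * target (a 0) (a ∘ suc) v)))
      ≈⟨ +-identityˡ _ ⟩
    selectSum xs (λ x r → orderSum r (λ v → restWeight x v * (kernel v * target (a 0) (a ∘ suc) v)))
      ≈⟨ selectSum-cong xs (λ {x} {r} _ → orderSum-cong r (λ {v} _ → collect x v)) ⟩
    selectSum xs (λ x r → orderSum r (λ v → w (x ∷ v) * (kernel (x ∷ v) * target p a (x ∷ v)))) ∎
    where
    target : ∀ {n} → ℕ → (ℕ → ℕ) → Vec Carrier (suc n) → Carrier
    target p a v = z ^ p * (Π (κ z) v * (monomial a v * (final v / (z - t * final v))))
    c : Carrier → Carrier
    c x = x ^ a 0 * z ^ (p ∸ a 0)
    odd rest restWeight : Carrier → Vec Carrier (suc n) → Carrier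
    odd x (y ∷ ys) = w (x ∷ y ∷ ys) * (kernel (x ∷ y ∷ ys)
      * (c x * (y ^ a 0 * (z * (t * x - y) * ((x - z) ⁻¹ * (y - z) ⁻¹)) * U (a ∘ suc) z ys)))
    restWeight x v = w (x ∷ v) * (Π (κ x) v * (c x * κ z x))
    rest x v = restWeight x v * (kernel v * deficit (a 0) (a ∘ suc) z v)

    split : ∀ {x v} → Allᵥ (Generic z) (x ∷ v) →
            w (x ∷ v) * (kernel (x ∷ v) * deficit p a z (x ∷ v)) ≈ odd x v + rest x v
    split {x} {y ∷ ys} ((z≉x , _) ∷ (z≉y , _) ∷ _) =
      trans (*-congˡ (*-congˡ (deficit-step p a-dec z x y ys (flip-≉0 z≉x) (flip-≉0 z≉y))))
        (solve 7 (λ w π k A c κ d → w :* ((π :* k) :* (A :+ c :* κ :* d))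
           := w :* ((π :* k) :* A) :+ w :* (π :* (c :* κ)) :* (k :* d))
           refl _ (Π (κ x) (y ∷ ys)) (kernel (y ∷ ys)) _ (c x) (κ z x) _)

    tail-z : ∀ {x r} → Selects xs x r → Allᵥ (Generic z) r
    tail-z s with All-select s z-gen
    ... | _ ∷ r-z = r-z

    rest-invariant : ∀ x → Invariant (restWeight x)
    rest-invariant x s = *-cong (w-inv (prep x s)) (*-congʳ (Π-invariant (κ x) s))

    odd-vanishes : selectSum xs (λ x r → orderSum r (odd x)) ≈ 0#
    odd-vanishes = selectSum-antisymmetric xs (λ x y s → orderSum s (λ ys → odd x (y ∷ ys)))
      λ {x} {y} {r} {s} s₁ s₂ → trans (sym (orderSum-+ s _ _)) (orderSum-0 s (λ {ys} o → antisymmetric x y ys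
        (x≉y s₁ s₂)))
      where
      x≉y : ∀ {x y r s} → Selects xs x r → Selects r y s → x - y ≉ 0#
      x≉y s₁ s₂ with All-select s₂ (generic-head s₁ xs-gen)
      ... | (x≉y , _) ∷ _ = x≉y
      -- (x − t y)(t x − y) is symmetric while x − y is not.
      antisymmetric : ∀ x y ys → x - y ≉ 0# → odd x (y ∷ ys) + odd y (x ∷ ys) ≈ 0#
      antisymmetric x y ys x≉y = begin
        odd x (y ∷ ys) + odd y (x ∷ ys)
          ≈⟨ +-congˡ (*-cong (w-inv (swap y x)) (*-congʳ (*-congʳ (*-congʳ (*-congˡ (⁻¹-flip x≉y)))))) ⟩
        odd x (y ∷ ys) + w (x ∷ y ∷ ys) * (((y - t * x) * - (x - y) ⁻¹ * Π (κ y) ys) * (Π (κ x) ys * kernel ys)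
          * (y ^ a 0 * z ^ (p ∸ a 0) * (x ^ a 0 * (z * (t * y - x) * ((y - z) ⁻¹ * (x - z) ⁻¹)) * U (a ∘ suc) z ys)))
          ≈⟨ solve 15 (λ w x y t i πx πy k X Y zp z ix iy u →
               w :* (((x :- t :* y) :* i :* πx) :* (πy :* k)
                  :* (X :* zp :* (Y :* (z :* (t :* x :- y) :* (ix :* iy)) :* u)))
               :+ w :* (((y :- t :* x) :* (:- i) :* πy) :* (πx :* k)
                  :* (Y :* zp :* (X :* (z :* (t :* y :- x) :* (iy :* ix)) :* u)))
               := con (+ 0))
               refl (w (x ∷ y ∷ ys)) x y t ((x - y) ⁻¹) (Π (κ x) ys) (Π (κ y) ys) (kernel ys)
               (x ^ a 0) (y ^ a 0) (z ^ (p ∸ a 0)) z ((x - z) ⁻¹) ((y - z) ⁻¹) (U (a ∘ suc) z ys) ⟩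
        0# ∎

    collect : ∀ x v → restWeight x v * (kernel v * target (a 0) (a ∘ suc) v)
                    ≈ w (x ∷ v) * (kernel (x ∷ v) * target p a (x ∷ v))
    collect x v@(_ ∷ _) = begin
      W * (π * (X * zd * κx)) * (k * (za * (πz * (m * f))))
        ≈⟨ solve 10 (λ W π X zd κx k za πz m f →
             W :* (π :* (X :* zd :* κx)) :* (k :* (za :* (πz :* (m :* f))))
             := W :* (π :* k :* ((zd :* za) :* (κx :* πz :* (X :* m :* f))))) refl W π X zd κx k za πz m f ⟩
      W * (π * k * ((zd * za) * (κx * πz * (X * m * f))))
        ≈⟨ *-congˡ (*-congˡ (*-congʳ (trans (sym (^-homo-* z (p ∸ a 0) (a 0)))
             (reflexive (≡.cong (z ^_) (ℕₚ.m∸n+n≡m a≤p)))))) ⟩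
      W * (π * k * (z ^ p * (κx * πz * (X * m * f)))) ∎
      where
      W = w (x ∷ v)
      π = Π (κ x) v
      X = x ^ a 0
      zd = z ^ (p ∸ a 0)
      za = z ^ a 0
      κx = κ z x
      k = kernel v
      πz = Π (κ z) v
      m = monomial (a ∘ suc) v
      f = final v / (z - t * final v)

  -- Symmetrization of U and of the monomial over all N variables

  -- For e = lagrange k this is Lagrange's formula with nodes v for the value of s^k at
  -- s = t · final v, divided by the product of the t · final v − y.
  bracket : ∀ {n} → (Carrier → Vec Carrier n → Carrier) → Vec Carrier (suc n) → Carrier
  bracket {zero}  e (w ∷ []) = e w []
  bracket {suc n} e (y ∷ v)  = bracket (λ z ys → e z (y ∷ ys)) v
                             + (1# - t) * final v / (y - t * final v) * e y v

  bracket-scale : ∀ {n} {c} (v : Vec Carrier (suc n)) {e f} →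
    (∀ {z ys} → Selects v z ys → e z ys ≈ c * f z ys) → bracket e v ≈ c * bracket f v
  bracket-scale {zero}      (w ∷ []) e≈ = e≈ here
  bracket-scale {suc n} {c} (y ∷ v) {e} {f} e≈ = begin
    bracket (λ z ys → e z (y ∷ ys)) v + q * e y v
      ≈⟨ +-cong (bracket-scale v (λ s → e≈ (there s))) (*-congˡ (e≈ here)) ⟩
    c * bracket (λ z ys → f z (y ∷ ys)) v + q * (c * f y v)
      ≈⟨ solve 4 (λ c b q f → c :* b :+ q :* (c :* f) := c :* (b :+ q :* f)) refl c _ q (f y v) ⟩
    c * (bracket (λ z ys → f z (y ∷ ys)) v + q * f y v) ∎
    where q = (1# - t) * final v / (y - t * final v)

  bracket-combine : ∀ {n} {c} (v : Vec Carrier (suc n)) {e f g} →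
    (∀ {z ys} → Selects v z ys → e z ys ≈ f z ys + c * g z ys) →
    bracket e v ≈ bracket f v + c * bracket g v
  bracket-combine {zero}      (w ∷ []) e≈ = e≈ here
  bracket-combine {suc n} {c} (y ∷ v) {e} {f} {g} e≈ = begin
    bracket (λ z ys → e z (y ∷ ys)) v + q * e y v
      ≈⟨ +-cong (bracket-combine v (λ s → e≈ (there s))) (*-congˡ (e≈ here)) ⟩
    bracket (λ z ys → f z (y ∷ ys)) v + c * bracket (λ z ys → g z (y ∷ ys)) v + q * (f y v + c * g y v)
      ≈⟨ solve 6 (λ c b d q f g → b :+ c :* d :+ q :* (f :+ c :* g)
           := (b :+ q :* f) :+ c :* (d :+ q :* g)) refl c _ _ q (f y v) (g y v) ⟩
    (bracket (λ z ys → f z (y ∷ ys)) v + q * f y v) + c * (bracket (λ z ys → g z (y ∷ ys)) v + q * g y v) ∎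
    where q = (1# - t) * final v / (y - t * final v)

  κ⁻ : Carrier → Carrier → Carrier
  κ⁻ y w = (y - w) / (y - t * w)

  κκ⁻ : ∀ {y w} → y - w ≉ 0# → y - t * w ≉ 0# → κ y w * κ⁻ y w ≈ 1#
  κκ⁻ {y} {w} p q = begin
    (y - t * w) * (y - w) ⁻¹ * ((y - w) * (y - t * w) ⁻¹)
      ≈⟨ solve 4 (λ a i b j → a :* i :* (b :* j) := (b :* i) :* (a :* j)) refl _ _ _ _ ⟩
    ((y - w) * (y - w) ⁻¹) * ((y - t * w) * (y - t * w) ⁻¹)
      ≈⟨ *-cong (inverseʳ _ p) (inverseʳ _ q) ⟩
    1# * 1# ≈⟨ *-identityˡ 1# ⟩
    1# ∎

  -- Here z is the last variable, and `κ⁻` divides out the factors κ(y, z) that the kernel of all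
  -- variables has beyond the kernel of the y's.
  moved : ∀ {n} → (Carrier → Vec Carrier n → Carrier) → Vec Carrier (suc n) → Carrier
  moved {zero}  e (w ∷ []) = e w []
  moved {suc n} e (y ∷ v)  = κ⁻ y (final v) * moved (λ z ys → e z (y ∷ ys)) v

  moved-scale : ∀ {n} {c} (v : Vec Carrier (suc n)) {e f} →
    (∀ {ys} → Selects v (final v) ys → e (final v) ys ≈ c * f (final v) ys) → moved e v ≈ c * moved f v
  moved-scale {zero}      (w ∷ []) e≈ = e≈ here
  moved-scale {suc n} {c} (y ∷ v@(_ ∷ _)) {e} {f} e≈ =
    trans (*-congˡ (moved-scale v (λ s → e≈ (there s))))
      (solve 3 (λ q c m → q :* (c :* m) := c :* (q :* m)) refl _ c _)

  -- Induction over the rows. By `U-split` either y keeps the first row and z passes on to the lower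
  -- ones, or, through `deficit-symmetrized`, z takes the first row itself. In the second case z
  -- collects the coefficient that `bracket` gives to a place before the last; a z that passes on to
  -- the end collects 1. The symmetry of `e z` is what `deficit-symmetrized` asks of its weight.
  U-symmetrized : ∀ {n a} → Decreasing a → a n ≡ 0 →
    {e : Carrier → Vec Carrier n → Carrier} → (∀ z → Invariant (e z)) → ∀ {xs} → AllPairs Generic xs →
    selectSum xs (λ z r → orderSum r (λ ys → e z ys * (kernel ys * U a z ys)))
      ≈ orderSum xs (λ v → kernel v * (monomial a v * bracket e v))
  U-symmetrized {zero} {a} a-dec a≡0 {e} e-inv {x ∷ []} _ rewrite a≡0 =
    solve 1 (λ e → e :* (con (+ 1) :* con (+ 1))
      := con (+ 1) :* con (+ 1) :* (con (+ 1) :* con (+ 1) :* e)) refl (e x [])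
  U-symmetrized {suc n} {a} a-dec a≡0 {e} e-inv {xs} xs-gen = begin
    selectSum xs (λ z r → orderSum r (λ ys → e z ys * (kernel ys * U a z ys)))
      ≈⟨ selectSum-cong xs (λ {z} {r} s → orderSum-cong r (λ {v} o → split z v (All-orders o (generic-head s xs-gen)))) ⟩
    selectSum xs (λ z r → orderSum r (λ v → head z v + deficient z v))
      ≈⟨ selectSum-cong xs (λ {z} {r} _ → orderSum-+ r (head z) (deficient z)) ⟩
    selectSum xs (λ z r → orderSum r (head z) + orderSum r (deficient z))
      ≈⟨ selectSum-+ xs _ _ ⟩
    selectSum xs (λ z r → orderSum r (head z)) + selectSum xs (λ z r → orderSum r (deficient z))
      -- Choosing y first leaves z to be summed over the remaining places, as the induction
      -- requires; the factor κ(y, z) from `U-split` has completed the product of κ(y, ·) over z and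
      -- the other variables.
      ≈⟨ +-cong (selectSum-swap xs (λ z y s → orderSum s (λ ys → head z (y ∷ ys))))
                (selectSum-cong xs (λ {z} s → deficit-symmetrized (a 0) (a-dec ∘ suc) (a-dec 0) a≡0 z
                  (λ σ → *-congˡ (e-inv z σ)) (generic-rest s xs-gen) (generic-head s xs-gen))) ⟩
    selectSum xs (λ y r → selectSum r (λ z s → orderSum s (λ ys → e′ y z ys * (kernel ys * U (a ∘ suc) z ys))))
      + selectSum xs (λ z r → orderSum r (λ v → (1# - t) * e z v * (kernel v * target z v)))
      ≈⟨ +-congʳ (selectSum-cong xs (λ {y} s → U-symmetrized (a-dec ∘ suc) a≡0 (e′-inv y) (generic-rest s xs-gen))) ⟩
    selectSum xs (λ y r → orderSum r (λ v → kernel v * (monomial (a ∘ suc) v * bracket (e′ y) v)))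
      + selectSum xs (λ z r → orderSum r (λ v → (1# - t) * e z v * (kernel v * target z v)))
      -- In the second sum the chosen z is renamed y: it is now the first entry of an ordering of
      -- all the variables.
      ≈⟨ selectSum-+ xs _ _ ⟨
    selectSum xs (λ y r → orderSum r (λ v → kernel v * (monomial (a ∘ suc) v * bracket (e′ y) v))
                  + orderSum r (λ v → (1# - t) * e y v * (kernel v * target y v)))
      ≈⟨ selectSum-cong xs (λ {y} {r} _ → orderSum-+ r
           (λ v → kernel v * (monomial (a ∘ suc) v * bracket (e′ y) v))
           (λ v → (1# - t) * e y v * (kernel v * target y v))) ⟨
    selectSum xs (λ y r → orderSum r (λ v → kernel v * (monomial (a ∘ suc) v * bracket (e′ y) v)
                                + (1# - t) * e y v * (kernel v * target y v)))
      ≈⟨ selectSum-cong xs (λ {y} {r} _ → orderSum-cong r (λ {v} _ → collect y v)) ⟩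
    selectSum xs (λ y r → orderSum r (λ v → kernel (y ∷ v) * (monomial a (y ∷ v) * bracket e (y ∷ v)))) ∎
    where
    head deficient target : Carrier → Vec Carrier (suc n) → Carrier
    e′ : Carrier → Carrier → Vec Carrier n → Carrier
    e′ y z ys = y ^ a 0 * (κ y z * Π (κ y) ys) * e z (y ∷ ys)
    head z (y ∷ ys) = e′ y z ys * (kernel ys * U (a ∘ suc) z ys)
    deficient z v = (1# - t) * e z v * (kernel v * deficit (a 0) (a ∘ suc) z v)
    target z v = z ^ a 0 * (Π (κ z) v * (monomial (a ∘ suc) v * (final v / (z - t * final v))))

    split : ∀ z v → Allᵥ (Generic z) v → e z v * (kernel v * U a z v) ≈ head z v + deficient z v
    split z (y ∷ ys) ((z≉y , _) ∷ _) =
      trans (*-congˡ (*-congˡ (U-split a-dec z y ys (flip-≉0 z≉y))))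
        (solve 8 (λ e π k c κ u s d → e :* ((π :* k) :* (c :* κ :* u :+ s :* d))
           := (c :* (κ :* π) :* e) :* (k :* u) :+ s :* e :* ((π :* k) :* d)) refl
           (e z (y ∷ ys)) (Π (κ y) ys) (kernel ys) (y ^ a 0) (κ y z) (U (a ∘ suc) z ys) (1# - t)
           (deficit (a 0) (a ∘ suc) z (y ∷ ys)))

    e′-inv : ∀ y z → Invariant (e′ y z)
    e′-inv y z σ = *-cong (*-congˡ (*-congˡ (Π-invariant (κ y) σ))) (e-inv z (prep y σ))

    collect : ∀ y v → kernel v * (monomial (a ∘ suc) v * bracket (e′ y) v)
                    + (1# - t) * e y v * (kernel v * target y v)
                    ≈ kernel (y ∷ v) * (monomial a (y ∷ v) * bracket e (y ∷ v))
    collect y v = begin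
      k * (m * bracket (e′ y) v) + s * e y v * (k * (c * (π * (m * (w * i)))))
        -- The product of κ(y, ·) over z and the rest is the same for every choice of z in v, so it
        -- leaves the bracket.
        ≈⟨ +-congʳ (*-congˡ (*-congˡ (bracket-scale v (λ σ → *-congʳ (*-congˡ (Π-select (κ y) σ)))))) ⟩
      k * (m * (c * π * β)) + s * e y v * (k * (c * (π * (m * (w * i)))))
        ≈⟨ solve 9 (λ k m c π b s e w i →
             k :* (m :* (c :* π :* b)) :+ s :* e :* (k :* (c :* (π :* (m :* (w :* i)))))
             := π :* k :* (c :* m :* (b :+ s :* w :* i :* e))) refl k m c π β s (e y v) w i ⟩
      π * k * (c * m * (β + s * w * i * e y v)) ∎
      where
      k = kernel v
      m = monomial (a ∘ suc) v
      c = y ^ a 0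
      π = Π (κ y) v
      s = 1# - t
      w = final v
      i = (y - t * final v) ⁻¹
      β = bracket (λ z ys → e z (y ∷ ys)) v

  -- Since `a n` is 0, appending z as the last variable does not change the monomial; only the
  -- kernel has to be corrected, which `moved` records.
  monomial-symmetrized : ∀ {n a} → a n ≡ 0 → (e : Carrier → Vec Carrier n → Carrier) →
    ∀ {xs} → AllPairs Generic xs →
    selectSum xs (λ z r → orderSum r (λ ys → e z ys * (kernel ys * monomial a ys)))
      ≈ orderSum xs (λ v → kernel v * (monomial a v * moved e v))
  monomial-symmetrized {zero} {a} a≡0 e {x ∷ []} _ rewrite a≡0 =
    solve 1 (λ e → e :* (con (+ 1) :* con (+ 1))
      := con (+ 1) :* con (+ 1) :* (con (+ 1) :* con (+ 1) :* e)) refl (e x [])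
  monomial-symmetrized {suc n} {a} a≡0 e {xs} xs-gen = begin
    selectSum xs (λ z r → orderSum r (λ ys → e z ys * (kernel ys * monomial a ys)))
      ≈⟨ selectSum-swap xs (λ z y s → orderSum s (λ ys → e z (y ∷ ys) * (kernel (y ∷ ys) * monomial a (y ∷ ys)))) ⟩
    selectSum xs (λ y r → selectSum r (λ z s → orderSum s (λ ys → e z (y ∷ ys) * (kernel (y ∷ ys) * monomial a (y ∷ ys)))))
      ≈⟨ selectSum-cong xs (λ {y} {r} _ → selectSum-cong r (λ {z} {s} _ → orderSum-cong s (λ {ys} _ →
           solve 5 (λ e π k c m → e :* ((π :* k) :* (c :* m)) := c :* π :* e :* (k :* m)) refl
             (e z (y ∷ ys)) (Π (κ y) ys) (kernel ys) (y ^ a 0) (monomial (a ∘ suc) ys)))) ⟩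
    selectSum xs (λ y r → selectSum r (λ z s → orderSum s (λ ys → e′ y z ys * (kernel ys * monomial (a ∘ suc) ys))))
      ≈⟨ selectSum-cong xs (λ {y} s → monomial-symmetrized a≡0 (e′ y) (generic-rest s xs-gen)) ⟩
    selectSum xs (λ y r → orderSum r (λ v → kernel v * (monomial (a ∘ suc) v * moved (e′ y) v)))
      ≈⟨ selectSum-cong xs (λ {y} {r} s → orderSum-cong r (λ {v} o → collect y v (All-orders o (generic-head s xs-gen)))) ⟩
    selectSum xs (λ y r → orderSum r (λ v → kernel (y ∷ v) * (monomial a (y ∷ v) * moved e (y ∷ v)))) ∎
    where
    e′ : Carrier → Carrier → Vec Carrier n → Carrier
    e′ y z ys = y ^ a 0 * Π (κ y) ys * e z (y ∷ ys)

    collect : ∀ y v → Allᵥ (Generic y) v → kernel v * (monomial (a ∘ suc) v * moved (e′ y) v)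
                    ≈ kernel (y ∷ v) * (monomial a (y ∷ v) * moved e (y ∷ v))
    collect y v y-gen = begin
      k * (m * moved (e′ y) v)
        ≈⟨ *-congˡ (*-congˡ (moved-scale v scale)) ⟩
      k * (m * (c * (π * q) * g))
        ≈⟨ solve 6 (λ k m c π q g → k :* (m :* (c :* (π :* q) :* g)) := π :* k :* (c :* m :* (q :* g)))
             refl k m c π q g ⟩
      π * k * (c * m * (q * g)) ∎
      where
      k = kernel v
      m = monomial (a ∘ suc) v
      c = y ^ a 0
      π = Π (κ y) v
      q = κ⁻ y (final v)
      g = moved (λ z ys → e z (y ∷ ys)) v
      scale : ∀ {ys} → Selects v (final v) ys →
              c * Π (κ y) ys * e (final v) (y ∷ ys) ≈ c * (π * q) * e (final v) (y ∷ ys)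
      scale {ys} σ with All-select σ y-gen
      ... | (y≉w , y≉tw , _) ∷ _ = *-congʳ (*-congˡ (begin
        Π (κ y) ys                            ≈⟨ *-identityʳ _ ⟨
        Π (κ y) ys * 1#                       ≈⟨ *-congˡ (κκ⁻ y≉w y≉tw) ⟨
        Π (κ y) ys * (κ y (final v) * q)      ≈⟨ solve 3 (λ a b c → a :* (b :* c) := b :* a :* c) refl _ _ q ⟩
        κ y (final v) * Π (κ y) ys * q        ≈⟨ *-congʳ (Π-select (κ y) σ) ⟩
        π * q                                 ∎))

  -- Lagrange interpolation at t times the last variable

  lagrange : ℕ → ∀ {n} → Carrier → Vec Carrier n → Carrier
  lagrange k z ys = z ^ k * Π (λ w → (z - w) ⁻¹) ys

  lagrange-invariant : ∀ k z {n} → Invariant (lagrange k {n} z)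
  lagrange-invariant k z σ = *-congˡ (Π-invariant (λ w → (z - w) ⁻¹) σ)

  nodeWeight : ∀ {n} → Vec Carrier (suc n) → Carrier
  nodeWeight (w ∷ [])         = 1#
  nodeWeight (y ∷ v@(_ ∷ _)) = (t * final v - y) ⁻¹ * nodeWeight v

  final-All : ∀ {n} {P : Carrier → Set} (v : Vec Carrier (suc n)) → Allᵥ P v → P (final v)
  final-All (w ∷ [])        (p ∷ []) = p
  final-All (y ∷ v@(_ ∷ _)) (_ ∷ ps) = final-All v ps

  partialFractions : ∀ {a b} z → z - a ≉ 0# → z - b ≉ 0# →
    (a - b) * ((z - a) ⁻¹ * (z - b) ⁻¹) ≈ (z - a) ⁻¹ - (z - b) ⁻¹
  partialFractions {a} {b} z z≉a z≉b = begin
    (a - b) * (i * j)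
      ≈⟨ solve 5 (λ a b z i j → (a :- b) :* (i :* j)
           := i :* ((z :- b) :* j) :- j :* ((z :- a) :* i)) refl a b z i j ⟩
    i * ((z - b) * j) - j * ((z - a) * i)
      ≈⟨ +-cong (trans (*-congˡ (inverseʳ _ z≉b)) (*-identityʳ i))
                (-‿cong (trans (*-congˡ (inverseʳ _ z≉a)) (*-identityʳ j))) ⟩
    i - j ∎
    where
    i = (z - a) ⁻¹
    j = (z - b) ⁻¹

  -- Interpolation of the constant 1 by divided differences: (x - y)/((z - x)(z - y)) = 1/(z - x) -
  -- 1/(z - y) reduces the nodes x, y, u to x, u and to y, u. The last node must stay in place
  -- because it determines the point of evaluation, so the case of two nodes is a base case of its
  -- own.
  bracket-lagrange₀ : ∀ {n} (v : Vec Carrier (suc n)) → AllPairs Generic v →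
                      bracket (lagrange 0) v ≈ nodeWeight v
  bracket-lagrange₀ (w ∷ []) _ = *-identityˡ 1#
  bracket-lagrange₀ (y ∷ w ∷ []) (((y≉w , y≉tw , _) ∷ []) ∷ _) = begin
    1# * ((w - y) ⁻¹ * 1#) + (1# - t) * w * i * (1# * (j * 1#))
      ≈⟨ +-congʳ (*-congˡ (trans (*-congʳ (⁻¹-flip y≉w)) (*-congˡ (sym (inverseʳ _ y≉tw))))) ⟩
    1# * (- j * ((y - t * w) * i)) + (1# - t) * w * i * (1# * (j * 1#))
      ≈⟨ solve 5 (λ y w t i j → con (+ 1) :* ((:- j) :* ((y :- t :* w) :* i))
             :+ (con (+ 1) :- t) :* w :* i :* (con (+ 1) :* (j :* con (+ 1)))
           := (:- i) :* ((y :- w) :* j)) refl y w t i j ⟩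
    - i * ((y - w) * j)
      ≈⟨ *-cong (sym (⁻¹-flip y≉tw)) (inverseʳ _ y≉w) ⟩
    (t * w - y) ⁻¹ * 1# ∎
    where
    i = (y - t * w) ⁻¹
    j = (y - w) ⁻¹
  bracket-lagrange₀ (x ∷ y ∷ u@(_ ∷ _))
                    (((x≉y , _) ∷ x-gen) ∷ (y-gen ∷ u-gen)) = cancelˡ x≉y (begin
    (x - y) * (bracket (λ z ys → c z (x ∷ y ∷ ys)) u + q * c y (x ∷ u) + p * c x (y ∷ u))
      ≈⟨ solve 6 (λ d B q a p b → d :* (B :+ q :* a :+ p :* b) := d :* B :+ q :* (d :* a) :+ p :* (d :* b))
           refl (x - y) _ q _ p _ ⟩
    (x - y) * bracket (λ z ys → c z (x ∷ y ∷ ys)) u + q * ((x - y) * c y (x ∷ u))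
      + p * ((x - y) * c x (y ∷ u))
      ≈⟨ +-cong (+-cong (trans (sym (bracket-scale u (λ _ → refl))) (bracket-combine u separate))
                        (*-congˡ y-node)) (*-congˡ x-node) ⟩
    bracket (λ z ys → c z (x ∷ ys)) u + - 1# * bracket (λ z ys → c z (y ∷ ys)) u + q * - c y u + p * c x u
      ≈⟨ solve 6 (λ A B q a p b → A :+ (:- con (+ 1)) :* B :+ q :* (:- a) :+ p :* b
           := (A :+ p :* b) :- (B :+ q :* a)) refl _ _ q (c y u) p (c x u) ⟩
    bracket c (x ∷ u) - bracket c (y ∷ u)
      ≈⟨ +-cong (bracket-lagrange₀ (x ∷ u) (x-gen ∷ u-gen))
                (-‿cong (bracket-lagrange₀ (y ∷ u) (y-gen ∷ u-gen))) ⟩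
    i * nodeWeight u - j * nodeWeight u
      ≈⟨ solve 3 (λ i j n → i :* n :- j :* n := (i :- j) :* n) refl i j (nodeWeight u) ⟩
    (i - j) * nodeWeight u
      ≈⟨ *-congʳ (partialFractions (t * final u) (flip-≉0 (proj₁ (proj₂ (final-All u x-gen))))
                                                 (flip-≉0 (proj₁ (proj₂ (final-All u y-gen))))) ⟨
    (x - y) * (i * j) * nodeWeight u
      ≈⟨ solve 4 (λ d i j n → d :* (i :* j) :* n := d :* (i :* (j :* n))) refl (x - y) i j (nodeWeight u) ⟩
    (x - y) * (i * (j * nodeWeight u)) ∎)
    where
    c : ∀ {n} → Carrier → Vec Carrier n → Carrier
    c = lagrange 0
    q = (1# - t) * final u / (y - t * final u)
    p = (1# - t) * final u / (x - t * final u)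
    i = (t * final u - x) ⁻¹
    j = (t * final u - y) ⁻¹
    separate : ∀ {z ys} → Selects u z ys →
               (x - y) * c z (x ∷ y ∷ ys) ≈ c z (x ∷ ys) + - 1# * c z (y ∷ ys)
    separate {z} {ys} σ with All-select σ x-gen | All-select σ y-gen
    ... | (x≉z , _) ∷ _ | (y≉z , _) ∷ _ = begin
      (x - y) * (1# * ((z - x) ⁻¹ * ((z - y) ⁻¹ * r)))
        ≈⟨ solve 4 (λ d i j r → d :* (con (+ 1) :* (i :* (j :* r))) := d :* (i :* j) :* r) refl _ _ _ r ⟩
      (x - y) * ((z - x) ⁻¹ * (z - y) ⁻¹) * r
        ≈⟨ *-congʳ (partialFractions z (flip-≉0 x≉z) (flip-≉0 y≉z)) ⟩
      ((z - x) ⁻¹ - (z - y) ⁻¹) * r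
        ≈⟨ solve 3 (λ i j r → (i :- j) :* r := con (+ 1) :* (i :* r)
             :+ (:- con (+ 1)) :* (con (+ 1) :* (j :* r))) refl _ _ r ⟩
      1# * ((z - x) ⁻¹ * r) + - 1# * (1# * ((z - y) ⁻¹ * r)) ∎
      where r = Π (λ w → (z - w) ⁻¹) ys
    x-node : (x - y) * c x (y ∷ u) ≈ c x u
    x-node = begin
      (x - y) * (1# * ((x - y) ⁻¹ * r))
        ≈⟨ solve 3 (λ d i r → d :* (con (+ 1) :* (i :* r)) := d :* i :* r) refl _ _ r ⟩
      (x - y) * (x - y) ⁻¹ * r   ≈⟨ *-congʳ (inverseʳ _ x≉y) ⟩
      1# * r                     ∎
      where r = Π (λ w → (x - w) ⁻¹) u
    y-node : (x - y) * c y (x ∷ u) ≈ - c y u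
    y-node = begin
      (x - y) * (1# * ((y - x) ⁻¹ * r))
        ≈⟨ *-congˡ (*-congˡ (*-congʳ (⁻¹-flip x≉y))) ⟩
      (x - y) * (1# * (- (x - y) ⁻¹ * r))
        ≈⟨ solve 3 (λ d i r → d :* (con (+ 1) :* ((:- i) :* r)) := :- (d :* i :* r)) refl _ _ r ⟩
      - ((x - y) * (x - y) ⁻¹ * r)   ≈⟨ -‿cong (*-congʳ (inverseʳ _ x≉y)) ⟩
      - (1# * r)                     ∎
      where r = Π (λ w → (y - w) ⁻¹) u

  -- From z^(k+1)/(z - y) = z^k + y z^k/(z - y): the exponent drops by one, and where the node y
  -- drops out as well the bound on the degree by the number of nodes is kept.
  bracket-lagrange : ∀ {n} k → k ℕ.≤ n → (v : Vec Carrier (suc n)) → AllPairs Generic v →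
                     bracket (lagrange k) v ≈ (t * final v) ^ k * nodeWeight v
  bracket-lagrange zero    _ v v-gen = trans (bracket-lagrange₀ v v-gen) (sym (*-identityˡ _))
  bracket-lagrange (suc k) (ℕ.s≤s k≤n) (y ∷ v@(_ ∷ _)) (y-gen ∷ v-gen) = begin
    bracket (λ z ys → lagrange (suc k) z (y ∷ ys)) v + q * lagrange (suc k) y v
      ≈⟨ +-cong (bracket-combine v lower) (*-congˡ (*-assoc y (y ^ k) _)) ⟩
    bracket (lagrange k) v + y * bracket (λ z ys → lagrange k z (y ∷ ys)) v + q * (y * lagrange k y v)
      ≈⟨ solve 5 (λ A y B q d → A :+ y :* B :+ q :* (y :* d) := A :+ y :* (B :+ q :* d))
           refl _ y _ q (lagrange k y v) ⟩
    bracket (lagrange k) v + y * bracket (lagrange k) (y ∷ v)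
      ≈⟨ +-cong (bracket-lagrange k k≤n v v-gen)
                (*-congˡ (bracket-lagrange k (ℕₚ.m≤n⇒m≤1+n k≤n) (y ∷ v) (y-gen ∷ v-gen))) ⟩
    c * n + y * (c * (i * n))
      ≈⟨ +-congʳ (trans (sym (*-identityʳ _)) (*-congˡ (sym (inverseʳ _ s≉y)))) ⟩
    c * n * ((s - y) * i) + y * (c * (i * n))
      ≈⟨ solve 5 (λ c n s y i → c :* n :* ((s :- y) :* i) :+ y :* (c :* (i :* n)) := s :* c :* (i :* n))
           refl c n s y i ⟩
    s * c * (i * n) ∎
    where
    s = t * final v
    q = (1# - t) * final v / (y - t * final v)
    c = s ^ k
    n = nodeWeight v
    i = (s - y) ⁻¹
    s≉y = flip-≉0 (proj₁ (proj₂ (final-All v y-gen)))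
    lower : ∀ {z ys} → Selects v z ys →
            lagrange (suc k) z (y ∷ ys) ≈ lagrange k z ys + y * lagrange k z (y ∷ ys)
    lower {z} {ys} σ with All-select σ y-gen
    ... | (y≉z , _) ∷ _ = begin
      z * d * (j * r)
        ≈⟨ solve 5 (λ z y d j r → z :* d :* (j :* r)
             := d :* (((z :- y) :* j) :* r) :+ y :* (d :* (j :* r))) refl z y d j r ⟩
      d * (((z - y) * j) * r) + y * (d * (j * r))
        ≈⟨ +-congʳ (*-congˡ (trans (*-congʳ (inverseʳ _ (flip-≉0 y≉z))) (*-identityˡ r))) ⟩
      d * r + y * (d * (j * r)) ∎
      where
      d = z ^ k
      j = (z - y) ⁻¹
      r = Π (λ w → (z - w) ⁻¹) ys

  -- With w the last variable, κ⁻(y, w)/(w - y) = 1/(t w - y), which is the factor of `nodeWeight`.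
  moved-lagrange : ∀ {n} k (v : Vec Carrier (suc n)) → AllPairs Generic v →
                   moved (lagrange k) v ≈ final v ^ k * nodeWeight v
  moved-lagrange k (w ∷ [])        _               = refl
  moved-lagrange k (y ∷ v@(_ ∷ _)) (y-gen ∷ v-gen) = begin
    κ⁻ y w * moved (λ z ys → lagrange k z (y ∷ ys)) v
      ≈⟨ *-congˡ (moved-scale v (λ _ → solve 3 (λ c i r → c :* (i :* r) := i :* (c :* r)) refl _ _ _)) ⟩
    κ⁻ y w * ((w - y) ⁻¹ * moved (lagrange k) v)
      ≈⟨ *-congˡ (*-cong (⁻¹-flip y≉w) (moved-lagrange k v v-gen)) ⟩
    (y - w) * i * (- j * (w ^ k * nodeWeight v))
      ≈⟨ solve 5 (λ d i j c n → d :* i :* ((:- j) :* (c :* n)) := (d :* j) :* (c :* ((:- i) :* n)))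
           refl (y - w) i j (w ^ k) (nodeWeight v) ⟩
    ((y - w) * j) * (w ^ k * (- i * nodeWeight v))
      ≈⟨ *-cong (inverseʳ _ y≉w) (*-congˡ (*-congʳ (sym (⁻¹-flip y≉tw)))) ⟩
    1# * (w ^ k * ((t * w - y) ⁻¹ * nodeWeight v))
      ≈⟨ *-identityˡ _ ⟩
    w ^ k * ((t * w - y) ⁻¹ * nodeWeight v) ∎
    where
    w = final v
    i = (y - t * w) ⁻¹
    j = (y - w) ⁻¹
    y≉w = proj₁ (final-All v y-gen)
    y≉tw = proj₁ (proj₂ (final-All v y-gen))

  -- For w the last variable, `bracket` yields (t w)^n and `moved` yields w^n, with the same node
  -- weight. The constant t^n is the ratio of the two, so the integrands cancel for each ordering
  -- separately.
  symmetrized-vanishes : ∀ {n a} → Decreasing a → a n ≡ 0 → ∀ {xs} → AllPairs Generic xs →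
    selectSum xs (λ z r → orderSum r (λ ys →
      lagrange n z ys * (kernel ys * (U a z ys - t ^ n * monomial a ys)))) ≈ 0#
  symmetrized-vanishes {n} {a} a-dec a≡0 {xs} xs-gen = begin
    selectSum xs (λ z r → orderSum r (λ ys → lagrange n z ys * (kernel ys * (U a z ys - t ^ n * monomial a ys))))
      ≈⟨ selectSum-cong xs (λ {z} {r} _ → orderSum-cong r (λ {ys} _ →
           solve 5 (λ e k u c m → e :* (k :* (u :- c :* m)) := e :* (k :* u) :+ (:- c) :* (e :* (k :* m)))
             refl (lagrange n z ys) (kernel ys) (U a z ys) (t ^ n) (monomial a ys))) ⟩
    selectSum xs (λ z r → orderSum r (λ ys → F z ys + - t ^ n * G z ys))
      ≈⟨ selectSum-cong xs (λ {z} {r} _ → trans (orderSum-+ r _ _) (+-congˡ (orderSum-* r _ _))) ⟩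
    selectSum xs (λ z r → orderSum r (F z) + - t ^ n * orderSum r (G z))
      ≈⟨ trans (selectSum-+ xs _ _) (+-congˡ (selectSum-* xs _ _)) ⟩
    selectSum xs (λ z r → orderSum r (F z)) + - t ^ n * selectSum xs (λ z r → orderSum r (G z))
      ≈⟨ +-cong (U-symmetrized a-dec a≡0 (λ z → lagrange-invariant n z) xs-gen)
                (*-congˡ (monomial-symmetrized a≡0 (λ z → lagrange n z) xs-gen)) ⟩
    orderSum xs F′ + - t ^ n * orderSum xs G′
      ≈⟨ +-congˡ (orderSum-* xs (- t ^ n) G′) ⟨
    orderSum xs F′ + orderSum xs (λ v → - t ^ n * G′ v)
      ≈⟨ orderSum-+ xs F′ (λ v → - t ^ n * G′ v) ⟨
    orderSum xs (λ v → F′ v + - t ^ n * G′ v)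
      ≈⟨ orderSum-0 xs (λ {v} o → cancels v (AllPairs-orders (λ {a} {b} → Generic-sym {a} {b}) o xs-gen)) ⟩
    0# ∎
    where
    F G : Carrier → Vec Carrier n → Carrier
    F z ys = lagrange n z ys * (kernel ys * U a z ys)
    G z ys = lagrange n z ys * (kernel ys * monomial a ys)
    F′ G′ : Vec Carrier (suc n) → Carrier
    F′ v = kernel v * (monomial a v * bracket (lagrange n) v)
    G′ v = kernel v * (monomial a v * moved (lagrange n) v)
    cancels : ∀ v → AllPairs Generic v → F′ v + - t ^ n * G′ v ≈ 0#
    cancels v v-gen = begin
      k * (m * bracket (lagrange n) v) + - t ^ n * (k * (m * moved (lagrange n) v))
        ≈⟨ +-cong (*-congˡ (*-congˡ (trans (bracket-lagrange n ℕₚ.≤-refl v v-gen)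
                                           (*-congʳ (^-distrib-* t (final v) n)))))
                  (*-congˡ (*-congˡ (*-congˡ (moved-lagrange n v v-gen)))) ⟩
      k * (m * (t ^ n * final v ^ n * nodeWeight v)) + - t ^ n * (k * (m * (final v ^ n * nodeWeight v)))
        ≈⟨ solve 5 (λ k m c d p → k :* (m :* (c :* d :* p)) :+ (:- c) :* (k :* (m :* (d :* p))) := con (+ 0))
             refl k m (t ^ n) (final v ^ n) (nodeWeight v) ⟩
      0# ∎
      where
      k = kernel v
      m = monomial a v

  -- The row recursion for φ

  module Sum = Fold +-commutativeMonoid
  module Prod = Fold *-commutativeMonoid
  open Sum using (keep)

  sum-* : ∀ {A : Set} (as : List A) c f → Sum.fold as (λ a → c * f a) ≈ c * Sum.fold as f
  sum-* []       c f = sym (zeroʳ c)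
  sum-* (a ∷ as) c f = trans (+-congˡ (sum-* as c f)) (sym (distribˡ c _ _))

  keep-0 : ∀ {P : Set} (P? : Dec P) {x} → x ≈ 0# → keep P? x ≈ 0#
  keep-0 (yes _) e = e
  keep-0 (no _)  e = refl

  -- branch₀ omits from φ the factor of the column part lam 0.
  branch branch₀ : List ℕ → List ℕ → Carrier
  branch []        []      = 1#
  branch (p ∷ lam) (ν ∷ μ) = t * keep (ν ℕ.≟ p) (branch lam μ) + (1# - t) * branch₀ (p ∷ lam) (ν ∷ μ)
  branch _         _       = 0#
  branch₀ (p ∷ lam) (ν ∷ μ) = keep (part lam 0 ℕ.<? ν) (branch lam μ) + keep (ν ℕ.≟ part lam 0) (branch₀ lam μ)
  branch₀ _         _       = 0#

  weight : ℕ → ℕ → ℕ → Carrier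
  weight d d′ m = Prod.keep (d′ ℕ.<? d) (1# - t ^ m)

  column : List ℕ → List ℕ → ℕ → Carrier
  column lam μ i = weight (excess lam μ i) (excess lam μ (suc i)) (multiplicity lam i)

  φ-columns : ∀ lam μ → Interlacing lam μ → φ lam μ ≈ Prod.fold [1⋯ part lam 0 ] (column lam μ)
  φ-columns lam μ I with interlacing? lam μ
  ... | yes _ = Prod.fold-filter (λ i → excess lam μ (suc i) ℕ.<? excess lam μ i) [1⋯ part lam 0 ] _
  ... | no ¬I = contradiction I ¬I

  φ-0 : ∀ lam μ → ¬ Interlacing lam μ → φ lam μ ≈ 0#
  φ-0 lam μ ¬I with interlacing? lam μ
  ... | yes I = contradiction I ¬I
  ... | no _  = refl

  weight-cong : ∀ {d d₁ d′ d′₁ m m₁} → d ≡ d₁ → d′ ≡ d′₁ → m ≡ m₁ → weight d d′ m ≈ weight d₁ d′₁ m₁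
  weight-cong ≡.refl ≡.refl ≡.refl = refl

  column-1 : ∀ lam μ i → excess lam μ i ℕ.≤ excess lam μ (suc i) → column lam μ i ≈ 1#
  column-1 lam μ i ≤ = Prod.keep-no (excess lam μ (suc i) ℕ.<? excess lam μ i) (ℕₚ.≤⇒≯ ≤)

  column-0 : ∀ lam μ i → excess lam μ i ≡ 0 → column lam μ i ≈ 1#
  column-0 lam μ i ≡0 = column-1 lam μ i (≡.subst (ℕ._≤ excess lam μ (suc i)) (≡.sym ≡0) ℕ.z≤n)

  module _ {p ν lam μ} (lam-part : IsPartition lam) (μ-part : IsPartition μ) (q≤p : part lam 0 ℕ.≤ p)
           (q≤ν : part lam 0 ℕ.≤ ν) (μ≤q : part μ 0 ℕ.≤ part lam 0) where
    column-same : ∀ {i} → i ℕ.< p → i ℕ.< ν → column (p ∷ lam) (ν ∷ μ) i ≈ column lam μ i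
    column-same i<p i<ν = weight-cong
      (excess-same lam μ (ℕₚ.<⇒≤ i<p) (ℕₚ.<⇒≤ i<ν)) (excess-same lam μ i<p i<ν)
      (multiplicity-≢ lam (ℕₚ.<⇒≢ i<p))

    -- Column i + 1 holds a box of the first row, and no column holds more than one, so the count
    -- cannot drop after column i.
    column-flat : (∀ i → excess (p ∷ lam) (ν ∷ μ) i ℕ.≤ 1) →
                  ∀ {i} → i ℕ.< p → ν ℕ.≤ i → column (p ∷ lam) (ν ∷ μ) i ≈ 1#
    column-flat ≤1 {i} i<p ν≤i = column-1 (p ∷ lam) (ν ∷ μ) i (≡.subst (excess (p ∷ lam) (ν ∷ μ) i ℕ.≤_)
      (≡.sym (excess-1 lam-part μ-part q<1+i (ℕₚ.≤-<-trans μ≤q q<1+i) i<p (ℕ.s≤s ν≤i))) (≤1 i))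
      where q<1+i = ℕ.s≤s (ℕₚ.≤-trans q≤ν ν≤i)

    column-flat′ : ∀ {i} → i ℕ.< p → i ℕ.< ν → part lam 0 ℕ.< i → column (p ∷ lam) (ν ∷ μ) i ≈ 1#
    column-flat′ {i} i<p i<ν q<i = column-0 (p ∷ lam) (ν ∷ μ) i
      (≡.trans (excess-same lam μ (ℕₚ.<⇒≤ i<p) (ℕₚ.<⇒≤ i<ν)) (excess-beyond {μ = μ} lam-part q<i))

  -- The first row adds to the multiplicity only in the column where it ends. That column is split
  -- off and compared in `top` with the weights t and 1 - t; `branch₀-columns` treats the others.
  branch-columns : ∀ {lam μ} → IsPartition lam → Strip lam μ →
                   Prod.fold [1⋯ part lam 0 ] (column lam μ) ≈ branch lam μ
  -- Let q be the second part. The columns from ν to p - 1 have factor 1. If ν > q, those strictly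
  -- between q and ν do too, and column q keeps its factor for `lam`. If ν = q, column q either is
  -- the omitted one or is followed by a box of the first row; its factor is lost both ways, which
  -- leaves `branch₀`.
  branch₀-columns : ∀ {p lam μ} → IsPartition (p ∷ lam) → Strip (p ∷ lam) μ →
                    Prod.fold [1⋯ p ∸ 1 ] (column (p ∷ lam) μ) ≈ branch₀ (p ∷ lam) μ

  branch₀-columns {zero}  pl-part _ = contradiction (proj₁ (proj₂ (uncons pl-part))) λ ()
  branch₀-columns {suc p} {lam} {ν ∷ μ} pl-part s@(strip q≤ν ν≤p 0<ν s′)
    with uncons pl-part | part lam 0 ℕ.<? ν | ν ℕ.≟ part lam 0
  ... | _ | yes q<ν | yes ν≡q = contradiction (≡.sym ν≡q) (ℕₚ.<⇒≢ q<ν)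
  ... | _ | no q≮ν | no ν≢q = contradiction (ℕₚ.≤∧≢⇒< q≤ν (ν≢q ∘ ≡.sym)) q≮ν
  ... | q≤p , _ , lam-part | yes q<ν | no _ = begin
    Prod.fold [1⋯ p ] (column (suc p ∷ lam) (ν ∷ μ))
      ≈⟨ Prod.fold-[1⋯]-truncate (ℕₚ.≤-pred (ℕₚ.≤-trans q<ν ν≤p)) flat ⟩
    Prod.fold [1⋯ part lam 0 ] (column (suc p ∷ lam) (ν ∷ μ))
      ≈⟨ Prod.fold-[1⋯]-cong (part lam 0) (λ _ i≤q → column-same lam-part μ-part q≤p q≤ν μ≤q
           (ℕₚ.≤-trans (ℕ.s≤s i≤q) (ℕₚ.≤-trans q<ν ν≤p)) (ℕₚ.≤-trans (ℕ.s≤s i≤q) q<ν)) ⟩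
    Prod.fold [1⋯ part lam 0 ] (column lam μ)
      ≈⟨ branch-columns lam-part s′ ⟩
    branch lam μ
      ≈⟨ +-identityʳ _ ⟨
    branch lam μ + 0# ∎
    where
    μ-part = strip⇒partition s′
    μ≤q = strip-head s′
    flat : ∀ {i} → part lam 0 ℕ.< i → i ℕ.≤ p → column (suc p ∷ lam) (ν ∷ μ) i ≈ 1#
    flat {i} q<i i≤p with i ℕ.<? ν
    ... | yes i<ν = column-flat′ lam-part μ-part q≤p q≤ν μ≤q (ℕ.s≤s i≤p) i<ν q<i
    ... | no  i≮ν = column-flat lam-part μ-part q≤p q≤ν μ≤q (excess-≤1 pl-part s) (ℕ.s≤s i≤p) (ℕₚ.≮⇒≥ i≮ν)
  branch₀-columns {suc p} {[]}           _ (strip _ _ () _)   | _ | no _ | yes ≡.refl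
  branch₀-columns {suc p} {lam@(suc q ∷ _)} {_ ∷ μ} pl-part s@(strip q≤ν ν≤p _ s′)
    | q≤p , _ , lam-part | no _ | yes ≡.refl = begin
    Prod.fold [1⋯ p ] (column (suc p ∷ lam) (suc q ∷ μ))
      ≈⟨ Prod.fold-[1⋯]-truncate (ℕₚ.≤-pred q≤p) (λ q<i i≤p →
           column-flat lam-part μ-part q≤p q≤ν μ≤q (excess-≤1 pl-part s) (ℕ.s≤s i≤p) q<i) ⟩
    Prod.fold [1⋯ q ] (column (suc p ∷ lam) (suc q ∷ μ))
      ≈⟨ Prod.fold-[1⋯]-cong q (λ _ i≤q → column-same lam-part μ-part q≤p q≤ν μ≤q
           (ℕₚ.≤-trans (ℕ.s≤s i≤q) q≤p) (ℕ.s≤s i≤q)) ⟩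
    Prod.fold [1⋯ q ] (column lam μ)
      ≈⟨ branch₀-columns lam-part s′ ⟩
    branch₀ lam μ
      ≈⟨ +-identityˡ _ ⟨
    0# + branch₀ lam μ ∎
    where
    μ-part = strip⇒partition s′
    μ≤q = strip-head s′

  branch-columns {[]}          []-part [] = refl
  branch-columns {zero ∷ lam}  pl-part _  = contradiction (proj₁ (proj₂ (uncons pl-part))) λ ()
  branch-columns {suc p ∷ lam} {ν ∷ μ} pl-part s@(strip q≤ν ν≤p 0<ν s′) = begin
    Prod.fold [1⋯ suc p ] (column (suc p ∷ lam) (ν ∷ μ))
      ≈⟨ Prod.fold-[1⋯] p _ ⟩
    Prod.fold [1⋯ p ] (column (suc p ∷ lam) (ν ∷ μ)) * column (suc p ∷ lam) (ν ∷ μ) (suc p)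
      ≈⟨ *-congʳ (branch₀-columns pl-part s) ⟩
    branch₀ (suc p ∷ lam) (ν ∷ μ) * column (suc p ∷ lam) (ν ∷ μ) (suc p)
      ≈⟨ top ⟩
    branch (suc p ∷ lam) (ν ∷ μ) ∎
    where
    μ-part = strip⇒partition s′
    lam-part = proj₂ (proj₂ (uncons pl-part))
    q≤p = proj₁ (uncons pl-part)
    top : branch₀ (suc p ∷ lam) (ν ∷ μ) * column (suc p ∷ lam) (ν ∷ μ) (suc p) ≈ branch (suc p ∷ lam) (ν ∷ μ)
    top with ν ℕ.≟ suc p
    -- The second part is at most ν, which lies below the first part; so the first part occurs once,
    -- and its column, which has a box, gives 1 - t.
    ... | no ν≢p = begin
      branch₀ (suc p ∷ lam) (ν ∷ μ) * column (suc p ∷ lam) (ν ∷ μ) (suc p)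
        ≈⟨ *-congˡ (weight-cong
             (excess-1 lam-part μ-part q<p (ℕₚ.≤-<-trans (strip-head s′) q<p) ℕₚ.≤-refl ν<p)
             (excess-beyond {μ = ν ∷ μ} pl-part (ℕₚ.n<1+n (suc p)))
             (≡.trans (multiplicity-≡ (suc p) lam) (≡.cong suc (multiplicity-beyond lam-part q<p)))) ⟩
      branch₀ (suc p ∷ lam) (ν ∷ μ) * (1# - t * 1#)
        ≈⟨ solve 2 (λ β t → β :* (con (+ 1) :- t :* con (+ 1))
             := t :* con (+ 0) :+ (con (+ 1) :- t) :* β) refl _ t ⟩
      t * 0# + (1# - t) * branch₀ (suc p ∷ lam) (ν ∷ μ) ∎
      where
      ν<p = ℕₚ.≤∧≢⇒< ν≤p ν≢p
      q<p = ℕₚ.≤-<-trans q≤ν ν<p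
    ... | yes ≡.refl with part lam 0 ℕ.<? suc p | suc p ℕ.≟ part lam 0
    ...   | yes q<p | yes p≡q = contradiction (≡.sym p≡q) (ℕₚ.<⇒≢ q<p)
    ...   | no q≮p  | no p≢q  = contradiction (ℕₚ.≤∧≢⇒< q≤p (p≢q ∘ ≡.sym)) q≮p
    -- The first row is untouched and no lower row is as long, so its last column has no box and
    -- contributes 1 = t + (1 - t).
    ...   | yes q<p | no _    = begin
      (branch lam μ + 0#) * column (suc p ∷ lam) (suc p ∷ μ) (suc p)
        ≈⟨ *-congˡ (column-0 (suc p ∷ lam) (suc p ∷ μ) (suc p)
             (≡.trans (excess-same {i = suc p} lam μ ℕₚ.≤-refl ℕₚ.≤-refl) (excess-beyond {μ = μ} lam-part q<p))) ⟩
      (branch lam μ + 0#) * 1#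
        ≈⟨ solve 2 (λ β t → (β :+ con (+ 0)) :* con (+ 1)
             := t :* β :+ (con (+ 1) :- t) :* (β :+ con (+ 0))) refl _ t ⟩
      t * branch lam μ + (1# - t) * (branch lam μ + 0#) ∎
    -- The first row extends a block of equal parts: the lower rows decide whether the last column
    -- has a box, and only the multiplicity grows by one.
    ...   | no _ | yes p≡q = begin
      (0# + branch₀ lam μ) * column (suc p ∷ lam) (suc p ∷ μ) (suc p)
        ≈⟨ *-congˡ (weight-cong (excess-same lam μ ℕₚ.≤-refl ℕₚ.≤-refl)
             (excess-beyond {μ = suc p ∷ μ} pl-part (ℕₚ.n<1+n (suc p))) (multiplicity-≡ (suc p) lam)) ⟩
      (0# + branch₀ lam μ) * weight d 0 (suc m)
        ≈⟨ lengthen ⟩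
      t * (branch₀ lam μ * weight d 0 m) + (1# - t) * (0# + branch₀ lam μ)
        ≈⟨ +-congʳ (*-congˡ (previous lam lam-part s′ p≡q)) ⟨
      t * branch lam μ + (1# - t) * (0# + branch₀ lam μ) ∎
      where
      d = excess lam μ (suc p)
      m = multiplicity lam (suc p)
      -- Because 1 - t^(m+1) = t (1 - t^m) + (1 - t), or 1 = t + (1 - t) if the column has no box.
      lengthen : (0# + branch₀ lam μ) * weight d 0 (suc m)
               ≈ t * (branch₀ lam μ * weight d 0 m) + (1# - t) * (0# + branch₀ lam μ)
      lengthen with 0 ℕ.<? d
      ... | yes _ = solve 3 (λ β t c → (con (+ 0) :+ β) :* (con (+ 1) :- t :* c)
            := t :* (β :* (con (+ 1) :- c)) :+ (con (+ 1) :- t) :* (con (+ 0) :+ β)) refl _ t (t ^ m)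
      ... | no _  = solve 2 (λ β t → (con (+ 0) :+ β) :* con (+ 1)
            := t :* (β :* con (+ 1)) :+ (con (+ 1) :- t) :* (con (+ 0) :+ β)) refl _ t
      previous : ∀ lam {μ} → IsPartition lam → Strip lam μ → suc p ≡ part lam 0 →
                 branch lam μ ≈ branch₀ lam μ * weight (excess lam μ (suc p)) 0 (multiplicity lam (suc p))
      previous (suc p ∷ lam) {μ} lam-part s ≡.refl = begin
        branch (suc p ∷ lam) μ
          ≈⟨ branch-columns lam-part s ⟨
        Prod.fold [1⋯ suc p ] (column (suc p ∷ lam) μ)
          ≈⟨ Prod.fold-[1⋯] p _ ⟩
        Prod.fold [1⋯ p ] (column (suc p ∷ lam) μ) * column (suc p ∷ lam) μ (suc p)
          ≈⟨ *-cong (branch₀-columns lam-part s)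
               (weight-cong (≡.refl {x = excess (suc p ∷ lam) μ (suc p)})
                            (excess-beyond {μ = μ} lam-part (ℕₚ.n<1+n (suc p)))
                            (≡.refl {x = multiplicity (suc p ∷ lam) (suc p)})) ⟩
        branch₀ (suc p ∷ lam) μ
          * weight (excess (suc p ∷ lam) μ (suc p)) 0 (multiplicity (suc p ∷ lam) (suc p)) ∎

  strip-refl : ∀ {lam} → IsPartition lam → Strip lam lam
  strip-refl {[]}      lam-part = []
  strip-refl {p ∷ lam} lam-part with uncons lam-part
  ... | q≤p , 0<p , lam-part′ = strip q≤p ℕₚ.≤-refl 0<p (strip-refl lam-part′)

  branch-refl : ∀ {lam} → IsPartition lam → branch lam lam ≈ 1#
  branch-refl {lam} lam-part = begin
    branch lam lam
      ≈⟨ branch-columns lam-part (strip-refl lam-part) ⟨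
    Prod.fold [1⋯ part lam 0 ] (column lam lam)
      ≈⟨ Prod.fold-ε [1⋯ part lam 0 ] (λ {i} _ → column-0 lam lam i (ℕₚ.n∸n≡0 (conjugate lam i))) ⟩
    1# ∎

  φ-branch : ∀ {lam μ} → IsPartition lam → Strip lam μ → φ lam μ ≈ branch lam μ
  φ-branch {lam} {μ} lam-part s = trans (φ-columns lam μ (strip⇒interlacing s)) (branch-columns lam-part s)

  -- The list `listsBelow lam` also has members that are not partitions or do not interlace with
  -- `lam`; the recursion must vanish there for sums to run over a product of ranges. A last part 0
  -- is excluded because `branch₀ [] []` is 0.
  branch-0 : ∀ lam μ → IsPartition lam → μ ∈ listsBelow lam → ¬ Strip lam μ →
             branch lam μ ≈ 0# × branch₀ lam μ ≈ 0#
  branch-0 []        []      _        _  ¬s = contradiction [] ¬s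
  branch-0 []        (_ ∷ _) _        _  ¬s = refl , refl
  branch-0 (p ∷ lam) μ₊      lam-part μ∈ ¬s with below-uncons {p} {lam} μ∈
  ... | ν , μ , ≡.refl , ν≤p , μ∈′ =
    trans (+-cong (trans (*-congˡ top-0) (zeroʳ t)) (trans (*-congˡ branch₀-0) (zeroʳ _))) (+-identityˡ 0#)
    , branch₀-0
    where
    q≤p = proj₁ (uncons lam-part)
    0<p = proj₁ (proj₂ (uncons lam-part))
    lam-part′ = proj₂ (proj₂ (uncons lam-part))
    top-0 : keep (ν ℕ.≟ p) (branch lam μ) ≈ 0#
    top-0 with strip? lam μ
    ... | no ¬s′ = keep-0 (ν ℕ.≟ p) (proj₁ (branch-0 lam μ lam-part′ μ∈′ ¬s′))
    ... | yes s  = Sum.keep-no (ν ℕ.≟ p) λ { ≡.refl → ¬s (strip q≤p ℕₚ.≤-refl 0<p s) }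
    first : keep (part lam 0 ℕ.<? ν) (branch lam μ) ≈ 0#
    first with strip? lam μ
    ... | no ¬s′ = keep-0 (part lam 0 ℕ.<? ν) (proj₁ (branch-0 lam μ lam-part′ μ∈′ ¬s′))
    ... | yes s  = Sum.keep-no (part lam 0 ℕ.<? ν) λ q<ν →
                     ¬s (strip (ℕₚ.<⇒≤ q<ν) ν≤p (ℕₚ.≤-<-trans ℕ.z≤n q<ν) s)
    second : ∀ lam μ → IsPartition lam → ν ℕ.≤ p → μ ∈ listsBelow lam → ¬ Strip (p ∷ lam) (ν ∷ μ) →
             keep (ν ℕ.≟ part lam 0) (branch₀ lam μ) ≈ 0#
    second []        μ         _        _   _   _  = keep-0 (ν ℕ.≟ 0) refl
    second (q ∷ lam) μ         lam-part ν≤p μ∈ ¬s with strip? (q ∷ lam) μ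
    ... | no ¬s′ = keep-0 (ν ℕ.≟ q) (proj₂ (branch-0 (q ∷ lam) μ lam-part μ∈ ¬s′))
    ... | yes s  = Sum.keep-no (ν ℕ.≟ q) λ { ≡.refl →
                     ¬s (strip ℕₚ.≤-refl ν≤p (proj₁ (proj₂ (uncons lam-part))) s) }
    branch₀-0 : branch₀ (p ∷ lam) (ν ∷ μ) ≈ 0#
    branch₀-0 = trans (+-cong first (second lam μ lam-part′ ν≤p μ∈′ ¬s)) (+-identityˡ 0#)

  -- The separate term is the missing μ = λ, where `branch` is 1, and the filter in `innerIndices`
  -- can go because `branch` vanishes off the strips.
  inner-sum : ∀ {lam} → IsPartition lam → ∀ f →
    f lam + (∑[ μ ∈ innerIndices lam ] f μ * φ lam μ) ≈ (∑[ μ ∈ listsBelow lam ] branch lam μ * f μ)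
  inner-sum {lam} lam-part f = begin
    f lam + Sum.fold (innerIndices lam) (λ μ → f μ * φ lam μ)
      ≈⟨ +-cong (sym (Sum.fold-single equal? f (below-unique lam) (below-refl lam) ≡.refl id))
                (Sum.fold-filter inner? (listsBelow lam) _) ⟩
    Sum.fold (listsBelow lam) (λ μ → keep (equal? μ) (f μ))
      + Sum.fold (listsBelow lam) (λ μ → keep (inner? μ) (f μ * φ lam μ))
      ≈⟨ Sum.fold-∙ (listsBelow lam) _ _ ⟨
    Sum.fold (listsBelow lam) (λ μ → keep (equal? μ) (f μ) + keep (inner? μ) (f μ * φ lam μ))
      ≈⟨ Sum.fold-cong (listsBelow lam) termwise ⟩
    Sum.fold (listsBelow lam) (λ μ → branch lam μ * f μ) ∎
    where
    equal? : ∀ μ → Dec (μ ≡ lam)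
    equal? μ = Listₚ.≡-dec ℕ._≟_ μ lam
    inner? : ∀ μ → Dec (IsPartition μ × μ ≢ lam)
    inner? μ = isPartition? μ ×-dec ¬? (equal? μ)
    φ-match : ∀ {μ} → μ ∈ listsBelow lam → IsPartition μ → φ lam μ ≈ branch lam μ
    φ-match {μ} μ∈ μ-part with strip? lam μ
    ... | yes s = φ-branch lam-part s
    ... | no ¬s = trans (φ-0 lam μ λ I → ¬s (interlacing⇒strip (below-length lam μ∈) μ-part I))
                        (sym (proj₁ (branch-0 lam μ lam-part μ∈ ¬s)))
    termwise : ∀ {μ} → μ ∈ listsBelow lam →
               keep (equal? μ) (f μ) + keep (inner? μ) (f μ * φ lam μ) ≈ branch lam μ * f μ
    termwise {μ} μ∈ with equal? μ | isPartition? μ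
    ... | yes ≡.refl | yes _      = trans (+-identityʳ _)
                                      (sym (trans (*-congʳ (branch-refl lam-part)) (*-identityˡ _)))
    ... | yes ≡.refl | no ¬part   = contradiction lam-part ¬part
    ... | no _       | yes μ-part = trans (+-identityˡ _)
                                      (trans (*-comm _ _) (*-congʳ (φ-match μ∈ μ-part)))
    ... | no _       | no ¬part   = trans (+-identityˡ _) (sym (trans
                                      (*-congʳ (proj₁ (branch-0 lam μ lam-part μ∈ (¬part ∘ strip⇒partition))))
                                      (zeroˡ _)))

  -- U and T as sums over horizontal strips

  module _ (z : Carrier) where
    steps-sum : ∀ p q y →
      Sum.fold (upTo (suc p)) (λ ν → keep (q ℕ.<? ν) (z ^ (p ∸ ν) * y ^ ν)) ≈ steps p q z y
    steps-sum zero    q y = +-identityʳ 0#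
    steps-sum (suc p) q y with q ℕ.≤? p
    ... | yes q≤p = begin
      Sum.fold (upTo (suc (suc p))) (λ ν → keep (q ℕ.<? ν) (z ^ (suc p ∸ ν) * y ^ ν))
        ≈⟨ Sum.fold-upTo (suc p) _ ⟩
      Sum.fold (upTo (suc p)) (λ ν → keep (q ℕ.<? ν) (z ^ (suc p ∸ ν) * y ^ ν))
        + keep (q ℕ.<? suc p) (z ^ (p ∸ p) * y ^ suc p)
        ≈⟨ +-cong (trans (Sum.fold-cong (upTo (suc p)) shift) (sum-* (upTo (suc p)) z _))
                  (Sum.keep-yes (q ℕ.<? suc p) (ℕ.s≤s q≤p)) ⟩
      z * Sum.fold (upTo (suc p)) (λ ν → keep (q ℕ.<? ν) (z ^ (p ∸ ν) * y ^ ν)) + z ^ (p ∸ p) * y ^ suc p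
        ≈⟨ +-cong (*-congˡ (steps-sum p q y))
             (trans (*-congʳ (reflexive (≡.cong (z ^_) (ℕₚ.n∸n≡0 p)))) (*-identityˡ _)) ⟩
      z * steps p q z y + y ^ suc p ∎
      where
      shift : ∀ {ν} → ν ∈ upTo (suc p) → keep (q ℕ.<? ν) (z ^ (suc p ∸ ν) * y ^ ν)
                                       ≈ z * keep (q ℕ.<? ν) (z ^ (p ∸ ν) * y ^ ν)
      shift {ν} ν∈ with q ℕ.<? ν
      ... | yes _ rewrite ℕₚ.+-∸-assoc 1 (ℕₚ.≤-pred (∈-upTo⁻ ν∈)) = *-assoc z _ _
      ... | no _  = sym (zeroʳ z)
    ... | no q≰p = Sum.fold-ε (upTo (suc (suc p))) λ {ν} ν∈ →
                     Sum.keep-no (q ℕ.<? ν) λ q<ν → q≰p (ℕₚ.≤-pred (ℕₚ.<-≤-trans q<ν (ℕₚ.≤-pred (∈-upTo⁻ ν∈))))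

    term : List ℕ → List ℕ → ∀ {n} → Vec Carrier n → Carrier
    term lam μ ys = z ^ weightDifference lam μ * monomial (part μ) ys

    -- A zero part cannot shrink, so it contributes just the weight t of an untouched row. This is
    -- the source of the power of t in `branch-sum`.
    U-[] : ∀ {n} (ys : Vec Carrier n) → U (part []) z ys ≈ t ^ n × T (part []) z ys ≈ 0#
    U-[] []       = refl , refl
    U-[] (y ∷ ys) = trans (+-cong (*-congˡ (trans (*-identityˡ _) (proj₁ (U-[] ys))))
                                  (trans (*-congˡ T-0) (zeroʳ _))) (+-identityʳ _)
                  , T-0
      where
      T-0 : T (part []) z (y ∷ ys) ≈ 0#
      T-0 = trans (+-cong (zeroˡ _) (trans (*-congˡ (proj₂ (U-[] ys))) (zeroʳ _))) (+-identityˡ 0#)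

    monomial-[] : ∀ {n} (ys : Vec Carrier n) → monomial (part []) ys ≈ 1#
    monomial-[] []       = refl
    monomial-[] (y ∷ ys) = trans (*-identityˡ _) (monomial-[] ys)

    -- Apart from the factor z^(p - ν) y^ν, the first part ν of μ enters only through the conditions
    -- ν > q, ν = q and ν = p. Summed over ν they give `steps`, the second term of `T` and the first
    -- term of `U`; m counts the padding zeros.
    branch-sum : ∀ lam → IsPartition lam → ∀ {m} (ys : Vec Carrier (length lam ℕ.+ m)) →
      U (part lam) z ys ≈ t ^ m * (∑[ μ ∈ listsBelow lam ] branch lam μ * term lam μ ys)
      × T (part lam) z ys ≈ t ^ m * (∑[ μ ∈ listsBelow lam ] branch₀ lam μ * term lam μ ys)
    branch-sum [] lam-part {m} ys =
      trans (proj₁ (U-[] ys)) (sym (trans (*-congˡ (trans (+-identityʳ _) (trans (*-identityˡ _)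
        (trans (*-identityˡ _) (monomial-[] ys))))) (*-identityʳ _)))
      , trans (proj₂ (U-[] ys)) (sym (trans (*-congˡ (trans (+-identityʳ _) (zeroˡ _))) (zeroʳ _)))
    branch-sum (p ∷ lam) lam-part {m} (y ∷ ys) with uncons lam-part
    ... | q≤p , _ , lam-part′ = full , open-top
      where
      q = part lam 0
      A B : Carrier
      A = Sum.fold (listsBelow lam) (λ μ → branch lam μ * term lam μ ys)
      B = Sum.fold (listsBelow lam) (λ μ → branch₀ lam μ * term lam μ ys)
      c : ℕ → Carrier
      c ν = z ^ (p ∸ ν) * y ^ ν

      rows : ∀ (g h : ℕ → Carrier) (β : ℕ → List ℕ → Carrier) →
        (∀ ν μ → β ν μ * term (p ∷ lam) (ν ∷ μ) (y ∷ ys)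
               ≈ g ν * (branch lam μ * term lam μ ys) + h ν * (branch₀ lam μ * term lam μ ys)) →
        Sum.fold (upTo (suc p)) (λ ν → Sum.fold (listsBelow lam) (λ μ →
          β ν μ * term (p ∷ lam) (ν ∷ μ) (y ∷ ys)))
        ≈ Sum.fold (upTo (suc p)) g * A + Sum.fold (upTo (suc p)) h * B
      rows g h β e = begin
        Sum.fold (upTo (suc p)) (λ ν → Sum.fold (listsBelow lam) (λ μ → β ν μ * term (p ∷ lam) (ν ∷ μ) (y ∷ ys)))
          ≈⟨ Sum.fold-cong (upTo (suc p)) (λ {ν} _ → trans (Sum.fold-cong (listsBelow lam) (λ {μ} _ → e ν μ))
               (trans (Sum.fold-∙ (listsBelow lam) _ _) (+-cong (sum-* (listsBelow lam) (g ν) _)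
                                                               (sum-* (listsBelow lam) (h ν) _)))) ⟩
        Sum.fold (upTo (suc p)) (λ ν → g ν * A + h ν * B)
          ≈⟨ Sum.fold-∙ (upTo (suc p)) _ _ ⟩
        Sum.fold (upTo (suc p)) (λ ν → g ν * A) + Sum.fold (upTo (suc p)) (λ ν → h ν * B)
          ≈⟨ +-cong (scaleʳ g A) (scaleʳ h B) ⟩
        Sum.fold (upTo (suc p)) g * A + Sum.fold (upTo (suc p)) h * B ∎
        where
        scaleʳ : ∀ g x → Sum.fold (upTo (suc p)) (λ ν → g ν * x) ≈ Sum.fold (upTo (suc p)) g * x
        scaleʳ g x = trans (Sum.fold-cong (upTo (suc p)) (λ {ν} _ → *-comm (g ν) x))
                           (trans (sum-* (upTo (suc p)) x g) (*-comm x _))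

      term-∷ : ∀ ν μ → term (p ∷ lam) (ν ∷ μ) (y ∷ ys) ≈ c ν * term lam μ ys
      term-∷ ν μ = trans (*-congʳ (^-homo-* z (p ∸ ν) (weightDifference lam μ)))
        (solve 4 (λ a b c d → a :* b :* (c :* d) := a :* c :* (b :* d)) refl (z ^ (p ∸ ν)) _ (y ^ ν) _)

      B-sum : Sum.fold (listsBelow (p ∷ lam)) (λ μ → branch₀ (p ∷ lam) μ * term (p ∷ lam) μ (y ∷ ys))
            ≈ steps p q z y * A + c q * B
      B-sum = begin
        Sum.fold (listsBelow (p ∷ lam)) (λ μ → branch₀ (p ∷ lam) μ * term (p ∷ lam) μ (y ∷ ys))
          ≈⟨ Sum.fold-cartesian _∷_ (upTo (suc p)) (listsBelow lam) _ ⟩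
        Sum.fold (upTo (suc p)) (λ ν → Sum.fold (listsBelow lam) (λ μ →
          branch₀ (p ∷ lam) (ν ∷ μ) * term (p ∷ lam) (ν ∷ μ) (y ∷ ys)))
          ≈⟨ rows (λ ν → keep (q ℕ.<? ν) (c ν)) (λ ν → keep (ν ℕ.≟ q) (c ν)) (λ ν μ → branch₀ (p ∷ lam) (ν ∷ μ)) split ⟩
        Sum.fold (upTo (suc p)) (λ ν → keep (q ℕ.<? ν) (c ν)) * A
          + Sum.fold (upTo (suc p)) (λ ν → keep (ν ℕ.≟ q) (c ν)) * B
          ≈⟨ +-cong (*-congʳ (steps-sum p q y))
               (*-congʳ (Sum.fold-single (ℕ._≟ q) c (Uniqueₚ.upTo⁺ (suc p)) (∈-upTo⁺ (ℕ.s≤s q≤p)) ≡.refl id)) ⟩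
        steps p q z y * A + c q * B ∎
        where
        split : ∀ ν μ → branch₀ (p ∷ lam) (ν ∷ μ) * term (p ∷ lam) (ν ∷ μ) (y ∷ ys)
              ≈ keep (q ℕ.<? ν) (c ν) * (branch lam μ * term lam μ ys)
              + keep (ν ℕ.≟ q) (c ν) * (branch₀ lam μ * term lam μ ys)
        split ν μ = trans (*-congˡ (term-∷ ν μ)) (trans (distribʳ _ _ _)
          (+-cong (move (q ℕ.<? ν)) (move (ν ℕ.≟ q))))
          where
          move : ∀ {P : Set} (P? : Dec P) {b} → keep P? b * (c ν * term lam μ ys)
                                              ≈ keep P? (c ν) * (b * term lam μ ys)
          move (yes _) {b} = solve 3 (λ b c d → b :* (c :* d) := c :* (b :* d)) refl b (c ν) _
          move (no _)  {b} = trans (zeroˡ _) (sym (zeroˡ _))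

      open-top : T (part (p ∷ lam)) z (y ∷ ys)
               ≈ t ^ m * Sum.fold (listsBelow (p ∷ lam)) (λ μ → branch₀ (p ∷ lam) μ * term (p ∷ lam) μ (y ∷ ys))
      open-top = begin
        steps p q z y * U (part lam) z ys + y ^ q * z ^ (p ∸ q) * T (part lam) z ys
          ≈⟨ +-cong (*-congˡ (proj₁ (branch-sum lam lam-part′ ys)))
                    (*-congˡ (proj₂ (branch-sum lam lam-part′ ys))) ⟩
        steps p q z y * (t ^ m * A) + y ^ q * z ^ (p ∸ q) * (t ^ m * B)
          ≈⟨ solve 6 (λ s τ A Y Z B → s :* (τ :* A) :+ Y :* Z :* (τ :* B)
               := τ :* (s :* A :+ Z :* Y :* B)) refl _ (t ^ m) A (y ^ q) (z ^ (p ∸ q)) B ⟩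
        t ^ m * (steps p q z y * A + c q * B)
          ≈⟨ *-congˡ B-sum ⟨
        t ^ m * Sum.fold (listsBelow (p ∷ lam)) (λ μ → branch₀ (p ∷ lam) μ * term (p ∷ lam) μ (y ∷ ys)) ∎

      A-sum : Sum.fold (listsBelow (p ∷ lam)) (λ μ → branch (p ∷ lam) μ * term (p ∷ lam) μ (y ∷ ys))
            ≈ t * (y ^ p * A)
            + (1# - t) * Sum.fold (listsBelow (p ∷ lam)) (λ μ → branch₀ (p ∷ lam) μ * term (p ∷ lam) μ (y ∷ ys))
      A-sum = begin
        Sum.fold (listsBelow (p ∷ lam)) (λ μ → branch (p ∷ lam) μ * term (p ∷ lam) μ (y ∷ ys))
          ≈⟨ Sum.fold-cartesian _∷_ (upTo (suc p)) (listsBelow lam) _ ⟩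
        Sum.fold (upTo (suc p)) (λ ν → Sum.fold (listsBelow lam) (λ μ →
          branch (p ∷ lam) (ν ∷ μ) * term (p ∷ lam) (ν ∷ μ) (y ∷ ys)))
          ≈⟨ Sum.fold-cong (upTo (suc p)) (λ {ν} _ → trans (Sum.fold-cong (listsBelow lam) (λ {μ} _ → split ν μ))
               (trans (Sum.fold-∙ (listsBelow lam) _ _)
                      (+-cong (sum-* (listsBelow lam) t _) (sum-* (listsBelow lam) (1# - t) _)))) ⟩
        Sum.fold (upTo (suc p)) (λ ν → t * top ν + (1# - t) * bottom ν)
          ≈⟨ trans (Sum.fold-∙ (upTo (suc p)) _ _)
                   (+-cong (sum-* (upTo (suc p)) t top) (sum-* (upTo (suc p)) (1# - t) bottom)) ⟩
        t * Sum.fold (upTo (suc p)) top + (1# - t) * Sum.fold (upTo (suc p)) bottom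
          ≈⟨ +-cong (*-congˡ top-sum)
                    (*-congˡ (sym (Sum.fold-cartesian _∷_ (upTo (suc p)) (listsBelow lam) _))) ⟩
        t * (y ^ p * A)
          + (1# - t) * Sum.fold (listsBelow (p ∷ lam)) (λ μ → branch₀ (p ∷ lam) μ * term (p ∷ lam) μ (y ∷ ys)) ∎
        where
        top bottom : ℕ → Carrier
        top ν = Sum.fold (listsBelow lam) (λ μ → keep (ν ℕ.≟ p) (branch lam μ) * term (p ∷ lam) (ν ∷ μ) (y ∷ ys))
        bottom ν = Sum.fold (listsBelow lam) (λ μ → branch₀ (p ∷ lam) (ν ∷ μ) * term (p ∷ lam) (ν ∷ μ) (y ∷ ys))
        split : ∀ ν μ → branch (p ∷ lam) (ν ∷ μ) * term (p ∷ lam) (ν ∷ μ) (y ∷ ys)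
              ≈ t * (keep (ν ℕ.≟ p) (branch lam μ) * term (p ∷ lam) (ν ∷ μ) (y ∷ ys))
              + (1# - t) * (branch₀ (p ∷ lam) (ν ∷ μ) * term (p ∷ lam) (ν ∷ μ) (y ∷ ys))
        split ν μ = trans (distribʳ _ _ _) (+-cong (*-assoc _ _ _) (*-assoc _ _ _))
        top-sum : Sum.fold (upTo (suc p)) top ≈ y ^ p * A
        top-sum = begin
          Sum.fold (upTo (suc p)) top
            ≈⟨ Sum.fold-cong (upTo (suc p)) (λ {ν} _ → pull ν) ⟩
          Sum.fold (upTo (suc p)) (λ ν → keep (ν ℕ.≟ p) (c ν * A))
            ≈⟨ Sum.fold-single (ℕ._≟ p) (λ ν → c ν * A) (Uniqueₚ.upTo⁺ (suc p)) (∈-upTo⁺ (ℕₚ.n<1+n p)) ≡.refl id ⟩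
          z ^ (p ∸ p) * y ^ p * A
            ≈⟨ *-congʳ (trans (*-congʳ (reflexive (≡.cong (z ^_) (ℕₚ.n∸n≡0 p)))) (*-identityˡ _)) ⟩
          y ^ p * A ∎
          where
          pull : ∀ ν → top ν ≈ keep (ν ℕ.≟ p) (c ν * A)
          pull ν with ν ℕ.≟ p
          ... | yes _ = trans (Sum.fold-cong (listsBelow lam) (λ {μ} _ → trans (*-congˡ (term-∷ ν μ))
                  (solve 3 (λ b c d → b :* (c :* d) := c :* (b :* d)) refl (branch lam μ) (c ν) _)))
                  (sum-* (listsBelow lam) (c ν) _)
          ... | no _  = Sum.fold-ε (listsBelow lam) (λ _ → zeroˡ _)

      full : U (part (p ∷ lam)) z (y ∷ ys)
           ≈ t ^ m * Sum.fold (listsBelow (p ∷ lam)) (λ μ → branch (p ∷ lam) μ * term (p ∷ lam) μ (y ∷ ys))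
      full = begin
        t * (y ^ p * U (part lam) z ys) + (1# - t) * T (part (p ∷ lam)) z (y ∷ ys)
          ≈⟨ +-cong (*-congˡ (*-congˡ (proj₁ (branch-sum lam lam-part′ ys)))) (*-congˡ open-top) ⟩
        t * (y ^ p * (t ^ m * A)) + (1# - t) * (t ^ m * β)
          ≈⟨ solve 5 (λ t Y τ A β → t :* (Y :* (τ :* A)) :+ (con (+ 1) :- t) :* (τ :* β)
               := τ :* (t :* (Y :* A) :+ (con (+ 1) :- t) :* β)) refl t (y ^ p) (t ^ m) A β ⟩
        t ^ m * (t * (y ^ p * A) + (1# - t) * β)
          ≈⟨ *-congˡ A-sum ⟨
        t ^ m * Sum.fold (listsBelow (p ∷ lam)) (λ μ → branch (p ∷ lam) μ * term (p ∷ lam) μ (y ∷ ys)) ∎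
        where
        β = Sum.fold (listsBelow (p ∷ lam)) (λ μ → branch₀ (p ∷ lam) μ * term (p ∷ lam) μ (y ∷ ys))

  -- Permutations, ordered pairs and Vandermonde products

  selectSum-tabulate : ∀ {n} (x : Vector Carrier (suc n)) f →
    selectSum (tabulate x) f ≈ (∑[ i ∈ allFin (suc n) ] f (x i) (tabulate (removeAt x i)))
  selectSum-tabulate {zero}  x f = sym (+-identityʳ _)
  selectSum-tabulate {suc n} x f = trans (+-congˡ (selectSum-tabulate (x ∘ Fin.suc) _))
    (sym (Sum.fold-allFin (suc n) (λ i → f (x i) (tabulate (removeAt x i)))))

  orderSum-permutations : ∀ {n} (x : Vector Carrier n) F →
    orderSum (tabulate x) F ≈ (∑[ π ∈ permutations n ] F (tabulate (x ∘ (π ⟨$⟩ʳ_))))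
  orderSum-permutations {zero}  x F = sym (+-identityʳ _)
  orderSum-permutations {suc n} x F = begin
    selectSum (tabulate x) (λ y r → orderSum r (λ ys → F (y ∷ ys)))
      ≈⟨ selectSum-tabulate x _ ⟩
    Sum.fold (allFin (suc n)) (λ i → orderSum (tabulate (removeAt x i)) (λ ys → F (x i ∷ ys)))
      ≈⟨ Sum.fold-cong (allFin (suc n)) (λ {i} _ → trans (orderSum-permutations (removeAt x i) (λ ys → F (x i ∷ ys)))
           (Sum.fold-cong (permutations n) (λ {π} _ → reflexive (≡.cong F (≡.sym (tabulate-insert x i π)))))) ⟩
    Sum.fold (allFin (suc n)) (λ i → Sum.fold (permutations n) (λ π →
      F (tabulate (x ∘ (Perm.insert Fin.zero i π ⟨$⟩ʳ_)))))
      ≈⟨ Sum.fold-cartesian (Perm.insert Fin.zero) (allFin (suc n)) (permutations n) _ ⟨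
    Sum.fold (permutations (suc n)) (λ π → F (tabulate (x ∘ (π ⟨$⟩ʳ_)))) ∎

  monomial-tabulate : ∀ {n} a (y : Vector Carrier n) →
    (∏[ i ∈ allFin n ] (y i ^ a (toℕ i))) ≈ monomial a (tabulate y)
  monomial-tabulate {zero}  a y = refl
  monomial-tabulate {suc n} a y = trans (Prod.fold-allFin n (λ i → y i ^ a (toℕ i)))
    (*-congˡ (monomial-tabulate (a ∘ suc) (y ∘ Fin.suc)))

  Π-tabulate : ∀ {n} h (y : Vector Carrier n) → Prod.fold (allFin n) (h ∘ y) ≈ Π h (tabulate y)
  Π-tabulate {zero}  h y = refl
  Π-tabulate {suc n} h y =
    trans (Prod.fold-allFin n (h ∘ y)) (*-congˡ (Π-tabulate h (y ∘ Fin.suc)))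

  Pairs-orderedPairs : ∀ {n} g (y : Vector Carrier n) →
    (∏[ (i , j) ∈ orderedPairs n ] g (y i) (y j)) ≈ Pairs g (tabulate y)
  Pairs-orderedPairs {n} g y = trans (Prod.fold-filter (λ (i , j) → i Finₚ.<? j)
      (List.cartesianProduct (allFin n) (allFin n)) (λ (i , j) → g (y i) (y j)))
    (trans (Prod.fold-cartesian _,_ (allFin n) (allFin n) _) (square y))
    where
    square : ∀ {n} (y : Vector Carrier n) →
      Prod.fold (allFin n) (λ i → Prod.fold (allFin n) (λ j → Prod.keep (i Finₚ.<? j) (g (y i) (y j))))
        ≈ Pairs g (tabulate y)
    square {zero}  y = refl
    square {suc n} y = trans (Prod.fold-allFin n _) (*-cong
      (trans (Prod.fold-allFin n _) (trans (*-identityˡ _) (Π-tabulate (g (y Fin.zero)) (y ∘ Fin.suc))))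
      (trans (Prod.fold-cong (allFin n) (λ {i} _ → trans (Prod.fold-allFin n _)
               (trans (*-identityˡ _) (Prod.fold-cong (allFin n) (λ {j} _ →
                 Prod.keep-cong (Fin.suc i Finₚ.<? Fin.suc j) (i Finₚ.<? j) ℕₚ.≤-pred ℕ.s≤s)))))
             (square (y ∘ Fin.suc))))

  -- Bringing x_i to the front reverses the factors x_a - x_i with a < i; counted from 0, there are
  -- i of them.
  Δ-expand : ∀ {n} (x : Vector Carrier (suc n)) i →
    Pairs _-_ (tabulate x) ≈ (- 1#) ^ toℕ i *
      (Pairs _-_ (tabulate (removeAt x i)) * Π (λ w → x i - w) (tabulate (removeAt x i)))
  Δ-expand {n}     x Fin.zero    = trans (*-comm _ _) (sym (*-identityˡ _))
  Δ-expand {suc n} x (Fin.suc i) = begin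
    Π (λ w → x₀ - w) (tabulate x′) * Pairs _-_ (tabulate x′)
      ≈⟨ *-cong (sym (Π-select (λ w → x₀ - w) (tabulate-selects x′ i))) (Δ-expand x′ i) ⟩
    (x₀ - x′ i) * Π (λ w → x₀ - w) r * (s * (Pairs _-_ r * Π (λ w → x′ i - w) r))
      ≈⟨ solve 6 (λ a b A s D B → (a :- b) :* A :* (s :* (D :* B))
           := (:- con (+ 1)) :* s :* (A :* D :* ((b :- a) :* B)))
           refl x₀ (x′ i) (Π (λ w → x₀ - w) r) s (Pairs _-_ r) (Π (λ w → x′ i - w) r) ⟩
    - 1# * s * (Π (λ w → x₀ - w) r * Pairs _-_ r * ((x′ i - x₀) * Π (λ w → x′ i - w) r)) ∎
    where
    x₀ = x Fin.zero
    x′ = x ∘ Fin.suc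
    r = tabulate (removeAt x′ i)
    s = (- 1#) ^ toℕ i

  Δ-lagrange : ∀ {n} (x : Vector Carrier (suc n)) → AllPairs Generic (tabulate x) → ∀ i →
    (- 1#) ^ toℕ i * x i ^ n * Δ (removeAt x i) ≈ Δ x * lagrange n (x i) (tabulate (removeAt x i))
  Δ-lagrange {n} x x-gen i = begin
    s * c * Δ (removeAt x i)
      ≈⟨ *-congˡ (Pairs-orderedPairs _-_ (removeAt x i)) ⟩
    s * c * Pairs _-_ r
      ≈⟨ *-identityʳ _ ⟨
    s * c * Pairs _-_ r * 1#
      ≈⟨ *-congˡ (trans (sym (Π-* _ _ r)) (Π-1 (generic-head (tabulate-selects x i) x-gen))) ⟨
    s * c * Pairs _-_ r * (Π (λ w → x i - w) r * Π (λ w → (x i - w) ⁻¹) r)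
      ≈⟨ solve 5 (λ s c D A B → s :* c :* D :* (A :* B) := s :* (D :* A) :* (c :* B)) refl s c _ _ _ ⟩
    s * (Pairs _-_ r * Π (λ w → x i - w) r) * (c * Π (λ w → (x i - w) ⁻¹) r)
      ≈⟨ *-congʳ (trans (Pairs-orderedPairs _-_ x) (Δ-expand x i)) ⟨
    Δ x * (c * Π (λ w → (x i - w) ⁻¹) r) ∎
    where
    s = (- 1#) ^ toℕ i
    c = x i ^ n
    r = tabulate (removeAt x i)
    Π-1 : ∀ {k} {r : Vec Carrier k} → Allᵥ (Generic (x i)) r → Π (λ w → (x i - w) * (x i - w) ⁻¹) r ≈ 1#
    Π-1 []               = refl
    Π-1 ((p , _) ∷ ps) = trans (*-cong (inverseʳ _ p) (Π-1 ps)) (*-identityˡ 1#)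

  Π-orders : ∀ h {n} {xs ys : Vec Carrier n} → Orders xs ys → Π h xs ≈ Π h ys
  Π-orders h []      = refl
  Π-orders h (s ∷ o) = trans (sym (Π-select h s)) (*-congˡ (Π-orders h o))

  orderSum-sum : ∀ {A : Set} (as : List A) {n} (xs : Vec Carrier n) (G : A → Vec Carrier n → Carrier) →
    orderSum xs (λ ys → Sum.fold as (λ a → G a ys)) ≈ Sum.fold as (λ a → orderSum xs (G a))
  orderSum-sum []       xs G = orderSum-0 xs (λ _ → refl)
  orderSum-sum (a ∷ as) xs G = trans (orderSum-+ xs (G a) _) (+-congˡ (orderSum-sum as xs G))

  -- Normalisation, and the identity for generic variables

  module _ (1≉0 : 1# ≉ 0#) (1-tʲ≉0 : ∀ j → 1# - t ^ suc j ≉ 0#) where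

    product-≉0 : ∀ {A : Set} (as : List A) {f} → (∀ {a} → a ∈ as → f a ≉ 0#) → Prod.fold as f ≉ 0#
    product-≉0 []       e = 1≉0
    product-≉0 (a ∷ as) e = *-≉0 (e (here ≡.refl)) (product-≉0 as (e ∘ there))

    power-≉0 : ∀ {a} → a ≉ 0# → ∀ n → a ^ n ≉ 0#
    power-≉0 a≉0 zero    = 1≉0
    power-≉0 a≉0 (suc n) = *-≉0 a≉0 (power-≉0 a≉0 n)

    ⁻¹-≉0 : ∀ {a} → a ≉ 0# → a ⁻¹ ≉ 0#
    ⁻¹-≉0 {a} a≉0 e = 1≉0 (trans (sym (inverseʳ a a≉0)) (trans (*-congˡ e) (zeroʳ a)))

    1-t≉0 : 1# - t ≉ 0#
    1-t≉0 e = 1-tʲ≉0 0 (trans (+-congˡ (-‿cong (*-identityʳ t))) e)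

    factor-≉0 : ∀ {n j} → j ∈ [1⋯ n ] → 1# - t ^ j ≉ 0#
    factor-≉0 {n} j∈ with ∈-map⁻ suc j∈
    ... | j , _ , ≡.refl = 1-tʲ≉0 j

    product-scale : ∀ {A : Set} (as : List A) f c → Prod.fold as (λ a → f a * c) ≈ Prod.fold as f * c ^ length as
    product-scale []       f c = sym (*-identityˡ 1#)
    product-scale (a ∷ as) f c = trans (*-congˡ (product-scale as f c))
      (solve 4 (λ f c F C → f :* c :* (F :* C) := f :* F :* (c :* C)) refl (f a) c _ _)

    multiplicities : ∀ {μ n} c → All (λ p → 0 ℕ.< p × p ℕ.≤ n) μ →
                     Prod.fold [1⋯ n ] (λ i → c ^ multiplicity μ i) ≈ c ^ length μ
    multiplicities {[]}    {n} c []            = Prod.fold-ε [1⋯ n ] (λ _ → refl)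
    multiplicities {p ∷ μ} {n} c ((0<p , p≤n) ∷ bounds) = begin
      Prod.fold [1⋯ n ] (λ i → c ^ multiplicity (p ∷ μ) i)
        ≈⟨ Prod.fold-cong [1⋯ n ] (λ {i} _ → split i) ⟩
      Prod.fold [1⋯ n ] (λ i → Prod.keep (i ℕ.≟ p) c * c ^ multiplicity μ i)
        ≈⟨ Prod.fold-∙ [1⋯ n ] _ _ ⟩
      Prod.fold [1⋯ n ] (λ i → Prod.keep (i ℕ.≟ p) c) * Prod.fold [1⋯ n ] (λ i → c ^ multiplicity μ i)
        ≈⟨ *-cong (Prod.fold-single (ℕ._≟ p) (λ _ → c) (Uniqueₚ.map⁺ ℕₚ.suc-injective (Uniqueₚ.upTo⁺ n))
                    (p∈ 0<p p≤n) ≡.refl id) (multiplicities c bounds) ⟩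
      c * c ^ length μ ∎
      where
      p∈ : ∀ {p} → 0 ℕ.< p → p ℕ.≤ n → p ∈ [1⋯ n ]
      p∈ {suc p} _ p≤n = ∈-map⁺ suc (∈-upTo⁺ p≤n)
      split : ∀ i → c ^ multiplicity (p ∷ μ) i ≈ Prod.keep (i ℕ.≟ p) c * c ^ multiplicity μ i
      split i with i ℕ.≟ p
      ... | yes ≡.refl = reflexive (≡.cong (c ^_) (multiplicity-≡ i μ))
      ... | no i≢p     = trans (reflexive (≡.cong (c ^_) (multiplicity-≢ μ i≢p))) (sym (*-identityˡ _))

    v₀ : ℕ → Carrier
    v₀ m = ∏[ j ∈ [1⋯ m ] ] ((1# - t ^ j) / (1# - t))

    -- This is b_μ/v_μ in M variables: the factors 1 - t^j belonging to the parts cancel, and v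
    -- retains the product for m₀ and one factor 1/(1 - t) per part.
    normalisation : ℕ → ℕ → Carrier
    normalisation M ℓ = (v₀ (M ∸ ℓ) * ((1# - t) ⁻¹) ^ ℓ) ⁻¹

    v-b : ∀ M {μ} → IsPartition μ → v M μ ≈ v₀ (M ∸ length μ) * (b μ * ((1# - t) ⁻¹) ^ length μ)
    v-b M {μ} μ-part = *-congˡ (begin
      Prod.fold [1⋯ part μ 0 ] (λ i → Prod.fold [1⋯ multiplicity μ i ] (λ j → (1# - t ^ j) * s))
        ≈⟨ Prod.fold-cong [1⋯ part μ 0 ] (λ {i} _ → trans (product-scale [1⋯ multiplicity μ i ] _ s)
             (*-congˡ (reflexive (≡.cong (s ^_) (length-[1⋯] (multiplicity μ i)))))) ⟩
      Prod.fold [1⋯ part μ 0 ] (λ i → Prod.fold [1⋯ multiplicity μ i ] (λ j → 1# - t ^ j) * s ^ multiplicity μ i)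
        ≈⟨ Prod.fold-∙ [1⋯ part μ 0 ] _ _ ⟩
      b μ * Prod.fold [1⋯ part μ 0 ] (λ i → s ^ multiplicity μ i)
        ≈⟨ *-congˡ (multiplicities s (partition-bounds μ-part ℕₚ.≤-refl)) ⟩
      b μ * s ^ length μ ∎)
      where
      s = (1# - t) ⁻¹
      length-[1⋯] : ∀ n → length [1⋯ n ] ≡ n
      length-[1⋯] n = ≡.trans (Listₚ.length-map suc (upTo n)) (Listₚ.length-upTo n)

    b-v : ∀ M {μ} → IsPartition μ → b μ * v M μ ⁻¹ ≈ normalisation M (length μ)
    b-v M {μ} μ-part = ⁻¹-unique (*-≉0 v₀≉0 s≉0) (begin
      V * S * (b μ * v M μ ⁻¹)
        ≈⟨ *-congˡ (*-congˡ (⁻¹-cong (V≉0 ∘ trans (sym (v-b M μ-part))) (v-b M μ-part))) ⟩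
      V * S * (b μ * (V * (b μ * S)) ⁻¹)
        ≈⟨ solve 4 (λ V S b i → V :* S :* (b :* i) := V :* (b :* S) :* i) refl V S (b μ) _ ⟩
      V * (b μ * S) * (V * (b μ * S)) ⁻¹
        ≈⟨ inverseʳ _ V≉0 ⟩
      1# ∎)
      where
      V = v₀ (M ∸ length μ)
      S = ((1# - t) ⁻¹) ^ length μ
      v₀≉0 : V ≉ 0#
      v₀≉0 = product-≉0 [1⋯ M ∸ length μ ] (λ j∈ → *-≉0 (factor-≉0 {M ∸ length μ} j∈) (⁻¹-≉0 1-t≉0))
      s≉0 : S ≉ 0#
      s≉0 = power-≉0 (⁻¹-≉0 1-t≉0) (length μ)
      b≉0 : b μ ≉ 0#
      b≉0 = product-≉0 [1⋯ part μ 0 ] (λ {i} _ → product-≉0 [1⋯ multiplicity μ i ]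
              (factor-≉0 {multiplicity μ i}))
      V≉0 : V * (b μ * S) ≉ 0#
      V≉0 = *-≉0 v₀≉0 (*-≉0 b≉0 s≉0)

    symmetrization : List ℕ → ∀ {n} → Vec Carrier n → Carrier
    symmetrization μ r = orderSum r (λ ys → kernel ys * monomial (part μ) ys)

    Q-symmetrization : ∀ {M μ} → IsPartition μ → (x : Vector Carrier M) →
      Q μ x ≈ normalisation M (length μ) * symmetrization μ (tabulate x)
    Q-symmetrization {M} {μ} μ-part x = trans (sym (*-assoc _ _ _)) (*-cong (b-v M μ-part) (sym (trans
      (orderSum-permutations x _)
      (Sum.fold-cong (permutations M) (λ {π} _ → trans (*-comm _ _)
        (*-cong (sym (monomial-tabulate (part μ) (x ∘ (π ⟨$⟩ʳ_))))
                (sym (Pairs-orderedPairs κ (x ∘ (π ⟨$⟩ʳ_))))))))))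

    vanishing : t ≉ 0# → ∀ {lam} → IsPartition lam → ∀ m {M} → length lam ℕ.+ m ≡ M →
      (x : Vector Carrier (suc M)) → AllPairs Generic (tabulate x) →
      (∑[ i ∈ allFin (suc M) ]
        ((- 1#) ^ toℕ i * x i ^ M * Δ (removeAt x i)
          * (Q lam (removeAt x i) * (1# - t ^ length lam)
             + (∑[ μ ∈ innerIndices lam ]
                  (x i ^ weightDifference lam μ * Q μ (removeAt x i) * φ lam μ))))) ≈ 0#
    -- The factor t^m accounts for the m zeros that pad λ to M parts: it turns the sum over μ into
    -- `U` and t^ℓ(λ) into t^M.
    vanishing t≉0 {lam} lam-part m {M} ≡.refl x x-gen = cancelˡ (power-≉0 t≉0 m) (begin
      t ^ m * Sum.fold (allFin (suc M)) summand
        ≈⟨ sum-* (allFin (suc M)) (t ^ m) summand ⟨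
      Sum.fold (allFin (suc M)) (λ i → t ^ m * summand i)
        ≈⟨ Sum.fold-cong (allFin (suc M)) (λ {i} _ → rewritten i) ⟩
      Sum.fold (allFin (suc M)) (λ i → Δ x * C * orderSum (r i) (integrand (x i)))
        ≈⟨ sum-* (allFin (suc M)) (Δ x * C) _ ⟩
      Δ x * C * Sum.fold (allFin (suc M)) (λ i → orderSum (r i) (integrand (x i)))
        ≈⟨ *-congˡ (selectSum-tabulate x (λ z r → orderSum r (integrand z))) ⟨
      Δ x * C * selectSum (tabulate x) (λ z r → orderSum r (integrand z))
        ≈⟨ *-congˡ (symmetrized-vanishes (part-decreasing lam-part) (part-0 lam (ℕₚ.m≤m+n _ m)) x-gen) ⟩
      Δ x * C * 0#
        ≈⟨ trans (zeroʳ _) (sym (zeroʳ _)) ⟩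
      t ^ m * 0# ∎)
      where
      ℓ = length lam
      C = normalisation M ℓ
      r : Fin (suc M) → Vec Carrier M
      r i = tabulate (removeAt x i)
      inner : Fin (suc M) → Carrier
      inner i = Q lam (removeAt x i) * (1# - t ^ ℓ)
        + Sum.fold (innerIndices lam) (λ μ → x i ^ weightDifference lam μ * Q μ (removeAt x i) * φ lam μ)
      summand : Fin (suc M) → Carrier
      summand i = (- 1#) ^ toℕ i * x i ^ M * Δ (removeAt x i) * inner i
      integrand : Carrier → Vec Carrier M → Carrier
      integrand z ys = lagrange M z ys * (kernel ys * (U (part lam) z ys - t ^ M * monomial (part lam) ys))
      weighted : Fin (suc M) → List ℕ → Carrier
      weighted i μ = x i ^ weightDifference lam μ * symmetrization μ (r i)

      weighted-lam : ∀ i → weighted i lam ≈ symmetrization lam (r i)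
      weighted-lam i = trans (*-congʳ (reflexive (≡.cong (x i ^_) (weightDifference-refl lam)))) (*-identityˡ _)

      -- As ℓ(μ) = ℓ(λ) throughout, `C` is common to all the Q's. Expanding 1 - t^ℓ(λ) supplies the
      -- term μ = λ and the one that is subtracted.
      inner-weighted : ∀ i → inner i
        ≈ C * (Sum.fold (listsBelow lam) (λ μ → branch lam μ * weighted i μ) - t ^ ℓ * weighted i lam)
      inner-weighted i = begin
        inner i
          ≈⟨ +-cong (*-congʳ (trans (Q-symmetrization lam-part (removeAt x i)) (*-congˡ (sym (weighted-lam i)))))
               (trans (Sum.fold-cong (innerIndices lam) scaled) (sum-* (innerIndices lam) C _)) ⟩
        C * w * (1# - t ^ ℓ) + C * s
          ≈⟨ solve 4 (λ C w τ s → C :* w :* (con (+ 1) :- τ) :+ C :* s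
               := C :* (w :+ s :- τ :* w)) refl C w (t ^ ℓ) s ⟩
        C * (w + s - t ^ ℓ * w)
          ≈⟨ *-congˡ (+-congʳ (inner-sum lam-part (weighted i))) ⟩
        C * (Sum.fold (listsBelow lam) (λ μ → branch lam μ * weighted i μ) - t ^ ℓ * w) ∎
        where
        w = weighted i lam
        s = Sum.fold (innerIndices lam) (λ μ → weighted i μ * φ lam μ)
        scaled : ∀ {μ} → μ ∈ innerIndices lam →
          x i ^ weightDifference lam μ * Q μ (removeAt x i) * φ lam μ ≈ C * (weighted i μ * φ lam μ)
        scaled {μ} μ∈ with ∈-innerIndices⁻ {lam} μ∈
        ... | μ-part , ℓ≡ , _ = trans
          (*-congʳ (*-congˡ (trans (Q-symmetrization μ-part (removeAt x i))
                                   (*-congʳ (reflexive (≡.cong (normalisation M) ℓ≡))))))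
          (solve 4 (λ z C S f → z :* (C :* S) :* f := C :* (z :* S :* f)) refl _ C _ _)

      branch-weighted : ∀ i →
        t ^ m * (Sum.fold (listsBelow lam) (λ μ → branch lam μ * weighted i μ) - t ^ ℓ * weighted i lam)
          ≈ orderSum (r i) (λ ys → kernel ys * (U (part lam) (x i) ys - t ^ M * monomial (part lam) ys))
      branch-weighted i = sym (begin
        orderSum (r i) (λ ys → kernel ys * (U (part lam) (x i) ys - t ^ M * monomial (part lam) ys))
          ≈⟨ orderSum-cong (r i) (λ {ys} _ → expand ys) ⟩
        orderSum (r i) (λ ys → t ^ m * (Sum.fold (listsBelow lam) (λ μ → G μ ys) + - t ^ ℓ * H ys))
          ≈⟨ trans (orderSum-* (r i) (t ^ m) _) (*-congˡ (trans (orderSum-+ (r i) _ _)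
               (+-cong (orderSum-sum (listsBelow lam) (r i) G) (orderSum-* (r i) (- t ^ ℓ) H)))) ⟩
        t ^ m * (Sum.fold (listsBelow lam) (λ μ → orderSum (r i) (G μ)) + - t ^ ℓ * symmetrization lam (r i))
          ≈⟨ *-congˡ (+-cong
               (Sum.fold-cong (listsBelow lam) (λ {μ} _ → trans (orderSum-* (r i) _ _) (*-assoc _ _ _)))
               (trans (*-congˡ (sym (weighted-lam i)))
                      (solve 2 (λ a b → (:- a) :* b := :- (a :* b)) refl (t ^ ℓ) _))) ⟩
        t ^ m * (Sum.fold (listsBelow lam) (λ μ → branch lam μ * weighted i μ) - t ^ ℓ * weighted i lam) ∎)
        where
        H : Vec Carrier M → Carrier
        H ys = kernel ys * monomial (part lam) ys
        G : List ℕ → Vec Carrier M → Carrier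
        G μ ys = branch lam μ * x i ^ weightDifference lam μ * (kernel ys * monomial (part μ) ys)
        expand : ∀ ys → kernel ys * (U (part lam) (x i) ys - t ^ M * monomial (part lam) ys)
          ≈ t ^ m * (Sum.fold (listsBelow lam) (λ μ → G μ ys) + - t ^ ℓ * H ys)
        expand ys = begin
          k * (U (part lam) (x i) ys - t ^ M * e)
            ≈⟨ *-congˡ (+-cong (proj₁ (branch-sum (x i) lam lam-part {m} ys))
                               (-‿cong (*-congʳ (^-homo-* t ℓ m)))) ⟩
          k * (t ^ m * s - t ^ ℓ * t ^ m * e)
            ≈⟨ solve 5 (λ k τ s σ e → k :* (τ :* s :- σ :* τ :* e) := τ :* (k :* s :+ (:- σ) :* (k :* e)))
                 refl k (t ^ m) s (t ^ ℓ) e ⟩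
          t ^ m * (k * s + - t ^ ℓ * (k * e))
            ≈⟨ *-congˡ (+-congʳ (trans (sym (sum-* (listsBelow lam) k _)) (Sum.fold-cong (listsBelow lam) (λ {μ} _ →
                 solve 4 (λ k b z e → k :* (b :* (z :* e)) := b :* z :* (k :* e)) refl k (branch lam μ)
                   (x i ^ weightDifference lam μ) (monomial (part μ) ys))))) ⟩
          t ^ m * (Sum.fold (listsBelow lam) (λ μ → G μ ys) + - t ^ ℓ * (k * e)) ∎
          where
          k = kernel ys
          e = monomial (part lam) ys
          s = Sum.fold (listsBelow lam) (λ μ → branch lam μ * term (x i) lam μ ys)

      rewritten : ∀ i → t ^ m * summand i ≈ Δ x * C * orderSum (r i) (integrand (x i))
      rewritten i = begin
        t ^ m * ((- 1#) ^ toℕ i * x i ^ M * Δ (removeAt x i) * inner i)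
          ≈⟨ *-congˡ (*-cong (Δ-lagrange x x-gen i) (inner-weighted i)) ⟩
        t ^ m * (Δ x * L * (C * w))
          ≈⟨ solve 5 (λ τ D L C w → τ :* (D :* L :* (C :* w)) := D :* C :* (L :* (τ :* w))) refl (t ^ m) (Δ x) L C w ⟩
        Δ x * C * (L * (t ^ m * w))
          ≈⟨ *-congˡ (*-congˡ (branch-weighted i)) ⟩
        Δ x * C * (L * orderSum (r i) (λ ys → kernel ys * (U (part lam) (x i) ys - t ^ M * monomial (part lam) ys)))
          ≈⟨ *-congˡ (orderSum-* (r i) L _) ⟨
        Δ x * C * orderSum (r i) (λ ys → L * (kernel ys * (U (part lam) (x i) ys - t ^ M * monomial (part lam) ys)))
          -- The factor `L` is symmetric in the remaining variables, so it may be evaluated at each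
          -- ordering instead of at `r i`.
          ≈⟨ *-congˡ (orderSum-cong (r i) (λ o → *-congʳ (*-congˡ (Π-orders (λ w → (x i - w) ⁻¹) o)))) ⟩
        Δ x * C * orderSum (r i) (integrand (x i)) ∎
        where
        L = lagrange M (x i) (r i)
        w = Sum.fold (listsBelow lam) (λ μ → branch lam μ * weighted i μ) - t ^ ℓ * weighted i lam

-- Nonvanishing of the denominators

t-poly≉0 : ∀ N → let open DecidableDomain (ℤ[t][x] N) in t-poly N ≉ 0#
t-poly≉0 zero    e = DecidableDomain.1≉0 ℤ-domain (ℤ[t].at e 1)
t-poly≉0 (suc N) e = t-poly≉0 N (Polynomials.at e 0)

-- Setting t and all variables to 0 would give 1 = 0. With a power of t for p, this shows that 1 -
-- t^(j+1) is not zero.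
1≉t-poly* : ∀ N p → let open DecidableDomain (ℤ[t][x] N) in 1# ≉ t-poly N * p
1≉t-poly* zero    []      e = 1≉0 (ℤ[t].at e 0)
  where open DecidableDomain ℤ-domain
1≉t-poly* zero    (a ∷ p) e = 1≉0 (trans (ℤ[t].at e 0) (trans (+-identityʳ _) (zeroˡ a)))
  where open DecidableDomain ℤ-domain
1≉t-poly* (suc N) []      e = 1≉0 (Polynomials.at e 0)
  where open DecidableDomain (ℤ[t][x] N)
1≉t-poly* (suc N) (a ∷ p) e = 1≉t-poly* N a (trans (Polynomials.at e 0) (+-identityʳ _))
  where open DecidableDomain (ℤ[t][x] N)

x-poly-distinct : ∀ N {i j} → i ≢ j → let open DecidableDomain (ℤ[t][x] N) in x-poly N i ≉ x-poly N j
x-poly-distinct (suc N) {Fin.zero}  {Fin.zero}  i≢j e = i≢j ≡.refl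
x-poly-distinct (suc N) {Fin.zero}  {Fin.suc j} i≢j e = 1≉0 (Polynomials.at e 1)
  where open DecidableDomain (ℤ[t][x] N)
x-poly-distinct (suc N) {Fin.suc i} {Fin.zero}  i≢j e = 1≉0 (sym (Polynomials.at e 1))
  where open DecidableDomain (ℤ[t][x] N)
x-poly-distinct (suc N) {Fin.suc i} {Fin.suc j} i≢j e =
  x-poly-distinct N (i≢j ∘ ≡.cong Fin.suc) (Polynomials.at e 0)

-- The coefficient of the variable with the smaller index is 1 or t on its own side and 0 on the
-- other.
x-poly≉t*x-poly : ∀ N {i j} → i ≢ j → let open DecidableDomain (ℤ[t][x] N) in
                  x-poly N i ≉ t-poly N * x-poly N j
x-poly≉t*x-poly (suc N) {Fin.zero}  {Fin.zero}  i≢j e = i≢j ≡.refl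
x-poly≉t*x-poly (suc N) {Fin.zero}  {Fin.suc j} i≢j e = 1≉0 (Polynomials.at e 1)
  where open DecidableDomain (ℤ[t][x] N)
x-poly≉t*x-poly (suc N) {Fin.suc i} {Fin.zero}  i≢j e =
  t-poly≉0 N (trans (sym (*-identityʳ _)) (sym (Polynomials.at e 1)))
  where open DecidableDomain (ℤ[t][x] N)
x-poly≉t*x-poly (suc N) {Fin.suc i} {Fin.suc j} i≢j e =
  x-poly≉t*x-poly N (i≢j ∘ ≡.cong Fin.suc)
    (trans (Polynomials.at e 0) (+-identityʳ _))
  where open DecidableDomain (ℤ[t][x] N)

-- Passage to the field of rational functions

module Embedding (D : DecidableDomain) where
  open Fractions D
  private
    module D = DecidableDomain D
    module K = CommutativeRing fractionField

  embed-* : ∀ a c → (embed a K.* embed c) K.≈ embed (a D.* c)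
  embed-* a c = cross (D.trans (D.*-identityʳ _) (D.sym (D.trans (D.*-congˡ (D.*-identityʳ _)) (D.*-identityʳ _))))

  embed-≉0 : ∀ {a} → a D.≉ D.0# → embed a K.≉ K.0#
  embed-≉0 a≉0 (cross e) = a≉0 (D.trans (D.sym (D.*-identityʳ _)) (D.trans e (D.zeroˡ _)))

  embed-difference-≉0 : ∀ {a c} → a D.≉ c → embed a K.- embed c K.≉ K.0#
  embed-difference-≉0 {a} {c} a≉c e = a≉c (begin
    a                                 ≈⟨ D.*-identityʳ a ⟨
    a D.* D.1#                        ≈⟨ crossEq embed-a≈embed-c ⟩
    c D.* D.1#                        ≈⟨ D.*-identityʳ c ⟩
    c                                 ∎)
    where
    open SetoidReasoning D.setoid
    embed-a≈embed-c : embed a K.≈ embed c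
    embed-a≈embed-c = RingProperties.x∙y⁻¹≈ε⇒x≈y K.ring (embed a) (embed c) e

module _ (N : ℕ) where
  open RationalFunctions N
  open CommutativeRing fractionField
  open Embedding (ℤ[t][x] N)
  open Fractions (ℤ[t][x] N) using (⁻¹-inverseʳ)
  open HallLittlewood fractionField _⁻¹ t using (_^_)
  open HallLittlewoodIdentity fractionField _⁻¹ t ⁻¹-inverseʳ using (Generic)

  -- Multiplying fractions multiplies denominators, so a power of t is only equivalent to a
  -- polynomial; `1≉t-poly*` takes the polynomial itself.
  t-power : ∀ k → ∃ λ p → t ^ k ≈ embed p
  t-power zero    = _ , refl
  t-power (suc k) with t-power k
  ... | p , tᵏ≈p = _ , trans (*-congˡ {t} tᵏ≈p) (embed-* (t-poly N) p)

  t≉0 : t ≉ 0#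
  t≉0 = embed-≉0 (t-poly≉0 N)

  1-tʲ≉0 : ∀ j → 1# - t ^ suc j ≉ 0#
  1-tʲ≉0 j e with t-power j
  ... | p , tʲ≈p = embed-difference-≉0 (1≉t-poly* N p)
    (trans (+-congˡ {1#} (-‿cong (sym (trans (*-congˡ {t} tʲ≈p) (embed-* (t-poly N) p))))) e)

  x-generic : AllPairs Generic (tabulate x)
  x-generic = AllPairsₚ.tabulate⁺ λ i≢j →
    embed-difference-≉0 (x-poly-distinct N i≢j) , scaled i≢j , scaled (i≢j ∘ ≡.sym)
    where
    scaled : ∀ {i j} → i ≢ j → x i - t * x j ≉ 0#
    scaled {i} {j} i≢j e = embed-difference-≉0 (x-poly≉t*x-poly N i≢j)
      (trans (+-congˡ {x i} (-‿cong (sym (embed-* (t-poly N) (x-poly N j))))) e)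

mainTheorem3 : ∀ (M : ℕ) (lam : List ℕ) →
    let N = suc M
        open RationalFunctions N
        open CommutativeRing fractionField
        open HallLittlewood fractionField _⁻¹ t
    in
    IsPartition lam → 0 ℕ.< length lam → length lam ℕ.< N →
    -- i is counted from 0, so (-1)^{i+1} of the 1-based formula is (- 1#) ^ toℕ i.
    (∑[ i ∈ allFin N ]
      ((- 1#) ^ toℕ i * x i ^ M * Δ (removeAt x i)
        * (Q lam (removeAt x i) * (1# - t ^ length lam)
           + (∑[ μ ∈ innerIndices lam ]
                (x i ^ weightDifference lam μ * Q μ (removeAt x i) * φ lam μ)))))
      ≈ 0#
mainTheorem3 M lam lam-part _ ℓ<N =
  HallLittlewoodIdentity.vanishing fractionField _⁻¹ t ⁻¹-inverseʳ (embed-≉0 1≉0) (1-tʲ≉0 (suc M)) (t≉0 (suc M))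
    -- As N = M + 1, the bound ℓ(λ) < N says that λ is padded to M parts by M - ℓ(λ) zeros.
    lam-part (M ∸ length lam) (ℕₚ.m+[n∸m]≡n (ℕₚ.≤-pred ℓ<N)) x (x-generic (suc M))
  where
  open RationalFunctions (suc M)
  open Embedding (ℤ[t][x] (suc M))
  open Fractions (ℤ[t][x] (suc M)) using (⁻¹-inverseʳ)
  open DecidableDomain (ℤ[t][x] (suc M)) using (1≉0)
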